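{- There is an absolute constant $C>0$ such that for every $n$ and every graph $H\subseteq K_n$ with at least one edge, the uniform probability measure $\nu_H$ on the copies of $H$ in $K_n$ is $C\,\Delta(H)^{2/d_*(H)}\,q_H$-spread.
   Context: All graphs are finite and simple; $v(G)$ and $e(G)$ are the numbers of vertices and edges of $G$, and $\Delta(G)$ is its maximum degree. A graph is nonempty if it has at least one edge. Isolated vertices are omitted, so a subgraph is identified with its edge set together with the endpoints of these edges; subgraphs need not be induced or connected. The maximum subgraph average degree is $d_*(H):=\max_{\varnothing\ne J\subseteq H}\frac{2e(J)}{v(J)}$, over nonempty subgraphs $J$ of $H$. A copy of $H$ in $K_n$ is a subgraph of $K_n$ isomorphic to $H$, and $N_I(G)$ denotes the number of copies of $I$ in $G$. $\nu_H$ is the uniform probability measure on the copies of $H$ in $K_n$. For nonempty $H\subseteq K_n$, $$q_H:=\max_{\varnothing\ne I\subseteq H}N_I(K_n)^{ -1/e(I)},$$ the maximum being over all nonempty subgraphs $I$ of $H$. A probability measure $\mu$ on subgraphs of $K_n$ is $a$-spread if $\mu(\{S:A\subseteq E(S)\})\le a^{|A|}$ for every nonempty edge set $A\subseteq E(K_n)$. -}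

module Defs where

open import Algebra.Bundles using (CommutativeRing)
open import Data.Bool.Base using (true; false; if_then_else_)
open import Data.Fin.Base as Fin using (Fin; finToFun; funToFin)
open import Data.Fin.Properties as Fin using (any?; all?; finToFun-funToFin)
open import Data.Fin.Subset using (Subset; inside; outside; ⊤; ⁅_⁆; _∈_; _⊆_; _∩_; ∣_∣; Nonempty)
open import Data.Fin.Subset.Properties
  using (_∈?_; _⊆?_; nonempty?; ⊆⊤; ⊆-refl; p⊆q⇒∣p∣≤∣q∣; ∣⁅x⁆∣≡1; x∈⁅y⁆⇒x≡y; x∈p∩q⁺)
open import Data.Integer.Base as ℤ using (ℤ; +_; -[1+_])
import Data.Integer.Properties as ℤ
open import Data.List.Base as List
  using (List; []; _∷_; _++_; map; filter; length; foldr; lookup; allFin; cartesianProduct; mapMaybe)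
import Data.List.Extrema
import Data.List.Extrema.Nat as ℕᴱ
open import Data.List.Membership.Propositional using () renaming (_∈_ to _∈ˡ_)
open import Data.List.Membership.Propositional.Properties
  using (∈-++⁺ˡ; ∈-++⁺ʳ; ∈-map⁺; ∈-filter⁺; ∈-allFin)
open import Data.List.Relation.Unary.Any using (here)
import Data.List.Relation.Unary.All as All
import Data.Maybe.Base as Maybe
open import Data.Nat.Base as ℕ using (ℕ; zero; suc; NonZero; >-nonZero)
import Data.Nat.Properties as ℕ
open import Data.Product.Base using (Σ; ∃; ∃-syntax; _×_; _,_; proj₁; proj₂)
open import Data.Product.Properties using (≡-dec)
open import Data.Rational.Base as ℚ using (ℚ; 0ℚ; 1ℚ; _/_; _÷_; ↥_; ↧ₙ_; -_)
import Data.Rational.Properties as ℚ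
import Data.Rational.Unnormalised.Base as ℚᵘ
import Data.Rational.Unnormalised.Properties as ℚᵘ
open import Data.Sum.Base using (_⊎_; inj₁; inj₂)
open import Data.Vec.Base as Vec using (here; there)
open import Data.Vec.Properties using (lookup⇒[]=; lookup∘tabulate)
open import Function.Base using (_∘_)
open import Function.Bundles using (_↔_; _⇔_; mk↔ₛ′; mk⇔; Inverse; Equivalence)
open import Function.Construct.Identity using (↔-id; ⇔-id)
open import Level using (Level; 0ℓ)
open import Relation.Binary.Bundles using (TotalOrder; DecTotalOrder)
open import Relation.Binary.PropositionalEquality
open import Relation.Nullary using (Dec; yes; no; does)
open import Relation.Nullary.Decidable
  using (_×-dec_; _⊎-dec_; _→-dec_; map′; dec⇒maybe; dec-true)
open import Relation.Nullary.Negation using (contradiction)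
open import Relation.Unary using (Pred; Decidable)

open import Algebra.Properties.CommutativeSemiring.Exp
  (CommutativeRing.commutativeSemiring ℚ.+-*-commutativeRing)
  using (_^_; ^-assocʳ) public

private
  variable
    ℓ : Level
    n : ℕ

-- `root k x` denotes the real number x^(1/k).  The nonnegative reals of
-- this form contain the rationals ≥ 0 and are closed under products and
-- rational powers; their order is decided by comparing rationals.

record Surd : Set where
  constructor root
  field
    index       : ℕ
    radicand    : ℚ
    {{index≢0}} : NonZero index
    radicand≥0  : 0ℚ ℚ.≤ radicand

open Surd public using (index; radicand)

-- x^(1/k) ≤ y^(1/l) as real numbers iff x^l ≤ y^k.
infix 4 _≤ˢ_ _≈ˢ_

_≤ˢ_ : Surd → Surd → Set
a ≤ˢ b = radicand a ^ index b ℚ.≤ radicand b ^ index a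

-- Equality of the denoted reals; representations are not unique.
_≈ˢ_ : Surd → Surd → Set
a ≈ˢ b = a ≤ˢ b × b ≤ˢ a

Positiveˢ : Surd → Set
Positiveˢ a = 0ℚ ℚ.< radicand a

*-nonNeg : ∀ {x y} → 0ℚ ℚ.≤ x → 0ℚ ℚ.≤ y → 0ℚ ℚ.≤ x ℚ.* y
*-nonNeg {x} {y} 0≤x 0≤y = subst (ℚ._≤ x ℚ.* y) (ℚ.*-zeroʳ x)
  (ℚ.*-monoˡ-≤-nonNeg x {{ℚ.nonNegative 0≤x}} 0≤y)

^-nonNeg : ∀ {x} → 0ℚ ℚ.≤ x → ∀ k → 0ℚ ℚ.≤ x ^ k
^-nonNeg 0≤x zero    = ℚ.nonNegative⁻¹ 1ℚ
^-nonNeg 0≤x (suc k) = *-nonNeg 0≤x (^-nonNeg 0≤x k)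

^-mono-≤ : ∀ {x y} → 0ℚ ℚ.≤ x → x ℚ.≤ y → ∀ k → x ^ k ℚ.≤ y ^ k
^-mono-≤         0≤x x≤y zero    = ℚ.≤-refl
^-mono-≤ {x} {y} 0≤x x≤y (suc k) = ℚ.≤-trans
  (ℚ.*-monoˡ-≤-nonNeg x {{ℚ.nonNegative 0≤x}} (^-mono-≤ 0≤x x≤y k))
  (ℚ.*-monoʳ-≤-nonNeg (y ^ k) {{ℚ.nonNegative (^-nonNeg (ℚ.≤-trans 0≤x x≤y) k)}} x≤y)

^-mono-< : ∀ {x y} → 0ℚ ℚ.≤ x → x ℚ.< y → ∀ k → {{NonZero k}} → x ^ k ℚ.< y ^ k
^-mono-< {x} {y} 0≤x x<y (suc k) = ℚ.≤-<-trans
  (ℚ.*-monoˡ-≤-nonNeg x {{ℚ.nonNegative 0≤x}} (^-mono-≤ 0≤x (ℚ.<⇒≤ x<y) k))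
  (ℚ.*-monoˡ-<-pos (y ^ k) {{ℚ.positive (y^k>0 k)}} x<y)
  where
  y^k>0 : ∀ j → 0ℚ ℚ.< y ^ j
  y^k>0 zero    = ℚ.positive⁻¹ 1ℚ
  y^k>0 (suc j) = subst (ℚ._< y ℚ.* y ^ j) (ℚ.*-zeroʳ y)
    (ℚ.*-monoʳ-<-pos y {{ℚ.positive (ℚ.≤-<-trans 0≤x x<y)}} (y^k>0 j))

^-cancel-≤ : ∀ {x y} → 0ℚ ℚ.≤ y → ∀ k → {{NonZero k}} → x ^ k ℚ.≤ y ^ k → x ℚ.≤ y
^-cancel-≤ {x} {y} 0≤y k xᵏ≤yᵏ with x ℚ.≤? y
... | yes x≤y = x≤y
... | no  x≰y = contradiction (ℚ.<-≤-trans (^-mono-< 0≤y (ℚ.≰⇒> x≰y) k) xᵏ≤yᵏ) (ℚ.<-irrefl refl)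

^-swap : ∀ x j k → (x ^ j) ^ k ≡ (x ^ k) ^ j
^-swap x j k = trans (^-assocʳ x j k)
  (trans (cong (x ^_) (ℕ.*-comm j k)) (sym (^-assocʳ x k j)))

≤ˢ-refl : ∀ {a} → a ≤ˢ a
≤ˢ-refl = ℚ.≤-refl

≤ˢ-trans : ∀ {a b c} → a ≤ˢ b → b ≤ˢ c → a ≤ˢ c
≤ˢ-trans {root k x 0≤x} {root l y {{l≢0}} 0≤y} {root m z 0≤z} xˡ≤yᵏ yᵐ≤zˡ =
  ^-cancel-≤ (^-nonNeg 0≤z k) l {{l≢0}} (begin
    (x ^ m) ^ l  ≡⟨ ^-swap x m l ⟩
    (x ^ l) ^ m  ≤⟨ ^-mono-≤ (^-nonNeg 0≤x l) xˡ≤yᵏ m ⟩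
    (y ^ k) ^ m  ≡⟨ ^-swap y k m ⟩
    (y ^ m) ^ k  ≤⟨ ^-mono-≤ (^-nonNeg 0≤y m) yᵐ≤zˡ k ⟩
    (z ^ l) ^ k  ≡⟨ ^-swap z l k ⟩
    (z ^ k) ^ l  ∎)
  where open ℚ.≤-Reasoning

≤ˢ-totalOrder : TotalOrder 0ℓ 0ℓ 0ℓ
≤ˢ-totalOrder = record
  { Carrier      = Surd
  ; _≈_          = _≈ˢ_
  ; _≤_          = _≤ˢ_
  ; isTotalOrder = record
    { isPartialOrder = record
      { isPreorder = record
        { isEquivalence = record
          { refl  = λ {a} → ≤ˢ-refl {a} , ≤ˢ-refl {a}
          ; sym   = λ (a≤b , b≤a) → b≤a , a≤b
          ; trans = λ {a} {b} {c} (a≤b , b≤a) (b≤c , c≤b) →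
              ≤ˢ-trans {a} {b} {c} a≤b b≤c , ≤ˢ-trans {c} {b} {a} c≤b b≤a
          }
        ; reflexive = proj₁
        ; trans     = λ {a} {b} {c} → ≤ˢ-trans {a} {b} {c}
        }
      ; antisym = _,_
      }
    ; total = λ a b → ℚ.≤-total (radicand a ^ index b) (radicand b ^ index a)
    }
  }

ℚ-totalOrder : TotalOrder 0ℓ 0ℓ 0ℓ
ℚ-totalOrder = DecTotalOrder.totalOrder ℚ.≤-decTotalOrder

fromℚ : (x : ℚ) → 0ℚ ℚ.≤ x → Surd
fromℚ x 0≤x = root 1 x 0≤x

infixl 7 _*ˢ_
infixr 8 _^ˢ_ _^ℚ_

_*ˢ_ : Surd → Surd → Surd
root k x {{k≢0}} 0≤x *ˢ root l y {{l≢0}} 0≤y =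
  root (k ℕ.* l) (x ^ l ℚ.* y ^ k) {{ℕ.m*n≢0 k l {{k≢0}} {{l≢0}}}}
       (*-nonNeg (^-nonNeg 0≤x l) (^-nonNeg 0≤y k))

_^ˢ_ : Surd → ℕ → Surd
root k x 0≤x ^ˢ m = root k (x ^ m) (^-nonNeg 0≤x m)

_^ℤ_ : (m : ℕ) → .{{NonZero m}} → ℤ → ℚ
m ^ℤ (+ a)    = + (m ℕ.^ a) / 1
m ^ℤ -[1+ a ] = (+ 1 / (m ℕ.^ suc a)) {{ℕ.m^n≢0 m (suc a)}}

^ℤ-nonNeg : ∀ m .{{_ : NonZero m}} i → 0ℚ ℚ.≤ m ^ℤ i
^ℤ-nonNeg m (+ a)    = ℚ.nonNegative⁻¹ _ {{ℚ.normalize-nonNeg (m ℕ.^ a) 1}}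
^ℤ-nonNeg m -[1+ a ] = ℚ.nonNegative⁻¹ _ {{ℚ.normalize-nonNeg 1 (m ℕ.^ suc a) {{ℕ.m^n≢0 m (suc a)}}}}

_^ℚ_ : (m : ℕ) → .{{NonZero m}} → ℚ → Surd
m ^ℚ q = root (↧ₙ q) (m ^ℤ (↥ q)) (^ℤ-nonNeg m (↥ q))

setOf : {P : Pred (Fin n) ℓ} → Decidable P → Subset n
setOf P? = Vec.tabulate (does ∘ P?)

∈-setOf : {P : Pred (Fin n) ℓ} (P? : Decidable P) → ∀ {x} → P x → x ∈ setOf P?
∈-setOf P? {x} px = lookup⇒[]= x _ (trans (lookup∘tabulate _ x) (dec-true (P? x) px))

∈-irrelevant : ∀ {p : Subset n} {x} (i j : x ∈ p) → i ≡ j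
∈-irrelevant here      here      = refl
∈-irrelevant (there i) (there j) = cong there (∈-irrelevant i j)

∈⇒∣p∣≢0 : ∀ {p : Subset n} {x} → x ∈ p → NonZero ∣ p ∣
∈⇒∣p∣≢0 {p = p} {x} x∈p = >-nonZero (subst (ℕ._≤ ∣ p ∣) (∣⁅x⁆∣≡1 x)
  (p⊆q⇒∣p∣≤∣q∣ λ y∈⁅x⁆ → subst (_∈ p) (sym (x∈⁅y⁆⇒x≡y x y∈⁅x⁆)) x∈p))

allSubsets : ∀ n → List (Subset n)
allSubsets zero    = Vec.[] ∷ []
allSubsets (suc n) = map (inside Vec.∷_) (allSubsets n) ++ map (outside Vec.∷_) (allSubsets n)

∈-allSubsets : (p : Subset n) → p ∈ˡ allSubsets n
∈-allSubsets Vec.[]            = here refl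
∈-allSubsets (inside  Vec.∷ p) = ∈-++⁺ˡ (∈-map⁺ _ (∈-allSubsets p))
∈-allSubsets (outside Vec.∷ p) = ∈-++⁺ʳ _ (∈-map⁺ _ (∈-allSubsets p))

∑ : List ℚ → ℚ
∑ = foldr ℚ._+_ 0ℚ

∑-nonNeg : ∀ {A : Set} (f : A → ℚ) → (∀ x → 0ℚ ℚ.≤ f x) → ∀ xs → 0ℚ ℚ.≤ ∑ (map f xs)
∑-nonNeg f 0≤f []       = ℚ.≤-refl
∑-nonNeg f 0≤f (x ∷ xs) = ℚ.+-mono-≤ (0≤f x) (∑-nonNeg f 0≤f xs)

1+k/1 : ∀ k → + suc k / 1 ≡ 1ℚ ℚ.+ + k / 1
1+k/1 k = ℚ.toℚᵘ-injective (begin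
  ℚ.toℚᵘ (+ suc k / 1)                   ≈⟨ ℚ.toℚᵘ-fromℚᵘ (ℚᵘ.mkℚᵘ (+ suc k) 0) ⟩
  ℚᵘ.mkℚᵘ (+ suc k) 0                    ≈⟨ ℚᵘ.*≡* (cong (λ i → (+ 1 ℤ.+ i) ℤ.* + 1) (sym (ℤ.*-identityʳ (+ k)))) ⟩
  ℚᵘ.1ℚᵘ ℚᵘ.+ ℚᵘ.mkℚᵘ (+ k) 0            ≈⟨ ℚᵘ.+-congʳ ℚᵘ.1ℚᵘ (ℚ.toℚᵘ-fromℚᵘ (ℚᵘ.mkℚᵘ (+ k) 0)) ⟨
  ℚᵘ.1ℚᵘ ℚᵘ.+ ℚ.toℚᵘ (+ k / 1)           ≈⟨ ℚ.toℚᵘ-homo-+ 1ℚ (+ k / 1) ⟨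
  ℚ.toℚᵘ (1ℚ ℚ.+ + k / 1)                ∎)
  where
  open ℚᵘ.≃-Reasoning

k/1*1/k : ∀ k .{{_ : NonZero k}} → (+ k / 1) ℚ.* (+ 1 / k) ≡ 1ℚ
k/1*1/k k@(suc k-1) = ℚ.toℚᵘ-injective (begin
  ℚ.toℚᵘ ((+ k / 1) ℚ.* (+ 1 / k))           ≈⟨ ℚ.toℚᵘ-homo-* (+ k / 1) (+ 1 / k) ⟩
  ℚ.toℚᵘ (+ k / 1) ℚᵘ.* ℚ.toℚᵘ (+ 1 / k)     ≈⟨ ℚᵘ.*-cong (ℚ.toℚᵘ-fromℚᵘ (ℚᵘ.mkℚᵘ (+ k) 0))
                                                          (ℚ.toℚᵘ-fromℚᵘ (ℚᵘ.mkℚᵘ (+ 1) k-1)) ⟩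
  ℚᵘ.mkℚᵘ (+ k) 0 ℚᵘ.* ℚᵘ.mkℚᵘ (+ 1) k-1     ≈⟨ ℚᵘ.*≡* (ℤ.*-assoc (+ k) (+ 1) (+ k)) ⟩
  ℚᵘ.mkℚᵘ (+ k) k-1                          ≈⟨ ℚᵘ.*≡* (ℤ.*-comm (+ k) (+ 1)) ⟩
  ℚᵘ.1ℚᵘ                                     ∎)
  where open ℚᵘ.≃-Reasoning

∑-indicator : ∀ {A : Set} {P : Pred A 0ℓ} (P? : Decidable P) c xs →
  ∑ (map (λ x → if does (P? x) then c else 0ℚ) xs) ≡ (+ length (filter P? xs) / 1) ℚ.* c
∑-indicator P? c [] = sym (ℚ.*-zeroˡ c)
∑-indicator P? c (x ∷ xs) with does (P? x)
... | false = trans (ℚ.+-identityˡ _) (∑-indicator P? c xs)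
... | true  = begin
  c ℚ.+ _                          ≡⟨ cong₂ ℚ._+_ (sym (ℚ.*-identityˡ c)) (∑-indicator P? c xs) ⟩
  1ℚ ℚ.* c ℚ.+ (+ k / 1) ℚ.* c     ≡⟨ ℚ.*-distribʳ-+ c 1ℚ (+ k / 1) ⟨
  (1ℚ ℚ.+ + k / 1) ℚ.* c           ≡⟨ cong (ℚ._* c) (1+k/1 k) ⟨
  (+ suc k / 1) ℚ.* c              ∎
  where
  open ≡-Reasoning
  k : ℕ
  k = length (filter P? xs)

module Subgraphs (n : ℕ) where

  -- The edges of Kₙ, each listed once, as pairs (u , v) with u < v.
  edges : List (Fin n × Fin n)
  edges = filter (λ (u , v) → u Fin.<? v) (cartesianProduct (allFin n) (allFin n))

  Edge : Set
  Edge = Fin (length edges)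

  ends : Edge → Fin n × Fin n
  ends = lookup edges

  -- A subgraph without isolated vertices is its set of edges.
  Graph : Set
  Graph = Subset (length edges)

  K : Graph
  K = ⊤

  graphs : List Graph
  graphs = allSubsets (length edges)

  Incident : Fin n → Edge → Set
  Incident u e = u ≡ proj₁ (ends e) ⊎ u ≡ proj₂ (ends e)

  incident? : ∀ (u : Fin n) e → Dec (Incident u e)
  incident? u e = (u Fin.≟ proj₁ (ends e)) ⊎-dec (u Fin.≟ proj₂ (ends e))

  Adj : Graph → Fin n → Fin n → Set
  Adj G u v = ∃[ e ] e ∈ G × (ends e ≡ (u , v) ⊎ ends e ≡ (v , u))

  adj? : ∀ (G : Graph) u v → Dec (Adj G u v)
  adj? G u v = any? λ e → (e ∈? G) ×-dec
    (≡-dec Fin._≟_ Fin._≟_ (ends e) (u , v) ⊎-dec ≡-dec Fin._≟_ Fin._≟_ (ends e) (v , u))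

  covered? : ∀ (G : Graph) u → Dec (∃[ e ] e ∈ G × Incident u e)
  covered? G u = any? λ e → (e ∈? G) ×-dec incident? u e

  V : Graph → Subset n
  V G = setOf (covered? G)

  v e : Graph → ℕ
  v G = ∣ V G ∣
  e G = ∣ G ∣

  deg : Graph → Fin n → ℕ
  deg G u = ∣ G ∩ setOf (incident? u) ∣

  Δ : Graph → ℕ
  Δ G = ℕᴱ.max 0 (map (deg G) (allFin n))

  v≢0 : ∀ {G} → Nonempty G → NonZero (v G)
  v≢0 {G} (f , f∈G) = ∈⇒∣p∣≢0 (∈-setOf (covered? G) (f , f∈G , inj₁ refl))

  e≢0 : ∀ {G} → Nonempty G → NonZero (e G)
  e≢0 (_ , f∈G) = ∈⇒∣p∣≢0 f∈G

  Δ≢0 : ∀ {G} → Nonempty G → NonZero (Δ G)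
  Δ≢0 {G} (f , f∈G) = >-nonZero (ℕ.≤-trans
    (ℕ.>-nonZero⁻¹ (deg G u) {{∈⇒∣p∣≢0 (x∈p∩q⁺ (f∈G , ∈-setOf (incident? u) (inj₁ refl)))}})
    (All.lookup (ℕᴱ.xs≤max 0 (map (deg G) (allFin n))) (∈-map⁺ (deg G) (∈-allFin u))))
    where
    u : Fin n
    u = proj₁ (ends f)

  Vertex : Graph → Set
  Vertex G = ∃[ u ] u ∈ V G

  infix 4 _≅_ _≅?_

  record _≅_ (G H : Graph) : Set where
    field
      bijection : Vertex G ↔ Vertex H
    open Inverse bijection public using (to; from)
    field
      adjacency : ∀ u w → Adj G (proj₁ u) (proj₁ w) ⇔ Adj H (proj₁ (to u)) (proj₁ (to w))

  ≅-refl : ∀ {G} → G ≅ G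
  ≅-refl = record { bijection = ↔-id _ ; adjacency = λ _ _ → ⇔-id _ }

  private
    vertex-≡ : ∀ {p : Subset n} {x y : ∃ (_∈ p)} → proj₁ x ≡ proj₁ y → x ≡ y
    vertex-≡ {x = u , i} {y = _ , j} refl = cong (u ,_) (∈-irrelevant i j)

    -- Isomorphism in terms of total functions, which can be searched.
    Iso : Graph → Graph → (f g : Fin n → Fin n) → Set
    Iso G H f g =
      (∀ u → u ∈ V G → f u ∈ V H × g (f u) ≡ u) ×
      (∀ u → u ∈ V H → g u ∈ V G × f (g u) ≡ u) ×
      (∀ u → u ∈ V G → ∀ w → w ∈ V G →
        (Adj G u w → Adj H (f u) (f w)) × (Adj H (f u) (f w) → Adj G u w))

    iso? : ∀ G H f g → Dec (Iso G H f g)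
    iso? G H f g =
      (all? λ u → (u ∈? V G) →-dec ((f u ∈? V H) ×-dec (g (f u) Fin.≟ u))) ×-dec
      (all? λ u → (u ∈? V H) →-dec ((g u ∈? V G) ×-dec (f (g u) Fin.≟ u))) ×-dec
      (all? λ u → (u ∈? V G) →-dec all? λ w → (w ∈? V G) →-dec
        ((adj? G u w →-dec adj? H (f u) (f w)) ×-dec
         (adj? H (f u) (f w) →-dec adj? G u w)))

    iso⇒≅ : ∀ {G H f g} → Iso G H f g → G ≅ H
    iso⇒≅ {f = f} {g} (F , B , A) = record
      { bijection = mk↔ₛ′
          (λ (u , i) → f u , proj₁ (F u i))
          (λ (u , i) → g u , proj₁ (B u i))
          (λ (u , i) → vertex-≡ (proj₂ (B u i)))
          (λ (u , i) → vertex-≡ (proj₂ (F u i)))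
      ; adjacency = λ (u , i) (w , j) → mk⇔ (proj₁ (A u i w j)) (proj₂ (A u i w j))
      }

    ≅⇒iso : ∀ {G H f g} (φ : G ≅ H) → let open _≅_ φ in
            (∀ u i → f u ≡ proj₁ (to (u , i))) → (∀ u i → g u ≡ proj₁ (from (u , i))) →
            Iso G H f g
    ≅⇒iso {G} {H} {f} {g} φ f≡ g≡ = F , B , A
      where
      open _≅_ φ
      open Inverse bijection using (strictlyInverseˡ; strictlyInverseʳ)
      F : ∀ u → u ∈ V G → f u ∈ V H × g (f u) ≡ u
      F u i = subst (λ x → x ∈ V H × g x ≡ u) (sym (f≡ u i))
        (proj₂ (to (u , i)) , trans (g≡ _ _) (cong proj₁ (strictlyInverseʳ (u , i))))
      B : ∀ u → u ∈ V H → g u ∈ V G × f (g u) ≡ u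
      B u i = subst (λ x → x ∈ V G × f x ≡ u) (sym (g≡ u i))
        (proj₂ (from (u , i)) , trans (f≡ _ _) (cong proj₁ (strictlyInverseˡ (u , i))))
      A : ∀ u → u ∈ V G → ∀ w → w ∈ V G →
          (Adj G u w → Adj H (f u) (f w)) × (Adj H (f u) (f w) → Adj G u w)
      A u i w j rewrite f≡ u i | f≡ w j =
        Equivalence.to (adjacency (u , i) (w , j)) , Equivalence.from (adjacency (u , i) (w , j))

    extend : ∀ {p q : Subset n} → (∃ (_∈ p) → ∃ (_∈ q)) → Fin n → Fin n
    extend {p} h u with u ∈? p
    ... | yes i = proj₁ (h (u , i))
    ... | no  _ = u

    extend-≡ : ∀ {p q : Subset n} (h : ∃ (_∈ p) → ∃ (_∈ q)) u i → extend h u ≡ proj₁ (h (u , i))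
    extend-≡ {p} h u i with u ∈? p
    ... | yes j  = cong (proj₁ ∘ h) (vertex-≡ refl)
    ... | no u∉p = contradiction i u∉p

  _≅?_ : ∀ G H → Dec (G ≅ H)
  G ≅? H = map′
    (λ (_ , _ , φ) → iso⇒≅ φ)
    (λ φ → let open _≅_ φ in
      funToFin (extend to) , funToFin (extend from) ,
      ≅⇒iso φ (λ u i → trans (finToFun-funToFin (extend to) u) (extend-≡ to u i))
              (λ u i → trans (finToFun-funToFin (extend from) u) (extend-≡ from u i)))
    (any? {n ℕ.^ n} λ i → any? {n ℕ.^ n} λ j → iso? G H (finToFun i) (finToFun j))

  IsCopy : (I G S : Graph) → Set
  IsCopy I G S = S ⊆ G × S ≅ I

  isCopy? : ∀ I G S → Dec (IsCopy I G S)
  isCopy? I G S = (S ⊆? G) ×-dec (S ≅? I)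

  N : (I G : Graph) → ℕ
  N I G = length (filter (isCopy? I G) graphs)

  N≢0 : ∀ I → NonZero (N I K)
  N≢0 I with filter (isCopy? I K) graphs
           | ∈-filter⁺ (isCopy? I K) (∈-allSubsets I) (⊆⊤ , ≅-refl)
  ... | _ ∷ _ | _ = _

  nonemptySubgraphs : Graph → List (Σ Graph Nonempty)
  nonemptySubgraphs H = mapMaybe
    (λ J → Maybe.map (λ (J≢∅ , _) → J , J≢∅) (dec⇒maybe (nonempty? J ×-dec (J ⊆? H))))
    graphs

  -- The library's max takes a starting value; H is itself one of the
  -- nonempty subgraphs, so starting from H does not change the maximum.
  maxOver : ∀ {c ℓ₁ ℓ₂} (O : TotalOrder c ℓ₁ ℓ₂) →
            ((J : Graph) → Nonempty J → TotalOrder.Carrier O) →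
            (H : Graph) → Nonempty H → TotalOrder.Carrier O
  maxOver O f H H≢∅ = Data.List.Extrema.max O (f H H≢∅)
    (map (λ (J , J≢∅) → f J J≢∅) (nonemptySubgraphs H))

  averageDegree : (J : Graph) → Nonempty J → ℚ
  averageDegree J J≢∅ = + (2 ℕ.* e J) / v J
    where instance v≢0′ = v≢0 J≢∅

  d⋆ : (H : Graph) → Nonempty H → ℚ
  d⋆ = maxOver ℚ-totalOrder averageDegree

  N^[-1/e] : (I : Graph) → Nonempty I → Surd
  N^[-1/e] I I≢∅ = N I K ^ℚ (- (+ 1 / e I))
    where
    instance
      N≢0′ = N≢0 I
      e≢0′ = e≢0 {I} I≢∅

  q : (H : Graph) → Nonempty H → Surd
  q = maxOver ≤ˢ-totalOrder N^[-1/e]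

  d⋆≢0 : ∀ H (H≢∅ : Nonempty H) → ℚ.NonZero (d⋆ H H≢∅)
  d⋆≢0 H H≢∅ = ℚ.>-nonZero (ℚ.<-≤-trans
    (ℚ.positive⁻¹ _ {{ℚ.normalize-pos (2 ℕ.* e H) (v H)}})
    (Data.List.Extrema.⊥≤max ℚ-totalOrder _ (map _ (nonemptySubgraphs H))))
    where
    instance
      v≢0′  = v≢0 H≢∅
      2e≢0′ = ℕ.m*n≢0 2 (e H) {{_}} {{e≢0 {H} H≢∅}}

  Δ^[2/d⋆] : (H : Graph) → Nonempty H → Surd
  Δ^[2/d⋆] H H≢∅ = Δ H ^ℚ ((+ 2 / 1) ÷ d⋆ H H≢∅)
    where
    instance
      Δ≢0′  = Δ≢0 H≢∅
      d⋆≢0′ = d⋆≢0 H H≢∅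

  record ProbabilityMeasure : Set where
    field
      mass   : Graph → ℚ
      mass≥0 : ∀ S → 0ℚ ℚ.≤ mass S
      total  : ∑ (map mass graphs) ≡ 1ℚ

    prob : {P : Pred Graph 0ℓ} → Decidable P → ℚ
    prob P? = ∑ (map mass (filter P? graphs))

    prob≥0 : {P : Pred Graph 0ℓ} (P? : Decidable P) → 0ℚ ℚ.≤ prob P?
    prob≥0 P? = ∑-nonNeg mass mass≥0 (filter P? graphs)

  Spread : Surd → ProbabilityMeasure → Set
  Spread a μ = (A : Graph) → Nonempty A →
    fromℚ (prob (A ⊆?_)) (prob≥0 (A ⊆?_)) ≤ˢ a ^ˢ ∣ A ∣
    where open ProbabilityMeasure μ

  ν : Graph → ProbabilityMeasure
  ν H = record
    { mass   = λ S → if does (isCopy? H K S) then 1/N else 0ℚ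
    ; mass≥0 = λ S → nonNeg (does (isCopy? H K S))
    ; total  = trans (∑-indicator (isCopy? H K) 1/N graphs) (k/1*1/k (N H K) {{N≢0 H}})
    }
    where
    1/N : ℚ
    1/N = (+ 1 / N H K) {{N≢0 H}}

    nonNeg : ∀ b → 0ℚ ℚ.≤ (if b then 1/N else 0ℚ)
    nonNeg true  = ℚ.nonNegative⁻¹ _ {{ℚ.normalize-nonNeg 1 (N H K) {{N≢0 H}}}}
    nonNeg false = ℚ.≤-refl

{-# OPTIONS --safe #-}

-- Write Δ, d⋆ and q for the parameters of H.  Relabelling by random permutations turns ν_H(A ⊆ S) into
-- the probability that a random permutation maps A into H, which is at most 4^v(A) w(A), where w(A) is
-- the proportion of all maps [n] → [n] that embed A in H.  Now w is submultiplicative over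
-- vertex-disjoint unions, so w(D) ≤ (C Δ^(2/d⋆) q)^e(D) is needed for connected D only.  Let D have v
-- vertices and e edges.  At most Δ^(v-1) embeddings of D send a given vertex to a given vertex, so
-- w(D) ≤ (Δ/n)^(v-1).  If v - 1 ≥ 2e/d⋆, this suffices, since a densest J ⊆ H has at most n^v(J) copies
-- and hence q ≥ n^(-2/d⋆).  Otherwise take a maximal family of m vertex-disjoint copies of D in H.
-- Every embedding meets one of them, so w(D) n^v ≤ m v² Δ^(v-1) ≤ m v² Δ^(2e/d⋆); and their union
-- has at most (n^v)^m / m! copies, because a copy of it is a set of m copies of D, so that
-- q^e ≥ (m!)^(1/m) / n^v ≥ m / (4 n^v).

module Submission where

open import Defs
open import Data.Fin.Subset using (Nonempty)
open import Data.Nat.Base using (ℕ)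
open import Data.Product.Base using (∃-syntax; _×_)

open import Algebra.Bundles using (CommutativeRing)
open import Data.Bool.Base using (true; false; if_then_else_)
import Data.Bool.Properties as Bool
open import Data.Empty using (⊥-elim)
open import Data.Fin.Base as Fin using (Fin; zero; suc)
open import Data.Fin.Properties as Fin using (any?; all?)
open import Data.Fin.Subset using (Subset; inside; outside; ⊤; ⊥; ⁅_⁆; _∈_; _∉_; _⊆_; _∩_; _∪_; ⋃; ∁; ∣_∣)
open import Data.Fin.Subset.Properties
open import Data.Integer.Base as ℤ using (ℤ; -[1+_])
import Data.Integer.Properties as ℤ
open import Data.List.Base as List using (List; []; _∷_; _++_; map; filter; length; allFin; tabulate; cartesianProduct; cartesianProductWith)
import Data.List.Extrema as Extrema
import Data.List.Extrema.Nat as Extremaℕ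
import Data.List.Membership.DecPropositional as DecMembership
open import Data.List.Membership.Propositional using () renaming (_∈_ to _∈ˡ_)
open import Data.List.Membership.Propositional.Properties using (∈-allFin; ∈-cartesianProductWith⁺; ∈-cartesianProduct⁺; ∈-filter⁺; ∈-filter⁻; ∈-lookup; ∈-map⁺; ∈-map⁻; ∈-++⁺ˡ; ∈-++⁺ʳ)
open import Data.List.Properties using (length-map; length-++; length-tabulate)
open import Data.List.Relation.Unary.All as All using (All; []; _∷_)
import Data.List.Relation.Unary.All.Properties as All
open import Data.List.Relation.Unary.AllPairs as AllPairs using (AllPairs; []; _∷_)
import Data.List.Relation.Unary.AllPairs.Properties as AllPairs
open import Data.List.Relation.Unary.Any as Any using (Any; here; there)
open import Data.List.Relation.Unary.Any.Properties using (lookup-index)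
open import Data.List.Relation.Unary.Unique.Propositional using (Unique)
import Data.List.Relation.Unary.Unique.Propositional.Properties as Unique
open import Data.Maybe.Base as Maybe using (Maybe; just; nothing)
open import Data.Nat.Base as ℕ using (zero; suc; _+_; _*_; _≤_; _<_; z≤n; s≤s; _!)
open import Data.Nat.Properties as ℕ using (module ≤-Reasoning)
open import Data.Nat.Tactic.RingSolver using (solve-∀)
open import Data.Product.Base using (∃; _,_; proj₁; proj₂)
import Data.Product.Properties as Product
open import Data.Rational.Base as ℚ using (ℚ; 0ℚ; 1ℚ; _/_; _÷_; ↥_; ↧ₙ_)
import Data.Rational.Properties as ℚ
import Data.Rational.Unnormalised.Base as ℚᵘ
import Data.Rational.Unnormalised.Properties as ℚᵘ
open import Data.Sum.Base using (_⊎_; inj₁; inj₂; [_,_]′)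
open import Data.Unit.Base using (tt) renaming (⊤ to Unit)
open import Data.Vec.Base as Vec using (Vec; []; _∷_; _[_]≔_) renaming (lookup to _!_)
open import Data.Vec.Properties using (∷-injective; lookup∘updateAt; lookup∘updateAt′; []=⇒lookup; lookup∘tabulate; lookup-replicate; ≡-dec)
open import Function.Base using (_∘_; id)
open import Function.Bundles using (Inverse; Equivalence; mk↔ₛ′; mk⇔)
open import Relation.Binary.Bundles using (TotalOrder)
open import Relation.Binary.Definitions using (tri<; tri≈; tri>)
open import Relation.Binary.PropositionalEquality
open import Relation.Nullary using (Dec; yes; no; does; ¬_; contradiction)
open import Relation.Nullary.Decidable using (_×-dec_; _⊎-dec_; _→-dec_; ¬?; map′; dec-true; dec-false; decidable-stable; dec⇒maybe)
open import Relation.Unary using (Decidable)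
open import Algebra.Properties.CommutativeSemiring.Exp (CommutativeRing.commutativeSemiring ℚ.+-*-commutativeRing) using (^-homo-*; ^-distrib-*)

-- Containment in a random copy is measured with uniform maps from `Fin n` to itself because their
-- values at distinct vertices are independent; for random permutations the events belonging to two
-- components are not. The price of the exchange is n^v (n - v)! / n!, which stays below 4^v even at
-- v = n. Graphs here have no isolated vertices, so v ≤ 2e, and both 4^v and the v² of the packing
-- are absorbed into C^e. The case distinction reflects that Δ/n ≤ 1 only allows the exponent of Δ/n
-- to be lowered, from v - 1 to 2e/d⋆. In the other case `D` alone yields q^e ≥ n^(-v), which misses
-- the factor m, and m can be arbitrarily large. It is recovered from the m! in the number of copies
-- of the union: the union is itself a subgraph of `H`, so it competes in the maximum `q`. No real
-- number is constructed. Every inequality has the form p ≤ s a^e with natural p, s, e, and the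
-- fractional exponents 2/d⋆ = v(J)/e(J) and 1/m are reached by raising to the power e(J) or m and
-- cancelling that power.

private
  variable
    A B : Set
    P Q : Set
    k n : ℕ

-- Finite sums and counting

sumOver : List A → (A → ℕ) → ℕ
sumOver []       f = 0
sumOver (x ∷ xs) f = f x + sumOver xs f

sumOver-mono-∈ : ∀ (xs : List A) {f g} → (∀ x → x ∈ˡ xs → f x ≤ g x) → sumOver xs f ≤ sumOver xs g
sumOver-mono-∈ []       f≤g = z≤n
sumOver-mono-∈ (x ∷ xs) f≤g = ℕ.+-mono-≤ (f≤g x (here refl)) (sumOver-mono-∈ xs λ y → f≤g y ∘ there)

sumOver-mono : ∀ (xs : List A) {f g} → (∀ x → f x ≤ g x) → sumOver xs f ≤ sumOver xs g
sumOver-mono xs f≤g = sumOver-mono-∈ xs λ x _ → f≤g x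

sumOver-cong : ∀ (xs : List A) {f g} → (∀ x → f x ≡ g x) → sumOver xs f ≡ sumOver xs g
sumOver-cong []       f≡g = refl
sumOver-cong (x ∷ xs) f≡g = cong₂ _+_ (f≡g x) (sumOver-cong xs f≡g)

sumOver-++ : ∀ (xs ys : List A) f → sumOver (xs ++ ys) f ≡ sumOver xs f + sumOver ys f
sumOver-++ []       ys f = refl
sumOver-++ (x ∷ xs) ys f = trans (cong (f x +_) (sumOver-++ xs ys f)) (sym (ℕ.+-assoc (f x) _ _))

sumOver-map : ∀ (h : A → B) xs f → sumOver (map h xs) f ≡ sumOver xs (f ∘ h)
sumOver-map h []       f = refl
sumOver-map h (x ∷ xs) f = cong (f (h x) +_) (sumOver-map h xs f)

sumOver-tabulate : ∀ {k} (h : Fin k → A) f → sumOver (tabulate h) f ≡ sumOver (allFin k) (f ∘ h)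
sumOver-tabulate {k = zero}  h f = refl
sumOver-tabulate {k = suc k} h f = cong (f (h zero) +_)
  (trans (sumOver-tabulate (h ∘ suc) f) (sym (sumOver-tabulate suc (f ∘ h))))

sumOver-const : ∀ (xs : List A) c → sumOver xs (λ _ → c) ≡ length xs * c
sumOver-const []       c = refl
sumOver-const (x ∷ xs) c = cong (c +_) (sumOver-const xs c)

sumOver-+ : ∀ (xs : List A) f g → sumOver xs (λ x → f x + g x) ≡ sumOver xs f + sumOver xs g
sumOver-+ []       f g = refl
sumOver-+ (x ∷ xs) f g = trans (cong ((f x + g x) +_) (sumOver-+ xs f g))
  (interchange (f x) (g x) (sumOver xs f) (sumOver xs g))
  where
  interchange : ∀ a b c d → a + b + (c + d) ≡ a + c + (b + d)
  interchange = solve-∀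

sumOver-*ˡ : ∀ c (xs : List A) f → sumOver xs (λ x → c * f x) ≡ c * sumOver xs f
sumOver-*ˡ c []       f = sym (ℕ.*-zeroʳ c)
sumOver-*ˡ c (x ∷ xs) f = trans (cong (c * f x +_) (sumOver-*ˡ c xs f)) (sym (ℕ.*-distribˡ-+ c (f x) _))

sumOver-*ʳ : ∀ (xs : List A) f c → sumOver xs (λ x → f x * c) ≡ sumOver xs f * c
sumOver-*ʳ xs f c = trans (sumOver-cong xs λ x → ℕ.*-comm (f x) c)
  (trans (sumOver-*ˡ c xs f) (ℕ.*-comm c _))

sumOver-swap : ∀ (xs : List A) (ys : List B) (f : A → B → ℕ) →
  sumOver xs (λ x → sumOver ys (f x)) ≡ sumOver ys (λ y → sumOver xs (λ x → f x y))
sumOver-swap []       ys f = sym (trans (sumOver-const ys 0) (ℕ.*-zeroʳ (length ys)))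
sumOver-swap (x ∷ xs) ys f = trans (cong (sumOver ys (f x) +_) (sumOver-swap xs ys f))
  (sym (sumOver-+ ys (f x) _))

sumOver-∈ : ∀ {xs : List A} {x} f → x ∈ˡ xs → f x ≤ sumOver xs f
sumOver-∈ f (here refl)  = ℕ.m≤m+n _ _
sumOver-∈ f (there x∈xs) = ℕ.≤-trans (sumOver-∈ f x∈xs) (ℕ.m≤n+m _ _)

𝟙 : Dec P → ℕ
𝟙 P? = if does P? then 1 else 0

𝟙-yes : (P? : Dec P) → P → 𝟙 P? ≡ 1
𝟙-yes P? p = cong (if_then 1 else 0) (dec-true P? p)

𝟙-no : (P? : Dec P) → ¬ P → 𝟙 P? ≡ 0
𝟙-no P? ¬p = cong (if_then 1 else 0) (dec-false P? ¬p)

𝟙≤ : (P? : Dec P) → ∀ {m} → (P → 1 ≤ m) → 𝟙 P? ≤ m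
𝟙≤ (yes p) 1≤m = 1≤m p
𝟙≤ (no _)  _   = z≤n

𝟙-mono : (P? : Dec P) (Q? : Dec Q) → (P → Q) → 𝟙 P? ≤ 𝟙 Q?
𝟙-mono P? Q? P⇒Q = 𝟙≤ P? (ℕ.≤-reflexive ∘ sym ∘ 𝟙-yes Q? ∘ P⇒Q)

𝟙-cong : (P? : Dec P) (Q? : Dec Q) → (P → Q) → (Q → P) → 𝟙 P? ≡ 𝟙 Q?
𝟙-cong P? Q? P⇒Q Q⇒P = ℕ.≤-antisym (𝟙-mono P? Q? P⇒Q) (𝟙-mono Q? P? Q⇒P)

𝟙-× : (P? : Dec P) (Q? : Dec Q) → 𝟙 (P? ×-dec Q?) ≡ 𝟙 P? * 𝟙 Q?
𝟙-× (yes _) (yes _) = refl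
𝟙-× (yes _) (no _)  = refl
𝟙-× (no _)  _       = refl

𝟙-⊎ : (P? : Dec P) (Q? : Dec Q) → 𝟙 (P? ⊎-dec Q?) ≤ 𝟙 P? + 𝟙 Q?
𝟙-⊎ P? Q? = 𝟙≤ (P? ⊎-dec Q?)
  [ (λ p → ℕ.≤-trans (ℕ.≤-reflexive (sym (𝟙-yes P? p))) (ℕ.m≤m+n _ _))
  , (λ q → ℕ.≤-trans (ℕ.≤-reflexive (sym (𝟙-yes Q? q))) (ℕ.m≤n+m _ _)) ]′

𝟙-¬ : (P? : Dec P) → 𝟙 P? + 𝟙 (¬? P?) ≡ 1
𝟙-¬ (yes _) = refl
𝟙-¬ (no _)  = refl

count : {P : A → Set} → Decidable P → List A → ℕ
count P? xs = sumOver xs (λ x → 𝟙 (P? x))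

length-filter≡count : {P : A → Set} (P? : Decidable P) → ∀ xs → length (filter P? xs) ≡ count P? xs
length-filter≡count P? []       = refl
length-filter≡count P? (x ∷ xs) with does (P? x)
... | true  = cong suc (length-filter≡count P? xs)
... | false = length-filter≡count P? xs

count-mono : {P Q : A → Set} (P? : Decidable P) (Q? : Decidable Q) → (∀ {x} → P x → Q x) →
             ∀ xs → count P? xs ≤ count Q? xs
count-mono P? Q? P⇒Q xs = sumOver-mono xs λ x → 𝟙-mono (P? x) (Q? x) P⇒Q

count-cong : {P Q : A → Set} (P? : Decidable P) (Q? : Decidable Q) → (∀ {x} → P x → Q x) →
             (∀ {x} → Q x → P x) → ∀ xs → count P? xs ≡ count Q? xs
count-cong P? Q? P⇒Q Q⇒P xs = ℕ.≤-antisym (count-mono P? Q? P⇒Q xs) (count-mono Q? P? Q⇒P xs)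

count-∈ : {P : A → Set} (P? : Decidable P) → ∀ {xs x} → x ∈ˡ xs → P x → 1 ≤ count P? xs
count-∈ P? {x = x} x∈xs px = subst (_≤ _) (𝟙-yes (P? x) px) (sumOver-∈ (𝟙 ∘ P?) x∈xs)

count>0 : {P : A → Set} (P? : Decidable P) → ∀ xs → 1 ≤ count P? xs → ∃[ x ] P x
count>0 P? (x ∷ xs) 1≤ with P? x
... | yes px = x , px
... | no _   = count>0 P? xs 1≤

count-∄ : {P : A → Set} (P? : Decidable P) → ∀ xs → (∀ x → x ∈ˡ xs → ¬ P x) → count P? xs ≡ 0
count-∄ P? []       ¬P = refl
count-∄ P? (x ∷ xs) ¬P = cong₂ _+_ (𝟙-no (P? x) (¬P x (here refl))) (count-∄ P? xs λ y → ¬P y ∘ there)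

count-≤1 : {P : A → Set} (P? : Decidable P) → ∀ {xs} → Unique xs →
           (∀ {x y} → P x → P y → x ≡ y) → count P? xs ≤ 1
count-≤1 P? {[]}     _          _   = z≤n
count-≤1 P? {x ∷ xs} (x∉xs ∷ u) unq with P? x
... | yes px = s≤s (ℕ.≤-reflexive (count-∄ P? xs λ y y∈xs py → All.lookup x∉xs y∈xs (unq px py)))
... | no _   = count-≤1 P? u unq

-- Double counting of the pairs related by `R`: each `x` with `P x` has a partner, and no `y` serves
-- two of them. A relation instead of a function allows the partner to depend on the proof of `P x`.
count-injection : {P : A → Set} {Q : B → Set} {R : A → B → Set}
  (P? : Decidable P) (Q? : Decidable Q) (R? : ∀ x y → Dec (R x y)) → ∀ {xs ys} → Unique xs →
  (∀ {x} → P x → ∃[ y ] y ∈ˡ ys × R x y) →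
  (∀ {x y} → R x y → Q y) →
  (∀ {x x′ y} → R x y → R x′ y → x ≡ x′) →
  count P? xs ≤ count Q? ys
count-injection P? Q? R? {xs} {ys} u total R⇒Q inj = begin
  count P? xs                                       ≤⟨ sumOver-mono xs (λ x → 𝟙≤ (P? x) λ px →
                                                        let _ , y∈ys , r = total px in count-∈ (R? x) y∈ys r) ⟩
  sumOver xs (λ x → sumOver ys (λ y → 𝟙 (R? x y)))  ≡⟨ sumOver-swap xs ys _ ⟩
  sumOver ys (λ y → count (λ x → R? x y) xs)        ≤⟨ sumOver-mono ys fibre ⟩
  count Q? ys                                       ∎
  where
  open ≤-Reasoning
  fibre : ∀ y → count (λ x → R? x y) xs ≤ 𝟙 (Q? y)
  fibre y with Q? y
  ... | yes _ = count-≤1 (λ x → R? x y) u inj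
  ... | no ¬q = ℕ.≤-reflexive (count-∄ (λ x → R? x y) xs λ _ _ r → ¬q (R⇒Q r))

∣p∣≡count : (p : Subset k) → ∣ p ∣ ≡ count (_∈? p) (allFin k)
∣p∣≡count []            = refl
∣p∣≡count (inside  ∷ p) = cong suc (trans (∣p∣≡count p)
  (sym (trans (sumOver-tabulate suc (λ i → 𝟙 (i ∈? (inside ∷ p))))
    (count-cong (λ i → suc i ∈? (inside ∷ p)) (_∈? p) drop-there Vec.there (allFin _)))))
∣p∣≡count (outside ∷ p) = trans (∣p∣≡count p)
  (sym (trans (sumOver-tabulate suc (λ i → 𝟙 (i ∈? (outside ∷ p))))
    (count-cong (λ i → suc i ∈? (outside ∷ p)) (_∈? p) drop-there Vec.there (allFin _))))

length-allFin : ∀ n → length (allFin n) ≡ n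
length-allFin n = length-tabulate id

-- Sums over all maps between finite sets

allMaps : ∀ n k → List (Vec (Fin n) k)
allMaps n zero    = [] ∷ []
allMaps n (suc k) = cartesianProductWith _∷_ (allFin n) (allMaps n k)

∈-allMaps : (f : Vec (Fin n) k) → f ∈ˡ allMaps n k
∈-allMaps []      = here refl
∈-allMaps (y ∷ f) = ∈-cartesianProductWith⁺ _∷_ (∈-allFin y) (∈-allMaps f)

allMaps-unique : ∀ n k → Unique (allMaps n k)
allMaps-unique n zero    = [] ∷ []
allMaps-unique n (suc k) = Unique.cartesianProductWith⁺ _∷_ ∷-injective (Unique.allFin⁺ n) (allMaps-unique n k)

sumOver-cartesianProductWith : ∀ {C : Set} (h : A → B → C) xs ys (f : C → ℕ) →
  sumOver (cartesianProductWith h xs ys) f ≡ sumOver xs (λ x → sumOver ys (λ y → f (h x y)))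
sumOver-cartesianProductWith h []       ys f = refl
sumOver-cartesianProductWith h (x ∷ xs) ys f = trans (sumOver-++ (map (h x) ys) _ f)
  (cong₂ _+_ (sumOver-map (h x) ys f) (sumOver-cartesianProductWith h xs ys f))

sumMaps-suc : ∀ n k F → sumOver (allMaps n (suc k)) F ≡
              sumOver (allFin n) (λ y → sumOver (allMaps n k) (λ g → F (y ∷ g)))
sumMaps-suc n k F = sumOver-cartesianProductWith _∷_ (allFin n) (allMaps n k) F

-- Among all `f [ b ]≔ y` each map occurs `n` times, once for every value that `f` may have had at
-- `b`. Redrawing one value thus keeps a uniform map uniform, and the choice of a single image can
-- be analysed with the other values held fixed.
resample : ∀ {n k} (F : Vec (Fin n) k → ℕ) b →
  n * sumOver (allMaps n k) F ≡ sumOver (allMaps n k) (λ f → sumOver (allFin n) (λ y → F (f [ b ]≔ y)))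
resample {n} {suc k} F zero = begin
  n * sumOver (allMaps n (suc k)) F                ≡⟨ cong (n *_) (sumMaps-suc n k F) ⟩
  n * sumOver ys (λ y → sumOver gs (λ g → F (y ∷ g)))  ≡⟨ cong (n *_) (sumOver-swap ys gs _) ⟩
  n * T                                            ≡⟨ cong (_* T) (length-allFin n) ⟨
  length ys * T                                    ≡⟨ sumOver-const ys T ⟨
  sumOver ys (λ _ → T)                             ≡⟨ sumMaps-suc n k _ ⟨
  sumOver (allMaps n (suc k)) (λ f → sumOver ys (λ y → F (f [ zero ]≔ y))) ∎
  where
  open ≡-Reasoning
  ys = allFin n
  gs = allMaps n k
  T = sumOver gs (λ g → sumOver ys (λ y → F (y ∷ g)))
resample {n} {suc k} F (suc b) = begin
  n * sumOver (allMaps n (suc k)) F                        ≡⟨ cong (n *_) (sumMaps-suc n k F) ⟩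
  n * sumOver ys (λ z → sumOver gs (λ g → F (z ∷ g)))      ≡⟨ sumOver-*ˡ n ys _ ⟨
  sumOver ys (λ z → n * sumOver gs (λ g → F (z ∷ g)))      ≡⟨ sumOver-cong ys (λ z → resample (F ∘ (z ∷_)) b) ⟩
  sumOver ys (λ z → sumOver gs (λ g → sumOver ys (λ y → F (z ∷ (g [ b ]≔ y))))) ≡⟨ sumMaps-suc n k _ ⟨
  sumOver (allMaps n (suc k)) (λ f → sumOver ys (λ y → F (f [ suc b ]≔ y)))     ∎
  where
  open ≡-Reasoning
  ys = allFin n
  gs = allMaps n k

DependsOn : Subset k → (Vec (Fin n) k → ℕ) → Set
DependsOn U F = ∀ f g → (∀ {i} → i ∈ U → f ! i ≡ g ! i) → F f ≡ F g

-- Induction on the coordinates: the first one influences at most one of `F` and `G`, so the partial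
-- sums of the other are constant in it and factor out. The power `n ^ k` clears the denominators of
-- the probabilities.
independent : ∀ {n k} (U W : Subset k) → (∀ {i} → i ∈ U → i ∉ W) →
  ∀ (F G : Vec (Fin n) k → ℕ) → DependsOn U F → DependsOn W G →
  sumOver (allMaps n k) (λ f → F f * G f) * n ℕ.^ k ≡ sumOver (allMaps n k) F * sumOver (allMaps n k) G
independent {n} {zero} [] [] _ F G _ _ = lemma (F []) (G [])
  where
  lemma : ∀ a b → (a * b + 0) * 1 ≡ (a + 0) * (b + 0)
  lemma = solve-∀
independent {n} {suc k} (u ∷ U) (w ∷ W) disj F G dF dG = begin
  sumOver (allMaps n (suc k)) (λ f → F f * G f) * (n * n ℕ.^ k)
    ≡⟨ cong (_* (n * n ℕ.^ k)) (sumMaps-suc n k _) ⟩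
  sumOver ys (λ y → sumOver gs (λ g → F (y ∷ g) * G (y ∷ g))) * (n * n ℕ.^ k)
    ≡⟨ swapʳ (sumOver ys (λ y → sumOver gs (λ g → F (y ∷ g) * G (y ∷ g)))) n (n ℕ.^ k) ⟩
  sumOver ys (λ y → sumOver gs (λ g → F (y ∷ g) * G (y ∷ g))) * n ℕ.^ k * n
    ≡⟨ cong (_* n) (sumOver-*ʳ ys _ (n ℕ.^ k)) ⟨
  sumOver ys (λ y → sumOver gs (λ g → F (y ∷ g) * G (y ∷ g)) * n ℕ.^ k) * n
    ≡⟨ cong (_* n) (sumOver-cong ys λ y → independent U W (λ i∈U i∈W → disj (Vec.there i∈U) (Vec.there i∈W))
         (λ g → F (y ∷ g)) (λ g → G (y ∷ g)) (tail dF) (tail dG)) ⟩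
  sumOver ys (λ y → F′ y * G′ y) * n
    ≡⟨ head u w disj dF dG ⟩
  sumOver ys F′ * sumOver ys G′
    ≡⟨ cong₂ _*_ (sumMaps-suc n k F) (sumMaps-suc n k G) ⟨
  sumOver (allMaps n (suc k)) F * sumOver (allMaps n (suc k)) G ∎
  where
  open ≡-Reasoning
  ys = allFin n
  gs = allMaps n k
  F′ G′ : Fin n → ℕ
  F′ y = sumOver gs (λ g → F (y ∷ g))
  G′ y = sumOver gs (λ g → G (y ∷ g))
  swapʳ : ∀ a b c → a * (b * c) ≡ a * c * b
  swapʳ = solve-∀
  tail : ∀ {s V} {E : Vec (Fin n) (suc k) → ℕ} {y} → DependsOn (s ∷ V) E → DependsOn V (λ g → E (y ∷ g))
  tail d f g f≡g = d _ _ λ { {zero} _ → refl ; {suc i} i∈V → f≡g (drop-there i∈V) }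
  constant : ∀ {V} {E : Vec (Fin n) (suc k) → ℕ} → DependsOn (outside ∷ V) E →
    ∀ y z → sumOver gs (λ g → E (y ∷ g)) ≡ sumOver gs (λ g → E (z ∷ g))
  constant d y z = sumOver-cong gs λ g → d _ _ λ { {zero} () ; {suc i} _ → refl }
  constant-sum : ∀ (E : Fin n → ℕ) → (∀ y z → E y ≡ E z) → ∀ y → sumOver ys E ≡ n * E y
  constant-sum E E-const y = trans (sumOver-cong ys λ z → E-const z y)
    (trans (sumOver-const ys (E y)) (cong (_* E y) (length-allFin n)))
  constant-factor : ∀ (D E : Fin n → ℕ) → (∀ y z → E y ≡ E z) →
    sumOver ys (λ y → D y * E y) * n ≡ sumOver ys D * sumOver ys E
  constant-factor D E E-const = begin
    sumOver ys (λ y → D y * E y) * n  ≡⟨ sumOver-*ʳ ys _ n ⟨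
    sumOver ys (λ y → D y * E y * n)  ≡⟨ sumOver-cong ys (λ y → trans (comm (D y) (E y) n)
                                           (cong (D y *_) (sym (constant-sum E E-const y)))) ⟩
    sumOver ys (λ y → D y * sumOver ys E)  ≡⟨ sumOver-*ʳ ys D _ ⟩
    sumOver ys D * sumOver ys E       ∎
    where
    comm : ∀ a b c → a * b * c ≡ a * (c * b)
    comm = solve-∀
  head : ∀ u w → (∀ {i} → i ∈ u ∷ U → i ∉ w ∷ W) →
    DependsOn (u ∷ U) F → DependsOn (w ∷ W) G →
    sumOver ys (λ y → F′ y * G′ y) * n ≡ sumOver ys F′ * sumOver ys G′
  head inside  inside  d _  _  = ⊥-elim (d Vec.here Vec.here)
  -- This clause also serves a coordinate that lies in neither set.
  head u       outside _ _  dG = constant-factor F′ G′ (constant dG)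
  head outside inside  _ dF _  = begin
    sumOver ys (λ y → F′ y * G′ y) * n  ≡⟨ cong (_* n) (sumOver-cong ys λ y → ℕ.*-comm (F′ y) (G′ y)) ⟩
    sumOver ys (λ y → G′ y * F′ y) * n  ≡⟨ constant-factor G′ F′ (constant dF) ⟩
    sumOver ys G′ * sumOver ys F′       ≡⟨ ℕ.*-comm (sumOver ys G′) _ ⟩
    sumOver ys F′ * sumOver ys G′       ∎

-- Extending partial injections

∣p∪q∣≡∣p∣+∣q∣ : ∀ (p q : Subset k) → (∀ {i} → i ∈ p → i ∉ q) → ∣ p ∪ q ∣ ≡ ∣ p ∣ + ∣ q ∣
∣p∪q∣≡∣p∣+∣q∣ []            []            _ = refl
∣p∪q∣≡∣p∣+∣q∣ (inside  ∷ p) (inside  ∷ q) d = contradiction Vec.here (d Vec.here)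
∣p∪q∣≡∣p∣+∣q∣ (inside  ∷ p) (outside ∷ q) d = cong suc (∣p∪q∣≡∣p∣+∣q∣ p q λ i∈p i∈q → d (Vec.there i∈p) (Vec.there i∈q))
∣p∪q∣≡∣p∣+∣q∣ (outside ∷ p) (inside  ∷ q) d = trans
  (cong suc (∣p∪q∣≡∣p∣+∣q∣ p q λ i∈p i∈q → d (Vec.there i∈p) (Vec.there i∈q))) (sym (ℕ.+-suc ∣ p ∣ ∣ q ∣))
∣p∪q∣≡∣p∣+∣q∣ (outside ∷ p) (outside ∷ q) d = ∣p∪q∣≡∣p∣+∣q∣ p q λ i∈p i∈q → d (Vec.there i∈p) (Vec.there i∈q)

∣p∪⁅x⁆∣≡1+∣p∣ : ∀ (p : Subset k) {x} → x ∉ p → ∣ p ∪ ⁅ x ⁆ ∣ ≡ suc ∣ p ∣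
∣p∪⁅x⁆∣≡1+∣p∣ p {x} x∉p = trans
  (∣p∪q∣≡∣p∣+∣q∣ p ⁅ x ⁆ λ i∈p i∈x → x∉p (subst (_∈ p) (x∈⁅y⁆⇒x≡y x i∈x) i∈p))
  (trans (cong (∣ p ∣ +_) (∣⁅x⁆∣≡1 x)) (ℕ.+-comm ∣ p ∣ 1))

p∪⁅x⁆≡p : ∀ (p : Subset k) {x} → x ∈ p → p ∪ ⁅ x ⁆ ≡ p
p∪⁅x⁆≡p p {x} x∈p = ⊆-antisym
  (λ i → [ id , (λ y∈x → subst (_∈ p) (sym (x∈⁅y⁆⇒x≡y x y∈x)) x∈p) ]′ (x∈p∪q⁻ p ⁅ x ⁆ i))
  (p⊆p∪q ⁅ x ⁆)

∃∉ : ∀ (p : Subset k) → ∣ p ∣ < k → ∃[ x ] x ∉ p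
∃∉ p ∣p∣<k with any? (λ x → ¬? (x ∈? p))
... | yes x∉p = x∉p
... | no ∄    = contradiction ∣p∣<k (ℕ.≤⇒≯ (subst (_≤ ∣ p ∣) (∣⊤∣≡n _)
  (p⊆q⇒∣p∣≤∣q∣ {p = ⊤} {p} λ {x} _ → decidable-stable (x ∈? p) (λ x∉p → ∄ (x , x∉p)))))

Agree : Subset k → Vec (Fin n) k → Vec (Fin n) k → Set
Agree U f g = ∀ {i} → i ∈ U → f ! i ≡ g ! i

agree? : ∀ (U : Subset k) (f g : Vec (Fin n) k) → Dec (Agree U f g)
agree? U f g = map′ (λ h {i} → h i) (λ h i → h {i}) (all? λ i → (i ∈? U) →-dec (f ! i Fin.≟ g ! i))

Respects : Subset k → (Vec (Fin n) k → Set) → Set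
Respects U P = ∀ f g → Agree U f g → P f → P g

InjectiveOn : Subset k → Vec (Fin n) k → Set
InjectiveOn U f = ∀ {a b} → a ∈ U → b ∈ U → f ! a ≡ f ! b → a ≡ b

injectiveOn? : ∀ (U : Subset k) (f : Vec (Fin n) k) → Dec (InjectiveOn U f)
injectiveOn? U f = map′ (λ h {a} {b} → h a b) (λ h a b → h {a} {b})
  (all? λ a → all? λ b → (a ∈? U) →-dec ((b ∈? U) →-dec ((f ! a Fin.≟ f ! b) →-dec (a Fin.≟ b))))

InjectiveOn-respects : ∀ {U : Subset k} → Respects {n = n} U (InjectiveOn U)
InjectiveOn-respects f g f≡g inj a∈U b∈U ga≡gb = inj a∈U b∈U (trans (f≡g a∈U) (trans ga≡gb (sym (f≡g b∈U))))

Hits : Subset k → Vec (Fin n) k → Fin n → Set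
Hits W f y = ∃[ a ] a ∈ W × f ! a ≡ y

hits? : ∀ (W : Subset k) (f : Vec (Fin n) k) y → Dec (Hits W f y)
hits? W f y = any? λ a → (a ∈? W) ×-dec (f ! a Fin.≟ y)

count-hits : ∀ (W : Subset k) (f : Vec (Fin n) k) → InjectiveOn W f →
             count (hits? W f) (allFin n) ≡ ∣ W ∣
count-hits W f inj = trans (ℕ.≤-antisym
  (count-injection (hits? W f) (_∈? W) (λ y a → (a ∈? W) ×-dec (f ! a Fin.≟ y)) (Unique.allFin⁺ _)
    (λ (a , a∈W , fa≡y) → a , ∈-allFin a , a∈W , fa≡y) proj₁
    (λ (_ , fa≡y) (_ , fa≡y′) → trans (sym fa≡y) fa≡y′))
  (count-injection (_∈? W) (hits? W f) (λ a y → (a ∈? W) ×-dec (f ! a Fin.≟ y)) (Unique.allFin⁺ _)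
    (λ {a} a∈W → f ! a , ∈-allFin _ , a∈W , refl) (λ {a} (a∈W , fa≡y) → a , a∈W , fa≡y)
    (λ (a∈W , fa≡y) (b∈W , fb≡y) → inj a∈W b∈W (trans fa≡y (sym fb≡y)))))
  (sym (∣p∣≡count W))

count-¬ : {A : Set} {P : A → Set} (P? : Decidable P) → ∀ xs → count P? xs + count (¬? ∘ P?) xs ≡ length xs
count-¬ P? xs = begin
  count P? xs + count (¬? ∘ P?) xs                   ≡⟨ sumOver-+ xs _ _ ⟨
  sumOver xs (λ x → 𝟙 (P? x) + 𝟙 (¬? (P? x)))        ≡⟨ sumOver-cong xs (𝟙-¬ ∘ P?) ⟩
  sumOver xs (λ _ → 1)                               ≡⟨ sumOver-const xs 1 ⟩
  length xs * 1                                      ≡⟨ ℕ.*-identityʳ _ ⟩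
  length xs                                          ∎
  where open ≡-Reasoning

update-≡ : ∀ (f : Vec (Fin n) k) b {y} → (f [ b ]≔ y) ! b ≡ y
update-≡ f b = lookup∘updateAt b f

update-≢ : ∀ (f : Vec (Fin n) k) {b i y} → i ≢ b → (f [ b ]≔ y) ! i ≡ f ! i
update-≢ f {b} {i} i≢b = lookup∘updateAt′ i b i≢b f

∉⇒Agree : ∀ {U : Subset k} (f : Vec (Fin n) k) {b y} → b ∉ U → Agree U (f [ b ]≔ y) f
∉⇒Agree f b∉U i∈U = update-≢ f λ { refl → b∉U i∈U }

module _ {n k : ℕ} {U : Subset k} {P : Vec (Fin n) k → Set} (P? : Decidable P) (P-resp : Respects U P) where

  injective-on? : ∀ W → Decidable (λ f → P f × InjectiveOn W f)
  injective-on? W f = P? f ×-dec injectiveOn? W f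

  -- After redrawing the value at `b`, injectivity survives exactly when the new value avoids the
  -- `∣ W ∣` distinct values on `W`, which leaves `j` choices. `P` does not notice, as `b` is
  -- outside `U`.
  count-insert : ∀ {W b j} → U ⊆ W → b ∉ W → ∣ W ∣ + j ≡ n →
    n * count (injective-on? (W ∪ ⁅ b ⁆)) (allMaps n k) ≡ j * count (injective-on? W) (allMaps n k)
  count-insert {W} {b} {j} U⊆W b∉W ∣W∣+j≡n = begin
    n * count (injective-on? (W ∪ ⁅ b ⁆)) fs
      ≡⟨ resample _ b ⟩
    sumOver fs (λ f → count (λ y → injective-on? (W ∪ ⁅ b ⁆) (f [ b ]≔ y)) (allFin n))
      ≡⟨ sumOver-cong fs inner ⟩
    sumOver fs (λ f → j * 𝟙 (injective-on? W f))
      ≡⟨ sumOver-*ˡ j fs _ ⟩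
    j * count (injective-on? W) fs
      ∎
    where
    open ≡-Reasoning
    fs = allMaps n k
    module _ (f : Vec (Fin n) k) where
      forth : ∀ {y} → P (f [ b ]≔ y) × InjectiveOn (W ∪ ⁅ b ⁆) (f [ b ]≔ y) →
              ¬ Hits W f y × (P f × InjectiveOn W f)
      forth {y} (p , inj) = miss , P-resp _ _ (∉⇒Agree f (b∉W ∘ U⊆W)) p ,
        InjectiveOn-respects (f [ b ]≔ y) f (∉⇒Agree f b∉W) (λ a∈W c∈W → inj (p⊆p∪q ⁅ b ⁆ a∈W) (p⊆p∪q ⁅ b ⁆ c∈W))
        where
        miss : ¬ Hits W f y
        miss (a , a∈W , fa≡y) = b∉W (subst (_∈ W) (inj (p⊆p∪q ⁅ b ⁆ a∈W) (q⊆p∪q W ⁅ b ⁆ (x∈⁅x⁆ b))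
          (trans (∉⇒Agree f b∉W a∈W) (trans fa≡y (sym (update-≡ f b))))) a∈W)
      back : ∀ {y} → ¬ Hits W f y × (P f × InjectiveOn W f) →
             P (f [ b ]≔ y) × InjectiveOn (W ∪ ⁅ b ⁆) (f [ b ]≔ y)
      back {y} (miss , p , inj) = P-resp _ _ (sym ∘ ∉⇒Agree f (b∉W ∘ U⊆W)) p , inj′
        where
        clash : ∀ {a} → a ∈ W → (f [ b ]≔ y) ! a ≢ (f [ b ]≔ y) ! b
        clash {a} a∈W eq = miss (a , a∈W , trans (sym (∉⇒Agree f b∉W a∈W)) (trans eq (update-≡ f b)))
        inj′ : InjectiveOn (W ∪ ⁅ b ⁆) (f [ b ]≔ y)
        inj′ a∈ c∈ eq with x∈p∪q⁻ W ⁅ b ⁆ a∈ | x∈p∪q⁻ W ⁅ b ⁆ c∈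
        ... | inj₁ a∈W | inj₁ c∈W = InjectiveOn-respects f (f [ b ]≔ y) (sym ∘ ∉⇒Agree f b∉W) inj a∈W c∈W eq
        ... | inj₁ a∈W | inj₂ c∈b = contradiction (trans eq (cong ((f [ b ]≔ y) !_) (x∈⁅y⁆⇒x≡y b c∈b))) (clash a∈W)
        ... | inj₂ a∈b | inj₁ c∈W = contradiction (trans (sym eq) (cong ((f [ b ]≔ y) !_) (x∈⁅y⁆⇒x≡y b a∈b))) (clash c∈W)
        ... | inj₂ a∈b | inj₂ c∈b = trans (x∈⁅y⁆⇒x≡y b a∈b) (sym (x∈⁅y⁆⇒x≡y b c∈b))
      inner : count (λ y → injective-on? (W ∪ ⁅ b ⁆) (f [ b ]≔ y)) (allFin n) ≡ j * 𝟙 (injective-on? W f)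
      inner = begin
        count (λ y → injective-on? (W ∪ ⁅ b ⁆) (f [ b ]≔ y)) (allFin n)
          ≡⟨ count-cong (λ y → injective-on? (W ∪ ⁅ b ⁆) (f [ b ]≔ y)) (λ y → ¬? (hits? W f y) ×-dec injective-on? W f) forth back (allFin n) ⟩
        count (λ y → ¬? (hits? W f y) ×-dec injective-on? W f) (allFin n)
          ≡⟨ sumOver-cong (allFin n) (λ y → 𝟙-× (¬? (hits? W f y)) (injective-on? W f)) ⟩
        sumOver (allFin n) (λ y → 𝟙 (¬? (hits? W f y)) * 𝟙 (injective-on? W f))
          ≡⟨ sumOver-*ʳ (allFin n) _ _ ⟩
        count (¬? ∘ hits? W f) (allFin n) * 𝟙 (injective-on? W f)
          ≡⟨ missed (injective-on? W f) ⟩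
        j * 𝟙 (injective-on? W f)
          ∎
        where
        -- Only an `f` injective on `W` misses exactly `j` values; for any other `f` both products
        -- vanish.
        missed : (d : Dec (P f × InjectiveOn W f)) → count (¬? ∘ hits? W f) (allFin n) * 𝟙 d ≡ j * 𝟙 d
        missed (yes (_ , inj)) = cong (_* 1) (ℕ.+-cancelˡ-≡ ∣ W ∣ _ _ (begin
          ∣ W ∣ + count (¬? ∘ hits? W f) (allFin n)
            ≡⟨ cong (_+ count (¬? ∘ hits? W f) (allFin n)) (count-hits W f inj) ⟨
          count (hits? W f) (allFin n) + count (¬? ∘ hits? W f) (allFin n)
            ≡⟨ count-¬ (hits? W f) (allFin n) ⟩
          length (allFin n)  ≡⟨ length-allFin n ⟩
          n                  ≡⟨ ∣W∣+j≡n ⟨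
          ∣ W ∣ + j          ∎))
        missed (no _) = trans (ℕ.*-zeroʳ (count (¬? ∘ hits? W f) (allFin n))) (sym (ℕ.*-zeroʳ j))

module _ {n : ℕ} {U : Subset n} {P : Vec (Fin n) n → Set} (P? : Decidable P) (P-resp : Respects U P) where

  -- Adding the missing elements to `W` one by one contributes the factors j, j - 1, ..., 1 over `n`
  -- each. This is the passage between maps and permutations: the proportion j! / n^j is the same
  -- for every property decided on `U`.
  count-injective : ∀ j {W} → U ⊆ W → ∣ W ∣ + j ≡ n →
    n ℕ.^ j * count (injective-on? P? P-resp ⊤) (allMaps n n) ≡
    j ! * count (injective-on? P? P-resp W) (allMaps n n)
  count-injective zero {W} U⊆W ∣W∣≡n =
    cong (λ V → 1 * count (injective-on? P? P-resp V) (allMaps n n))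
      (sym (∣p∣≡n⇒p≡⊤ (trans (sym (ℕ.+-identityʳ _)) ∣W∣≡n)))
  count-injective (suc j) {W} U⊆W ∣W∣+1+j≡n
    with b , b∉W ← ∃∉ W (subst (∣ W ∣ <_) ∣W∣+1+j≡n (ℕ.m<m+n ∣ W ∣ (s≤s z≤n))) = begin
    n * n ℕ.^ j * X ⊤                       ≡⟨ ℕ.*-assoc n (n ℕ.^ j) _ ⟩
    n * (n ℕ.^ j * X ⊤)                     ≡⟨ cong (n *_) (count-injective j (p⊆p∪q ⁅ b ⁆ ∘ U⊆W) (trans
                                                 (cong (_+ j) (∣p∪⁅x⁆∣≡1+∣p∣ W b∉W))
                                                 (trans (sym (ℕ.+-suc ∣ W ∣ j)) ∣W∣+1+j≡n))) ⟩
    n * (j ! * X (W ∪ ⁅ b ⁆))               ≡⟨ swapˡ n (j !) _ ⟩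
    j ! * (n * X (W ∪ ⁅ b ⁆))               ≡⟨ cong (j ! *_) (count-insert P? P-resp U⊆W b∉W ∣W∣+1+j≡n) ⟩
    j ! * (suc j * X W)                     ≡⟨ ℕ.*-assoc (j !) (suc j) _ ⟨
    j ! * suc j * X W                       ≡⟨ cong (_* X W) (ℕ.*-comm (j !) (suc j)) ⟩
    suc j * j ! * X W                       ∎
    where
    open ≡-Reasoning
    X : Subset n → ℕ
    X V = count (injective-on? P? P-resp V) (allMaps n n)
    swapˡ : ∀ a b c → a * (b * c) ≡ b * (a * c)
    swapˡ = solve-∀

-- Coordinates in `U` are forced and the others are free; the factor `n ^ ∣ U ∣` avoids a
-- subtraction in the exponent.
count-agree : ∀ (U : Subset k) (g : Vec (Fin n) k) →
              count (λ f → agree? U f g) (allMaps n k) * n ℕ.^ ∣ U ∣ ≡ n ℕ.^ k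
count-agree {n = n} [] [] = cong (λ x → (x + 0) * 1) (𝟙-yes (agree? {n = n} [] [] []) λ {i} → λ ())
count-agree {suc k} {n} (s ∷ U) (z ∷ g) = trans
  (cong (_* n ℕ.^ ∣ s ∷ U ∣) (sumMaps-suc n k _)) (go s)
  where
  open ≡-Reasoning
  c : ℕ
  c = count (λ f → agree? U f g) (allMaps n k)
  go : ∀ s → sumOver (allFin n) (λ y → count (λ f → agree? (s ∷ U) (y ∷ f) (z ∷ g)) (allMaps n k)) * n ℕ.^ ∣ s ∷ U ∣
       ≡ n ℕ.^ suc k
  go outside = begin
    sumOver (allFin n) (λ y → count (λ f → agree? (outside ∷ U) (y ∷ f) (z ∷ g)) (allMaps n k)) * n ℕ.^ ∣ U ∣
      ≡⟨ cong (_* n ℕ.^ ∣ U ∣) (sumOver-cong (allFin n) λ y → count-cong (λ f → agree? (outside ∷ U) (y ∷ f) (z ∷ g)) (λ f → agree? U f g)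
           (λ h i∈U → h (Vec.there i∈U)) (λ h {i} → λ { (Vec.there i∈U) → h i∈U }) (allMaps n k)) ⟩
    sumOver (allFin n) (λ _ → c) * n ℕ.^ ∣ U ∣
      ≡⟨ cong (_* n ℕ.^ ∣ U ∣) (trans (sumOver-const (allFin n) c) (cong (_* c) (length-allFin n))) ⟩
    n * c * n ℕ.^ ∣ U ∣     ≡⟨ ℕ.*-assoc n c _ ⟩
    n * (c * n ℕ.^ ∣ U ∣)   ≡⟨ cong (n *_) (count-agree U g) ⟩
    n ℕ.^ suc k             ∎
  go inside = begin
    sumOver (allFin n) (λ y → count (λ f → agree? (inside ∷ U) (y ∷ f) (z ∷ g)) (allMaps n k)) * (n * n ℕ.^ ∣ U ∣)
      ≡⟨ cong (_* (n * n ℕ.^ ∣ U ∣)) (sumOver-cong (allFin n) λ y → trans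
           (sumOver-cong (allMaps n k) λ f → trans
             (𝟙-cong (agree? (inside ∷ U) (y ∷ f) (z ∷ g)) ((y Fin.≟ z) ×-dec agree? U f g)
               (λ h → h Vec.here , λ i∈U → h (Vec.there i∈U))
               (λ (y≡z , h) → λ { {zero} _ → y≡z ; {suc i} i∈ → h (drop-there i∈) }))
             (𝟙-× (y Fin.≟ z) (agree? U f g)))
           (sumOver-*ˡ (𝟙 (y Fin.≟ z)) (allMaps n k) _)) ⟩
    sumOver (allFin n) (λ y → 𝟙 (y Fin.≟ z) * c) * (n * n ℕ.^ ∣ U ∣)
      ≡⟨ cong (_* (n * n ℕ.^ ∣ U ∣)) (sumOver-*ʳ (allFin n) _ c) ⟩
    count (Fin._≟ z) (allFin n) * c * (n * n ℕ.^ ∣ U ∣)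
      ≡⟨ cong (λ x → x * c * (n * n ℕ.^ ∣ U ∣)) (ℕ.≤-antisym
           (count-≤1 (Fin._≟ z) (Unique.allFin⁺ n) λ x≡z y≡z → trans x≡z (sym y≡z))
           (count-∈ (Fin._≟ z) (∈-allFin z) refl)) ⟩
    1 * c * (n * n ℕ.^ ∣ U ∣)   ≡⟨ rearrange c n (n ℕ.^ ∣ U ∣) ⟩
    n * (c * n ℕ.^ ∣ U ∣)       ≡⟨ cong (n *_) (count-agree U g) ⟩
    n ℕ.^ suc k                 ∎
    where
    rearrange : ∀ a b c → 1 * a * (b * c) ≡ b * (a * c)
    rearrange = solve-∀

abstract
  -- n ^ (n ∸ ∣ U ∣) maps extend g, and a proportion (n ∸ ∣ U ∣)! / n ^ (n ∸ ∣ U ∣) of them is injective.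
  extend-injective : ∀ {U : Subset n} (g : Vec (Fin n) n) → InjectiveOn U g →
                     ∃[ f ] InjectiveOn ⊤ f × Agree U g f
  extend-injective {n} {U} g inj = f , f-inj , λ {i} → agree {i}
    where
    agree-U? : Decidable (Agree U g)
    agree-U? = λ f → agree? U g f
    agree-resp : Respects U (λ f → Agree U g f)
    agree-resp _ _ f≡h g≡f i∈U = trans (g≡f i∈U) (f≡h i∈U)
    j : ℕ
    j = n ℕ.∸ ∣ U ∣
    X : Subset n → ℕ
    X = λ V → count (injective-on? agree-U? agree-resp V) (allMaps n n)
    positive : 1 ≤ n ℕ.^ j * X ⊤
    positive = begin
      1 * 1           ≤⟨ ℕ.*-mono-≤ (ℕ.1≤n! j) (count-∈ (injective-on? agree-U? agree-resp U)
                                                (∈-allMaps g) ((λ _ → refl) , inj)) ⟩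
      j ! * X U       ≡⟨ count-injective agree-U? agree-resp j id (ℕ.m+[n∸m]≡n (∣p∣≤n U)) ⟨
      n ℕ.^ j * X ⊤   ∎
      where open ≤-Reasoning
    X⊤>0 : ∀ x → 1 ≤ n ℕ.^ j * x → 1 ≤ x
    X⊤>0 zero    1≤ = subst (1 ≤_) (ℕ.*-zeroʳ (n ℕ.^ j)) 1≤
    X⊤>0 (suc x) _  = s≤s z≤n
    found : ∃[ f ] Agree U g f × InjectiveOn ⊤ f
    found = count>0 (injective-on? agree-U? agree-resp ⊤) (allMaps n n) (X⊤>0 (X ⊤) positive)
    f : Vec (Fin n) n
    f = proj₁ found
    agree : Agree U g f
    agree = proj₁ (proj₂ found)
    f-inj : InjectiveOn ⊤ f
    f-inj = proj₂ (proj₂ found)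

-- Relabelling graphs

lookup-injective : {A : Set} {xs : List A} → Unique xs → ∀ i j → List.lookup xs i ≡ List.lookup xs j → i ≡ j
lookup-injective (x∉xs ∷ u) zero    zero    _  = refl
lookup-injective (x∉xs ∷ u) zero    (suc j) eq = contradiction eq (All.lookup x∉xs (∈-lookup j))
lookup-injective (x∉xs ∷ u) (suc i) zero    eq = contradiction (sym eq) (All.lookup x∉xs (∈-lookup i))
lookup-injective (x∉xs ∷ u) (suc i) (suc j) eq = cong suc (lookup-injective u i j eq)

∈-setOf⁻ : {P : Fin k → Set} (P? : Decidable P) → ∀ {x} → x ∈ setOf P? → P x
∈-setOf⁻ P? {x} x∈ with P? x | trans (sym (lookup∘tabulate (does ∘ P?) x)) ([]=⇒lookup x∈)
... | yes px | _  = px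
... | no _   | ()

infix 4 _≟ˢ_
_≟ˢ_ : (p q : Subset k) → Dec (p ≡ q)
_≟ˢ_ = ≡-dec Bool._≟_

allSubsets-unique : ∀ k → Unique (allSubsets k)
allSubsets-unique zero    = [] ∷ []
allSubsets-unique (suc k) = Unique.++⁺
  (Unique.map⁺ (proj₂ ∘ ∷-injective) (allSubsets-unique k))
  (Unique.map⁺ (proj₂ ∘ ∷-injective) (allSubsets-unique k))
  λ (i , o) → heads-differ (∈-map⁻ _ i) (∈-map⁻ _ o)
  where
  heads-differ : ∀ {v : Subset (suc k)} → ∃[ p ] p ∈ˡ allSubsets k × v ≡ inside ∷ p →
                 ¬ (∃[ q ] q ∈ˡ allSubsets k × v ≡ outside ∷ q)
  heads-differ (_ , _ , refl) (_ , _ , ())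

𝟙≡count : {P : Set} {B : Set} {R : B → Set} (P? : Dec P) (R? : Decidable R) → ∀ {ys} → Unique ys →
  (P → ∃[ y ] y ∈ˡ ys × R y) → (∀ {y} → R y → P) → (∀ {y z} → R y → R z → y ≡ z) →
  𝟙 P? ≡ count R? ys
𝟙≡count P? R? {ys} u P⇒R R⇒P unq = ℕ.≤-antisym
  (𝟙≤ P? λ p → let _ , y∈ , r = P⇒R p in count-∈ R? y∈ r)
  (bound P?)
  where
  bound : ∀ P? → count R? ys ≤ 𝟙 P?
  bound (yes _) = count-≤1 R? u unq
  bound (no ¬p) = ℕ.≤-reflexive (count-∄ R? ys λ _ _ → ¬p ∘ R⇒P)

module _ {k : ℕ} where

  abstract
    -- Pigeonhole: the `k` distinct values already account for all of `Fin k`, so the number of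
    -- missed values is zero.
    image-of-⊤ : (f : Vec (Fin k) k) → InjectiveOn ⊤ f → ∀ y → ∃[ x ] f ! x ≡ y
    image-of-⊤ f inj y with hits? ⊤ f y
    ... | yes (x , _ , fx≡y) = x , fx≡y
    ... | no miss = contradiction (count-∈ (¬? ∘ hits? ⊤ f) (∈-allFin y) miss) (ℕ.<⇒≱ (s≤s (ℕ.≤-reflexive
      (ℕ.+-cancelˡ-≡ k _ _ (begin
        k + misses                             ≡⟨ cong (_+ misses) (∣⊤∣≡n k) ⟨
        ∣ ⊤ {k} ∣ + misses                     ≡⟨ cong (_+ misses) (count-hits ⊤ f inj) ⟨
        count (hits? ⊤ f) (allFin k) + misses  ≡⟨ count-¬ (hits? ⊤ f) (allFin k) ⟩
        length (allFin k)                      ≡⟨ length-allFin k ⟩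
        k                                      ≡⟨ ℕ.+-identityʳ k ⟨
        k + 0                                  ∎)))))
      where
      open ≡-Reasoning
      misses : ℕ
      misses = count (¬? ∘ hits? ⊤ f) (allFin k)

  inverse : (f : Vec (Fin k) k) → InjectiveOn ⊤ f → Vec (Fin k) k
  inverse f inj = Vec.tabulate (proj₁ ∘ image-of-⊤ f inj)

  module _ (f : Vec (Fin k) k) (inj : InjectiveOn ⊤ f) where

    f[inverse] : ∀ y → f ! (inverse f inj ! y) ≡ y
    f[inverse] y = trans (cong (f !_) (lookup∘tabulate _ y)) (proj₂ (image-of-⊤ f inj y))

    inverse[f] : ∀ x → inverse f inj ! (f ! x) ≡ x
    inverse[f] x = inj ∈⊤ ∈⊤ (f[inverse] (f ! x))

    inverse-injective : InjectiveOn ⊤ (inverse f inj)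
    inverse-injective {a} {b} _ _ eq = trans (sym (f[inverse] a)) (trans (cong (f !_) eq) (f[inverse] b))

  infixr 9 _∘ᵛ_
  _∘ᵛ_ : Vec (Fin k) k → Vec (Fin k) k → Vec (Fin k) k
  f ∘ᵛ g = Vec.tabulate λ x → f ! (g ! x)

  ∘ᵛ-! : ∀ f g x → (f ∘ᵛ g) ! x ≡ f ! (g ! x)
  ∘ᵛ-! f g x = lookup∘tabulate _ x

  ∘ᵛ-injective : ∀ f g → InjectiveOn ⊤ f → InjectiveOn ⊤ g → InjectiveOn ⊤ (f ∘ᵛ g)
  ∘ᵛ-injective f g f-inj g-inj {a} {b} _ _ eq =
    g-inj ∈⊤ ∈⊤ (f-inj ∈⊤ ∈⊤ (trans (sym (∘ᵛ-! f g a)) (trans eq (∘ᵛ-! f g b))))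

module Relabelling (n : ℕ) where
  open Subgraphs n

  Map : Set
  Map = Vec (Fin n) n

  maps : List Map
  maps = allMaps n n

  src tgt : Edge → Fin n
  src x = proj₁ (ends x)
  tgt x = proj₂ (ends x)

  Joins : Edge → Fin n → Fin n → Set
  Joins x u w = ends x ≡ (u , w) ⊎ ends x ≡ (w , u)

  joins? : ∀ x u w → Dec (Joins x u w)
  joins? x u w = Product.≡-dec Fin._≟_ Fin._≟_ (ends x) (u , w) ⊎-dec Product.≡-dec Fin._≟_ Fin._≟_ (ends x) (w , u)

  edges-unique : Unique edges
  edges-unique = Unique.filter⁺ _ (Unique.cartesianProduct⁺ (Unique.allFin⁺ n) (Unique.allFin⁺ n))

  src<tgt : ∀ x → src x Fin.< tgt x
  src<tgt x = proj₂ (∈-filter⁻ (λ (u , w) → u Fin.<? w) {xs = cartesianProduct (allFin n) (allFin n)} (∈-lookup {xs = edges} x))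

  edge-between : ∀ {u w} → u ≢ w → ∃[ x ] Joins x u w
  edge-between {u} {w} u≢w with Fin.<-cmp u w
  ... | tri≈ _ u≡w _ = contradiction u≡w u≢w
  ... | tri< u<w _ _ = Any.index uw∈ , inj₁ (sym (lookup-index uw∈))
    where uw∈ = ∈-filter⁺ (λ (u , w) → u Fin.<? w) (∈-cartesianProduct⁺ (∈-allFin u) (∈-allFin w)) u<w
  ... | tri> _ _ w<u = Any.index wu∈ , inj₂ (sym (lookup-index wu∈))
    where wu∈ = ∈-filter⁺ (λ (u , w) → u Fin.<? w) (∈-cartesianProduct⁺ (∈-allFin w) (∈-allFin u)) w<u

  joins-sym : ∀ {x u w} → Joins x u w → Joins x w u
  joins-sym (inj₁ eq) = inj₂ eq
  joins-sym (inj₂ eq) = inj₁ eq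

  joins-< : ∀ {x u w} → Joins x u w → u Fin.< w → ends x ≡ (u , w)
  joins-< (inj₁ eq) _ = eq
  joins-< {x} (inj₂ eq) u<w = contradiction (subst (λ (a , b) → a Fin.< b) eq (src<tgt x)) (Fin.<-asym u<w)

  joins-unique : ∀ {x y u w} → Joins x u w → Joins y u w → x ≡ y
  joins-unique {x} {y} {u} {w} xuw yuw with Fin.<-cmp u w
  ... | tri< u<w _ _ = lookup-injective edges-unique x y (trans (joins-< xuw u<w) (sym (joins-< yuw u<w)))
  ... | tri> _ _ w<u = lookup-injective edges-unique x y
    (trans (joins-< (joins-sym xuw) w<u) (sym (joins-< (joins-sym yuw) w<u)))
  joins-unique {x} (inj₁ eq) yuw | tri≈ _ refl _ =
    contradiction (subst (λ (a , b) → a Fin.< b) eq (src<tgt x)) (Fin.<-irrefl refl)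
  joins-unique {x} (inj₂ eq) yuw | tri≈ _ refl _ =
    contradiction (subst (λ (a , b) → a Fin.< b) eq (src<tgt x)) (Fin.<-irrefl refl)

  joins-≢ : ∀ {x u w} → Joins x u w → u ≢ w
  joins-≢ {x} (inj₁ eq) refl = Fin.<-irrefl refl (subst (λ (a , b) → a Fin.< b) eq (src<tgt x))
  joins-≢ {x} (inj₂ eq) refl = Fin.<-irrefl refl (subst (λ (a , b) → a Fin.< b) eq (src<tgt x))

  joins-ends : ∀ {x a b c d} → Joins x a b → Joins x c d → (a ≡ c × b ≡ d) ⊎ (a ≡ d × b ≡ c)
  joins-ends {x} (inj₁ p) (inj₁ r) with refl ← trans (sym p) r = inj₁ (refl , refl)
  joins-ends {x} (inj₁ p) (inj₂ r) with refl ← trans (sym p) r = inj₂ (refl , refl)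
  joins-ends {x} (inj₂ p) (inj₁ r) with refl ← trans (sym p) r = inj₂ (refl , refl)
  joins-ends {x} (inj₂ p) (inj₂ r) with refl ← trans (sym p) r = inj₁ (refl , refl)

  joins-other : ∀ {x u a b} → Joins x u a → Joins x u b → a ≡ b
  joins-other xua xub with joins-ends xua xub
  ... | inj₁ (_ , a≡b)   = a≡b
  ... | inj₂ (u≡b , a≡u) = trans a≡u u≡b

  self-joins : ∀ x → Joins x (src x) (tgt x)
  self-joins x = inj₁ refl

  ∈⇒Adj : ∀ {G x} → x ∈ G → Adj G (src x) (tgt x)
  ∈⇒Adj {x = x} x∈G = x , x∈G , self-joins x

  Adj⇒∈ : ∀ {G x u w} → Joins x u w → Adj G u w → x ∈ G
  Adj⇒∈ {G} xuw (y , y∈G , yuw) = subst (_∈ G) (joins-unique yuw xuw) y∈G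

  Adj-sym : ∀ {G u w} → Adj G u w → Adj G w u
  Adj-sym (x , x∈G , xuw) = x , x∈G , joins-sym xuw

  Adj-≢ : ∀ {G u w} → Adj G u w → u ≢ w
  Adj-≢ (x , _ , xuw) = joins-≢ xuw

  Adj-mono : ∀ {G H u w} → G ⊆ H → Adj G u w → Adj H u w
  Adj-mono G⊆H (x , x∈G , xuw) = x , G⊆H x∈G , xuw

  Adj⇒⊆ : ∀ {G H} → (∀ u w → Adj G u w → Adj H u w) → G ⊆ H
  Adj⇒⊆ G⇒H {x} x∈G = Adj⇒∈ (self-joins x) (G⇒H _ _ (∈⇒Adj x∈G))

  ∈V⁺ : ∀ {G u w} → Adj G u w → u ∈ V G
  ∈V⁺ {G} (x , x∈G , inj₁ eq) = ∈-setOf (covered? G) (x , x∈G , inj₁ (sym (cong proj₁ eq)))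
  ∈V⁺ {G} (x , x∈G , inj₂ eq) = ∈-setOf (covered? G) (x , x∈G , inj₂ (sym (cong proj₂ eq)))

  ∈V⁻ : ∀ {G u} → u ∈ V G → ∃[ w ] Adj G u w
  ∈V⁻ {G} u∈V with ∈-setOf⁻ (covered? G) u∈V
  ... | x , x∈G , inj₁ refl = _ , ∈⇒Adj x∈G
  ... | x , x∈G , inj₂ refl = _ , Adj-sym (∈⇒Adj x∈G)

  V-mono : ∀ {G H} → G ⊆ H → V G ⊆ V H
  V-mono G⊆H u∈V = ∈V⁺ (Adj-mono G⊆H (proj₂ (∈V⁻ u∈V)))

  -- The preimage of `G` on vertex pairs. Preimages make sense for every map, injective or not, and
  -- `A ⊆ pull f H` says that `f` is a homomorphism from `A` to `H`. For permutations the graphs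
  -- `pull f G` are the copies of `G`.
  pull : Map → Graph → Graph
  pull f G = setOf λ x → adj? G (f ! src x) (f ! tgt x)

  ∈-pull⁺ : ∀ {f G x} → Adj G (f ! src x) (f ! tgt x) → x ∈ pull f G
  ∈-pull⁺ {f} {G} = ∈-setOf λ x → adj? G (f ! src x) (f ! tgt x)

  ∈-pull⁻ : ∀ {f G x} → x ∈ pull f G → Adj G (f ! src x) (f ! tgt x)
  ∈-pull⁻ {f} {G} = ∈-setOf⁻ λ x → adj? G (f ! src x) (f ! tgt x)

  Adj-pull⁺ : ∀ {f G u w} → Adj G (f ! u) (f ! w) → Adj (pull f G) u w
  Adj-pull⁺ {f} {G} {u} {w} a with edge-between {u} {w} (Adj-≢ {G} a ∘ cong (f !_))
  ... | x , inj₁ eq = x , ∈-pull⁺ {f} {G} (subst (λ (u , w) → Adj G (f ! u) (f ! w)) (sym eq) a) , inj₁ eq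
  ... | x , inj₂ eq = x , ∈-pull⁺ {f} {G} (subst (λ (u , w) → Adj G (f ! u) (f ! w)) (sym eq) (Adj-sym {G} a)) , inj₂ eq

  Adj-pull⁻ : ∀ {f G u w} → Adj (pull f G) u w → Adj G (f ! u) (f ! w)
  Adj-pull⁻ {f} {G} (x , x∈ , inj₁ eq) = subst (λ (u , w) → Adj G (f ! u) (f ! w)) eq (∈-pull⁻ {f} {G} x∈)
  Adj-pull⁻ {f} {G} (x , x∈ , inj₂ eq) = Adj-sym {G} (subst (λ (u , w) → Adj G (f ! u) (f ! w)) eq (∈-pull⁻ {f} {G} x∈))

  pull-∘ : ∀ f g G → pull g (pull f G) ≡ pull (f ∘ᵛ g) G
  pull-∘ f g G = ⊆-antisym
    (Adj⇒⊆ {pull g (pull f G)} {pull (f ∘ᵛ g) G} λ u w a → Adj-pull⁺ {f ∘ᵛ g} {G}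
      (subst₂ (Adj G) (sym (∘ᵛ-! f g u)) (sym (∘ᵛ-! f g w)) (Adj-pull⁻ {f} {G} (Adj-pull⁻ {g} {pull f G} a))))
    (Adj⇒⊆ {pull (f ∘ᵛ g) G} {pull g (pull f G)} λ u w a → Adj-pull⁺ {g} {pull f G} (Adj-pull⁺ {f} {G}
      (subst₂ (Adj G) (∘ᵛ-! f g u) (∘ᵛ-! f g w) (Adj-pull⁻ {f ∘ᵛ g} {G} a))))

  pull-identity : ∀ {f} G → (∀ x → f ! x ≡ x) → pull f G ≡ G
  pull-identity {f} G f≡id = ⊆-antisym
    (Adj⇒⊆ {pull f G} {G} λ u w a → subst₂ (Adj G) (f≡id u) (f≡id w) (Adj-pull⁻ {f} {G} a))
    (Adj⇒⊆ {G} {pull f G} λ u w a → Adj-pull⁺ {f} {G} (subst₂ (Adj G) (sym (f≡id u)) (sym (f≡id w)) a))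

  module _ (f : Map) (inj : InjectiveOn ⊤ f) where

    pull-inverse : ∀ G → pull (inverse f inj) (pull f G) ≡ G
    pull-inverse G = trans (pull-∘ f (inverse f inj) G)
      (pull-identity {f ∘ᵛ inverse f inj} G λ x → trans (∘ᵛ-! f (inverse f inj) x) (f[inverse] f inj x))

    pull-≅ : ∀ G → pull f G ≅ G
    pull-≅ G = record
      { bijection = mk↔ₛ′
          (λ (u , i) → f ! u , ∈V⁺ {G} (Adj-pull⁻ {f} {G} (proj₂ (∈V⁻ {pull f G} i))))
          (λ (u , i) → inverse f inj ! u , ∈V⁺ {pull f G} (Adj-pull⁺ {f} {G}
            (subst₂ (Adj G) (sym (f[inverse] f inj u)) (sym (f[inverse] f inj _)) (proj₂ (∈V⁻ {G} i)))))
          (λ (u , i) → vertex-≡ (f[inverse] f inj u))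
          (λ (u , i) → vertex-≡ (inverse[f] f inj u))
      ; adjacency = λ u w → mk⇔ (Adj-pull⁻ {f} {G}) (Adj-pull⁺ {f} {G})
      }
      where
      vertex-≡ : ∀ {p : Subset n} {x y : ∃ (_∈ p)} → proj₁ x ≡ proj₁ y → x ≡ y
      vertex-≡ {x = u , i} {y = _ , j} refl = cong (u ,_) (∈-irrelevant i j)

    e-pull-≤ : ∀ G → e (pull f G) ≤ e G
    e-pull-≤ G = subst₂ _≤_ (sym (∣p∣≡count (pull f G))) (sym (∣p∣≡count G))
      (count-injection (_∈? pull f G) (_∈? G)
        (λ x y → (y ∈? G) ×-dec joins? y (f ! src x) (f ! tgt x)) (Unique.allFin⁺ _)
        (λ x∈ → let y , y∈G , y-joins = ∈-pull⁻ {f} {G} x∈ in y , ∈-allFin y , y∈G , y-joins)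
        proj₁
        λ (_ , y-joins) (_ , y-joins′) → same (joins-ends y-joins y-joins′))
      where
      same : ∀ {x x′} → (f ! src x ≡ f ! src x′ × f ! tgt x ≡ f ! tgt x′) ⊎
                        (f ! src x ≡ f ! tgt x′ × f ! tgt x ≡ f ! src x′) → x ≡ x′
      same {x} {x′} (inj₁ (p , r)) = joins-unique (self-joins x)
        (inj₁ (sym (cong₂ _,_ (inj ∈⊤ ∈⊤ p) (inj ∈⊤ ∈⊤ r))))
      same {x} {x′} (inj₂ (p , r)) = joins-unique (self-joins x)
        (inj₂ (sym (cong₂ _,_ (inj ∈⊤ ∈⊤ r) (inj ∈⊤ ∈⊤ p))))

  -- The inequality is applied to the permutation and to its inverse.
  e-pull : ∀ f → InjectiveOn ⊤ f → ∀ G → e (pull f G) ≡ e G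
  e-pull f inj G = ℕ.≤-antisym (e-pull-≤ f inj G)
    (subst (λ G′ → e G′ ≤ e (pull f G)) (pull-inverse f inj G)
      (e-pull-≤ (inverse f inj) (inverse-injective f inj) (pull f G)))

  module _ {S G : Graph} (φ : S ≅ G) where
    open _≅_ φ
    open Inverse bijection using (strictlyInverseˡ; strictlyInverseʳ)

    private
      partial : Fin n → Fin n
      partial u with u ∈? V S
      ... | yes i = proj₁ (to (u , i))
      -- An arbitrary default: injectivity and agreement are claimed on `V S` only, and
      -- `extend-injective` chooses the other values afresh.
      ... | no _  = u

      partial-≡ : ∀ {u} (i : u ∈ V S) → partial u ≡ proj₁ (to (u , i))
      partial-≡ {u} i with u ∈? V S
      ... | yes j  = cong (λ j → proj₁ (to (u , j))) (∈-irrelevant j i)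
      ... | no u∉S = contradiction i u∉S

      vertex-map : Map
      vertex-map = Vec.tabulate partial

      vertex-map-≡ : ∀ {u} (i : u ∈ V S) → vertex-map ! u ≡ proj₁ (to (u , i))
      vertex-map-≡ {u} i = trans (lookup∘tabulate partial u) (partial-≡ i)

      vertex-map-injective : InjectiveOn (V S) vertex-map
      vertex-map-injective {a} {b} a∈ b∈ eq = cong proj₁ (trans (sym (strictlyInverseʳ (a , a∈)))
        (trans (cong from (same (to (a , a∈)) (to (b , b∈))
          (trans (sym (vertex-map-≡ a∈)) (trans eq (vertex-map-≡ b∈))))) (strictlyInverseʳ (b , b∈))))
        where
        same : ∀ (x y : Vertex G) → proj₁ x ≡ proj₁ y → x ≡ y
        same (u , i) (_ , j) refl = cong (u ,_) (∈-irrelevant i j)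

    pull≡ : ∀ f → InjectiveOn ⊤ f → Agree (V S) vertex-map f → pull f G ≡ S
    pull≡ f f-inj agree = ⊆-antisym (Adj⇒⊆ {pull f G} {S} pull⇒S) (Adj⇒⊆ {S} {pull f G} S⇒pull)
      where
      f-≡ : ∀ {u} (i : u ∈ V S) → f ! u ≡ proj₁ (to (u , i))
      f-≡ i = trans (sym (agree i)) (vertex-map-≡ i)
      -- The isomorphism already provides a vertex of `S` with the image `f ! u`, and injectivity of
      -- `f` identifies it with `u`. So no vertex outside `S` is sent into `V G`.
      covered : ∀ {u} → f ! u ∈ V G → u ∈ V S
      covered {u} fu∈ = subst (_∈ V S)
        (f-inj ∈⊤ ∈⊤ (trans (f-≡ (proj₂ w)) (cong proj₁ (strictlyInverseˡ (f ! u , fu∈))))) (proj₂ w)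
        where w = from (f ! u , fu∈)
      S⇒pull : ∀ u w → Adj S u w → Adj (pull f G) u w
      S⇒pull u w a = Adj-pull⁺ {f} {G} (subst₂ (Adj G) (sym (f-≡ i)) (sym (f-≡ j))
        (Equivalence.to (adjacency (u , i) (w , j)) a))
        where
        i = ∈V⁺ {S} a
        j = ∈V⁺ {S} (Adj-sym {S} a)
      pull⇒S : ∀ u w → Adj (pull f G) u w → Adj S u w
      pull⇒S u w a = Equivalence.from (adjacency (u , i) (w , j)) (subst₂ (Adj G) (f-≡ i) (f-≡ j) fa)
        where
        fa = Adj-pull⁻ {f} {G} a
        i = covered (∈V⁺ {G} fa)
        j = covered (∈V⁺ {G} (Adj-sym {G} fa))

    -- An isomorphism is an injection on `V S` alone; extended to a permutation of all vertices it
    -- becomes a relabelling. Copies can therefore be treated as the orbit of `G` under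
    -- permutations.
    ≅⇒pull : ∃[ f ] InjectiveOn ⊤ f × pull f G ≡ S
    ≅⇒pull with f , f-inj , agree ← extend-injective {U = V S} vertex-map vertex-map-injective =
      f , f-inj , pull≡ f f-inj agree

-- Fibres of the map from permutations to copies

module Labellings (n : ℕ) where
  open Subgraphs n
  open Relabelling n

  module _ (H : Graph) where

    labels? : ∀ S f → Dec (InjectiveOn ⊤ f × pull f H ≡ S)
    labels? S f = injectiveOn? ⊤ f ×-dec (pull f H ≟ˢ S)

    -- The size of the fibre of `f ↦ pull f H` over `S`; at `S = H` it is the order of the
    -- stabiliser of `H` in the symmetric group.
    labellings : Graph → ℕ
    labellings S = count (labels? S) maps

    -- Composition with `σ` carries the fibre over `S` into the fibre over `pull σ S`, and it is
    -- injective because `σ` can be undone.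
    labellings-pull-≤ : ∀ S σ → InjectiveOn ⊤ σ → labellings S ≤ labellings (pull σ S)
    labellings-pull-≤ S σ σ-inj = count-injection (labels? S) (labels? (pull σ S))
      (λ f g → labels? S f ×-dec ≡-dec Fin._≟_ g (f ∘ᵛ σ)) (allMaps-unique n n)
      (λ {f} l → f ∘ᵛ σ , ∈-allMaps _ , l , refl)
      (λ { {f} ((f-inj , refl) , refl) → ∘ᵛ-injective f σ f-inj σ-inj , sym (pull-∘ f σ H) })
      λ { {f} {f′} (_ , refl) (_ , eq) → sym (pointwise f′ f λ x → begin
        f′ ! x                       ≡⟨ cong (f′ !_) (f[inverse] σ σ-inj x) ⟨
        f′ ! (σ ! (σ⁻¹ ! x))         ≡⟨ ∘ᵛ-! f′ σ _ ⟨
        (f′ ∘ᵛ σ) ! (σ⁻¹ ! x)        ≡⟨ cong (λ g → g ! (σ⁻¹ ! x)) eq ⟨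
        (f ∘ᵛ σ) ! (σ⁻¹ ! x)         ≡⟨ ∘ᵛ-! f σ _ ⟩
        f ! (σ ! (σ⁻¹ ! x))          ≡⟨ cong (f !_) (f[inverse] σ σ-inj x) ⟩
        f ! x                        ∎) }
      where
      open ≡-Reasoning
      σ⁻¹ = inverse σ σ-inj
      pointwise : ∀ {k} (f g : Vec (Fin n) k) → (∀ x → f ! x ≡ g ! x) → f ≡ g
      pointwise []      []      _  = refl
      pointwise (y ∷ f) (z ∷ g) eq = cong₂ _∷_ (eq zero) (pointwise f g (eq ∘ suc))

    labellings-pull : ∀ σ → InjectiveOn ⊤ σ → labellings (pull σ H) ≡ labellings H
    labellings-pull σ σ-inj = ℕ.≤-antisym below (labellings-pull-≤ H σ σ-inj)
      where
      below : labellings (pull σ H) ≤ labellings H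
      below = subst (λ G → labellings (pull σ H) ≤ labellings G) (pull-inverse σ σ-inj H)
        (labellings-pull-≤ (pull σ H) (inverse σ σ-inj) (inverse-injective σ σ-inj))

    labellings-≅ : ∀ {S} → S ≅ H → labellings S ≡ labellings H
    labellings-≅ {S} φ = from-pull (≅⇒pull {S} {H} φ)
      where
      from-pull : ∃[ σ ] InjectiveOn ⊤ σ × pull σ H ≡ S → labellings S ≡ labellings H
      from-pull (σ , σ-inj , eq) = trans (cong labellings (sym eq)) (labellings-pull σ σ-inj)

    module _ {Q : Graph → Set} (Q? : Decidable Q) where

      copyWith? : ∀ S → Dec (S ≅ H × Q S)
      copyWith? S = (S ≅? H) ×-dec Q? S

      private
        labels-copy? : ∀ f S → Dec ((S ≅ H × Q S) × (InjectiveOn ⊤ f × pull f H ≡ S))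
        labels-copy? f S = copyWith? S ×-dec labels? S f

        only-copies : ∀ S (d : Dec (S ≅ H × Q S)) → 𝟙 d * labellings S ≡ 𝟙 d * labellings H
        only-copies S (yes (φ , _)) = cong (1 *_) (labellings-≅ φ)
        only-copies S (no _)        = refl

        unique-copy : ∀ f → 𝟙 (injectiveOn? ⊤ f ×-dec Q? (pull f H)) ≡ count (labels-copy? f) graphs
        unique-copy f = 𝟙≡count (injectiveOn? ⊤ f ×-dec Q? (pull f H)) (labels-copy? f) (allSubsets-unique _)
          (λ (inj , q) → pull f H , ∈-allSubsets _ , (pull-≅ f inj H , q) , inj , refl)
          (λ ((_ , q) , inj , eq) → inj , subst Q (sym eq) q)
          (λ (_ , _ , eq) (_ , _ , eq′) → trans (sym eq) eq′)

      -- All fibres over copies of `H` have the size of the one over `H`, so the relabelling of `H`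
      -- by a uniform permutation is a uniform copy, that is, distributed as `ν H`.
      count-labellings : count (λ f → injectiveOn? ⊤ f ×-dec Q? (pull f H)) maps ≡
                         count copyWith? graphs * labellings H
      count-labellings = begin
        count (λ f → injectiveOn? ⊤ f ×-dec Q? (pull f H)) maps
          ≡⟨ sumOver-cong maps unique-copy ⟩
        sumOver maps (λ f → sumOver graphs (λ S → 𝟙 (labels-copy? f S)))
          ≡⟨ sumOver-swap maps graphs (λ f S → 𝟙 (labels-copy? f S)) ⟩
        sumOver graphs (λ S → sumOver maps (λ f → 𝟙 (labels-copy? f S)))
          ≡⟨ sumOver-cong graphs per-copy ⟩
        sumOver graphs (λ S → 𝟙 (copyWith? S) * labellings H)
          ≡⟨ sumOver-*ʳ graphs (λ S → 𝟙 (copyWith? S)) (labellings H) ⟩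
        count copyWith? graphs * labellings H
          ∎
        where
        open ≡-Reasoning
        per-copy : ∀ S → sumOver maps (λ f → 𝟙 (labels-copy? f S)) ≡ 𝟙 (copyWith? S) * labellings H
        per-copy S = trans (sumOver-cong maps λ f → 𝟙-× (copyWith? S) (labels? S f))
          (trans (sumOver-*ˡ (𝟙 (copyWith? S)) maps (λ f → 𝟙 (labels? S f))) (only-copies S (copyWith? S)))

-- Embeddings of connected graphs

module Embeddings (n : ℕ) (H : Subgraphs.Graph n) where
  open Subgraphs n
  open Relabelling n

  ∈neighbourhood : ∀ u → Decidable (_∈ (H ∩ setOf (incident? u)))
  ∈neighbourhood u = _∈? (H ∩ setOf (incident? u))

  joins⇒incident : ∀ {x u w} → Joins x u w → Incident u x
  joins⇒incident (inj₁ eq) = inj₁ (sym (cong proj₁ eq))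
  joins⇒incident (inj₂ eq) = inj₂ (sym (cong proj₂ eq))

  incident⇒joins : ∀ {x u} → Incident u x → ∃[ w ] Joins x u w
  incident⇒joins (inj₁ refl) = _ , inj₁ refl
  incident⇒joins (inj₂ refl) = _ , inj₂ refl

  neighbours≤Δ : ∀ u → count (adj? H u) (allFin n) ≤ Δ H
  neighbours≤Δ u = begin
    count (adj? H u) (allFin n)         ≤⟨ count-injection (adj? H u) (∈neighbourhood u)
                                             (λ w x → (x ∈? H) ×-dec joins? x u w) (Unique.allFin⁺ n)
                                             (λ (x , x∈H , xuw) → x , ∈-allFin x , x∈H , xuw)
                                             (λ (x∈H , xuw) → x∈p∩q⁺ (x∈H , ∈-setOf (incident? u) (joins⇒incident xuw)))
                                             (λ (_ , xuw) (_ , xuw′) → joins-other xuw xuw′) ⟩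
    count (∈neighbourhood u) (allFin _) ≡⟨ ∣p∣≡count (H ∩ setOf (incident? u)) ⟨
    deg H u                             ≤⟨ All.lookup (Extremaℕ.xs≤max 0 (map (deg H) (allFin n)))
                                             (∈-map⁺ (deg H) (∈-allFin u)) ⟩
    Δ H                                 ∎
    where open ≤-Reasoning

  -- This is Δ/n ≤ 1, which later permits lowering an exponent of Δ/n.
  Δ≤n : Δ H ≤ n
  Δ≤n = Extremaℕ.max≤v⁺ {xs = map (deg H) (allFin n)} z≤n (All.tabulate λ d∈ →
    let u , _ , eq = ∈-map⁻ (deg H) d∈ in subst (_≤ n) (sym eq) (deg≤n u))
    where
    open ≤-Reasoning
    neighbour : ∀ {u x} → x ∈ H ∩ setOf (incident? u) → ∃[ w ] w ∈ˡ allFin n × Joins x u w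
    neighbour {u} x∈ with w , xuw ← incident⇒joins (∈-setOf⁻ (incident? u) (proj₂ (x∈p∩q⁻ H _ x∈))) =
      w , ∈-allFin w , xuw
    deg≤n : ∀ u → deg H u ≤ n
    deg≤n u = begin
      deg H u                              ≡⟨ ∣p∣≡count (H ∩ setOf (incident? u)) ⟩
      count (∈neighbourhood u) (allFin _)  ≤⟨ count-injection (∈neighbourhood u) (_∈? ⊤) (λ x w → joins? x u w)
                                                (Unique.allFin⁺ _)
                                                neighbour
                                                (λ _ → ∈⊤) joins-unique ⟩
      count (_∈? ⊤) (allFin n)             ≡⟨ ∣p∣≡count (⊤ {n}) ⟨
      ∣ ⊤ {n} ∣                            ≡⟨ ∣⊤∣≡n n ⟩
      n                                    ∎

  -- The set `W` is a separate argument because the vertex set of a partly grown graph, at its start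
  -- a lone root, need not be determined by the edges.
  Embeds : Graph → Subset n → Map → Set
  Embeds A W f = A ⊆ pull f H × InjectiveOn W f

  embeds? : ∀ A W f → Dec (Embeds A W f)
  embeds? A W f = (A ⊆? pull f H) ×-dec injectiveOn? W f

  embeddings : Graph → ℕ
  embeddings A = count (embeds? A (V A)) maps

  ⊆pull⇒Adj : ∀ {A f u w} → A ⊆ pull f H → Adj A u w → Adj H (f ! u) (f ! w)
  ⊆pull⇒Adj {A} {f} A⊆ a = Adj-pull⁻ {f} {H} (Adj-mono {A} {pull f H} A⊆ a)

  ⊆pull-respects : ∀ A {W} → V A ⊆ W → Respects W (λ f → A ⊆ pull f H)
  ⊆pull-respects A V⊆W f g f≡g A⊆ {x} x∈A = ∈-pull⁺ {g} {H} (subst₂ (Adj H)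
    (f≡g (V⊆W (∈V⁺ {A} (∈⇒Adj {A} x∈A)))) (f≡g (V⊆W (∈V⁺ {A} (Adj-sym {A} (∈⇒Adj {A} x∈A)))))
    (∈-pull⁻ {f} {H} (A⊆ x∈A)))

  embeds-respects : ∀ A {W} → V A ⊆ W → Respects W (Embeds A W)
  embeds-respects A V⊆W f g f≡g (A⊆ , inj) =
    ⊆pull-respects A V⊆W f g f≡g A⊆ , InjectiveOn-respects f g f≡g inj

  embeds-mono : ∀ {A B f} → A ⊆ B → Embeds B (V B) f → Embeds A (V A) f
  embeds-mono {A} {B} A⊆B (B⊆ , inj) = B⊆ ∘ A⊆B , λ a∈ b∈ → inj (V-mono {A} {B} A⊆B a∈) (V-mono {A} {B} A⊆B b∈)

  -- An embedding of `A` embeds both `D` and `B`, and the two events look at disjoint sets of values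
  -- of the map. Injectivity between the two parts is given up, hence the inequality.
  embeddings-disjoint : ∀ {A D B} → D ⊆ A → B ⊆ A → (∀ {u} → u ∈ V D → u ∉ V B) →
    embeddings A * n ℕ.^ n ≤ embeddings D * embeddings B
  embeddings-disjoint {A} {D} {B} D⊆A B⊆A disj = begin
    embeddings A * n ℕ.^ n
      ≤⟨ ℕ.*-monoˡ-≤ (n ℕ.^ n) (sumOver-mono maps λ f → ℕ.≤-trans
           (𝟙-mono (embeds? A (V A) f) (embeds? D (V D) f ×-dec embeds? B (V B) f)
             (λ emb → embeds-mono {D} {A} {f} D⊆A emb , embeds-mono {B} {A} {f} B⊆A emb))
           (ℕ.≤-reflexive (𝟙-× (embeds? D (V D) f) (embeds? B (V B) f)))) ⟩
    sumOver maps (λ f → 𝟙 (embeds? D (V D) f) * 𝟙 (embeds? B (V B) f)) * n ℕ.^ n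
      ≡⟨ independent (V D) (V B) disj _ _ (depends D) (depends B) ⟩
    embeddings D * embeddings B ∎
    where
    open ≤-Reasoning
    depends : ∀ G → DependsOn (V G) (λ f → 𝟙 (embeds? G (V G) f))
    depends G f g f≡g = 𝟙-cong (embeds? G (V G) f) (embeds? G (V G) g)
      (embeds-respects G id f g f≡g) (embeds-respects G id g f (sym ∘ f≡g))

  -- The second index is the vertex set, which V would lose at a single vertex.
  data Connected : Graph → Subset n → Set where
    root : ∀ u → Connected ⊥ ⁅ u ⁆
    grow : ∀ {D W c x b} → Connected D W → c ∈ W → Joins x c b → Connected (D ∪ ⁅ x ⁆) (W ∪ ⁅ b ⁆)

  connected-V⊆ : ∀ {D W} → Connected D W → V D ⊆ W
  connected-V⊆ (root u) i with _ , (_ , x∈⊥ , _) ← ∈V⁻ {⊥} i = contradiction x∈⊥ ∉⊥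
  connected-V⊆ (grow {D} {W} {c} {x} {b} C c∈W xcb) {u} i with ∈V⁻ {D ∪ ⁅ x ⁆} i
  ... | w , y , y∈ , yuw with x∈p∪q⁻ D ⁅ x ⁆ y∈
  ...   | inj₁ y∈D = p⊆p∪q ⁅ b ⁆ (connected-V⊆ C (∈V⁺ {D} (y , y∈D , yuw)))
  ...   | inj₂ y∈x with refl ← x∈⁅y⁆⇒x≡y x y∈x with joins-ends yuw xcb
  ...     | inj₁ (refl , _) = p⊆p∪q ⁅ b ⁆ c∈W
  ...     | inj₂ (refl , _) = q⊆p∪q W ⁅ b ⁆ (x∈⁅x⁆ b)

  -- A vertex of `W` without an edge exists only at the start; the first added edge contains the
  -- root, since its end `c` must be the root.
  connected-⊆V : ∀ {D W} → Connected D W → W ⊆ V D ⊎ (∃[ u ] W ≡ ⁅ u ⁆)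
  connected-⊆V (root u) = inj₂ (u , refl)
  connected-⊆V (grow {D} {W} {c} {x} {b} C c∈W xcb) = inj₁ λ i → [ old (connected-⊆V C) , new ]′ (x∈p∪q⁻ W ⁅ b ⁆ i)
    where
    D′ = D ∪ ⁅ x ⁆
    x∈D′ : x ∈ D′
    x∈D′ = q⊆p∪q D ⁅ x ⁆ (x∈⁅x⁆ x)
    old : W ⊆ V D ⊎ (∃[ u ] W ≡ ⁅ u ⁆) → ∀ {v} → v ∈ W → v ∈ V D′
    old (inj₁ W⊆) v∈W = V-mono {D} {D′} (p⊆p∪q ⁅ x ⁆) (W⊆ v∈W)
    old (inj₂ (u , refl)) v∈W = subst (_∈ V D′) (trans (x∈⁅y⁆⇒x≡y u c∈W) (sym (x∈⁅y⁆⇒x≡y u v∈W)))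
      (∈V⁺ {D′} (x , x∈D′ , xcb))
    new : ∀ {v} → v ∈ ⁅ b ⁆ → v ∈ V D′
    new v∈b = subst (_∈ V D′) (sym (x∈⁅y⁆⇒x≡y b v∈b)) (∈V⁺ {D′} (x , x∈D′ , joins-sym xcb))

  rooted? : ∀ D W a z f → Dec (Embeds D W f × f ! a ≡ z)
  rooted? D W a z f = embeds? D W f ×-dec (f ! a Fin.≟ z)

  rooted : Graph → Subset n → Fin n → Fin n → ℕ
  rooted D W a z = count (rooted? D W a z) maps

  module _ {D W c x b} (V⊆W : V D ⊆ W) (c∈W : c ∈ W) (xcb : Joins x c b) (b∉W : b ∉ W) where
    open ≤-Reasoning
    private
      D′ W′ : Subset _
      D′ = D ∪ ⁅ x ⁆
      W′ = W ∪ ⁅ b ⁆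

    restrict : ∀ {f y} → Embeds D′ W′ (f [ b ]≔ y) → Embeds D W f × Adj H (f ! c) y
    restrict {f} {y} (D′⊆ , inj) =
      embeds-respects D V⊆W (f [ b ]≔ y) f (∉⇒Agree f b∉W)
        (D′⊆ ∘ p⊆p∪q ⁅ x ⁆ , λ a∈ b∈ → inj (p⊆p∪q ⁅ b ⁆ a∈) (p⊆p∪q ⁅ b ⁆ b∈)) ,
      subst₂ (Adj H) (∉⇒Agree f b∉W c∈W) (update-≡ f b)
        (⊆pull⇒Adj {D′} {f [ b ]≔ y} D′⊆ (x , q⊆p∪q D ⁅ x ⁆ (x∈⁅x⁆ x) , xcb))

    rooted-old : ∀ {a} z → a ∈ W → n * rooted D′ W′ a z ≤ rooted D W a z * Δ H
    rooted-old {a} z a∈W = begin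
      n * rooted D′ W′ a z
        ≡⟨ resample _ b ⟩
      sumOver maps (λ f → sumOver (allFin n) (λ y → 𝟙 (rooted? D′ W′ a z (f [ b ]≔ y))))
        ≤⟨ sumOver-mono maps (λ f → sumOver-mono (allFin n) λ y → ℕ.≤-trans
             (𝟙-mono (rooted? D′ W′ a z (f [ b ]≔ y)) (rooted? D W a z f ×-dec adj? H (f ! c) y)
               (λ (emb , eq) → let emb′ , a′ = restrict {f} {y} emb in
                 (emb′ , trans (sym (∉⇒Agree f b∉W a∈W)) eq) , a′))
             (ℕ.≤-reflexive (𝟙-× (rooted? D W a z f) (adj? H (f ! c) y)))) ⟩
      sumOver maps (λ f → sumOver (allFin n) (λ y → 𝟙 (rooted? D W a z f) * 𝟙 (adj? H (f ! c) y)))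
        ≡⟨ sumOver-cong maps (λ f → sumOver-*ˡ (𝟙 (rooted? D W a z f)) (allFin n) _) ⟩
      sumOver maps (λ f → 𝟙 (rooted? D W a z f) * count (adj? H (f ! c)) (allFin n))
        ≤⟨ sumOver-mono maps (λ f → ℕ.*-monoʳ-≤ (𝟙 (rooted? D W a z f)) (neighbours≤Δ (f ! c))) ⟩
      sumOver maps (λ f → 𝟙 (rooted? D W a z f) * Δ H)
        ≡⟨ sumOver-*ʳ maps _ (Δ H) ⟩
      rooted D W a z * Δ H ∎

    -- With the new vertex `b` fixed at `z`, its neighbour `c` has to go to a neighbour `t` of `z`,
    -- so the embeddings are sorted by `t` and counted with `c` as the root.
    rooted-new : ∀ z → n * rooted D′ W′ b z ≤ sumOver (allFin n) (λ t → 𝟙 (adj? H z t) * rooted D W c t)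
    rooted-new z = begin
      n * rooted D′ W′ b z
        ≡⟨ resample _ b ⟩
      sumOver maps (λ f → sumOver (allFin n) (λ y → 𝟙 (rooted? D′ W′ b z (f [ b ]≔ y))))
        ≤⟨ sumOver-mono maps (λ f → sumOver-mono (allFin n) λ y → ℕ.≤-trans
             (𝟙-mono (rooted? D′ W′ b z (f [ b ]≔ y)) ((y Fin.≟ z) ×-dec (embeds? D W f ×-dec adj? H z (f ! c)))
               (λ (emb , eq) → let emb′ , a′ = restrict {f} {y} emb ; y≡z = trans (sym (update-≡ f b)) eq in
                 y≡z , emb′ , subst (λ z → Adj H z (f ! c)) y≡z (Adj-sym {H} a′)))
             (ℕ.≤-reflexive (𝟙-× (y Fin.≟ z) (embeds? D W f ×-dec adj? H z (f ! c))))) ⟩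
      sumOver maps (λ f → sumOver (allFin n) (λ y → 𝟙 (y Fin.≟ z) * 𝟙 (embeds? D W f ×-dec adj? H z (f ! c))))
        ≡⟨ sumOver-cong maps (λ f → sumOver-*ʳ (allFin n) _ _) ⟩
      sumOver maps (λ f → count (Fin._≟ z) (allFin n) * 𝟙 (embeds? D W f ×-dec adj? H z (f ! c)))
        ≤⟨ sumOver-mono maps (λ f → ℕ.≤-trans
             (ℕ.*-monoˡ-≤ _ (count-≤1 (Fin._≟ z) (Unique.allFin⁺ n) λ p q → trans p (sym q)))
             (ℕ.≤-trans (ℕ.≤-reflexive (ℕ.*-identityˡ _))
               (𝟙≤ (embeds? D W f ×-dec adj? H z (f ! c)) λ (emb , a) →
                 count-∈ (λ t → adj? H z t ×-dec rooted? D W c t f) (∈-allFin (f ! c)) (a , emb , refl)))) ⟩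
      sumOver maps (λ f → sumOver (allFin n) (λ t → 𝟙 (adj? H z t ×-dec rooted? D W c t f)))
        ≡⟨ sumOver-swap maps (allFin n) _ ⟩
      sumOver (allFin n) (λ t → sumOver maps (λ f → 𝟙 (adj? H z t ×-dec rooted? D W c t f)))
        ≡⟨ sumOver-cong (allFin n) (λ t → trans
             (sumOver-cong maps λ f → 𝟙-× (adj? H z t) (rooted? D W c t f))
             (sumOver-*ˡ (𝟙 (adj? H z t)) maps _)) ⟩
      sumOver (allFin n) (λ t → 𝟙 (adj? H z t) * rooted D W c t) ∎

  -- A vertex added next to an embedded one has at most Δ possible images; when the root itself
  -- is the new vertex, the embedding is rerooted at its neighbour.
  rooted-bound : ∀ {D W} → Connected D W → ∀ {a} → a ∈ W → ∀ z →
    rooted D W a z * (n ℕ.^ ∣ W ∣ * Δ H) ≤ n ℕ.^ n * Δ H ℕ.^ ∣ W ∣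
  rooted-bound (root u) {a} a∈u z rewrite x∈⁅y⁆⇒x≡y u a∈u = begin
    rooted ⊥ ⁅ u ⁆ u z * (n ℕ.^ ∣ ⁅ u ⁆ ∣ * Δ H)        ≡⟨ ℕ.*-assoc (rooted ⊥ ⁅ u ⁆ u z) _ (Δ H) ⟨
    rooted ⊥ ⁅ u ⁆ u z * n ℕ.^ ∣ ⁅ u ⁆ ∣ * Δ H          ≤⟨ ℕ.*-monoˡ-≤ (Δ H) (ℕ.*-monoˡ-≤ (n ℕ.^ ∣ ⁅ u ⁆ ∣)
      (count-mono (rooted? ⊥ ⁅ u ⁆ u z) (λ f → agree? ⁅ u ⁆ f constant) (λ {f} → agrees {f}) maps)) ⟩
    count (λ f → agree? ⁅ u ⁆ f constant) maps * n ℕ.^ ∣ ⁅ u ⁆ ∣ * Δ H ≡⟨ cong₂ _*_ (count-agree ⁅ u ⁆ constant) Δ¹ ⟩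
    n ℕ.^ n * Δ H ℕ.^ ∣ ⁅ u ⁆ ∣                         ∎
    where
    open ≤-Reasoning
    constant : Map
    constant = Vec.replicate n z
    agrees : ∀ {f} → Embeds ⊥ ⁅ u ⁆ f × f ! u ≡ z → Agree ⁅ u ⁆ f constant
    agrees {f} (_ , fu≡z) {i} i∈u rewrite x∈⁅y⁆⇒x≡y u i∈u = trans fu≡z (sym (lookup-replicate u z))
    -- The extra `Δ H` on the left of the bound stands for the exponent `∣ W ∣ - 1` on the right
    -- without a subtraction; at a single vertex the two powers of Δ agree.
    Δ¹ : Δ H ≡ Δ H ℕ.^ ∣ ⁅ u ⁆ ∣
    Δ¹ = trans (sym (ℕ.^-identityʳ (Δ H))) (cong (Δ H ℕ.^_) (sym (∣⁅x⁆∣≡1 u)))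
  rooted-bound (grow {D} {W} {c} {x} {b} C c∈W xcb) {a} a∈W′ z with b ∈? W
  -- The edge `x` brings no new vertex, for instance when it closes a cycle; forgetting its
  -- condition can only increase the count.
  ... | yes b∈W rewrite p∪⁅x⁆≡p W b∈W = ℕ.≤-trans
    (ℕ.*-monoˡ-≤ (n ℕ.^ ∣ W ∣ * Δ H) (count-mono (rooted? (D ∪ ⁅ x ⁆) W a z) (rooted? D W a z)
      (λ ((D′⊆ , inj) , eq) → (D′⊆ ∘ p⊆p∪q ⁅ x ⁆ , inj) , eq) maps))
    (rooted-bound C a∈W′ z)
  ... | no b∉W rewrite ∣p∪⁅x⁆∣≡1+∣p∣ W b∉W = bound (x∈p∪q⁻ W ⁅ b ⁆ a∈W′)
    where
    open ≤-Reasoning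
    w = ∣ W ∣
    rearrange₁ : ∀ r a b d → r * (a * b * d) ≡ a * r * (b * d)
    rearrange₁ = solve-∀
    rearrange₂ : ∀ a b c → a * b * c ≡ b * (a * c)
    rearrange₂ = solve-∀
    rearrange₃ : ∀ a b c → a * (b * c) ≡ b * (a * c)
    rearrange₃ = solve-∀
    V⊆W = connected-V⊆ C
    bound : a ∈ W ⊎ a ∈ ⁅ b ⁆ → rooted (D ∪ ⁅ x ⁆) (W ∪ ⁅ b ⁆) a z * (n * n ℕ.^ w * Δ H) ≤ n ℕ.^ n * (Δ H * Δ H ℕ.^ w)
    bound (inj₁ a∈W) = begin
      rooted (D ∪ ⁅ x ⁆) (W ∪ ⁅ b ⁆) a z * (n * n ℕ.^ w * Δ H)    ≡⟨ rearrange₁ _ n _ (Δ H) ⟩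
      n * rooted (D ∪ ⁅ x ⁆) (W ∪ ⁅ b ⁆) a z * (n ℕ.^ w * Δ H)    ≤⟨ ℕ.*-monoˡ-≤ _ (rooted-old V⊆W c∈W xcb b∉W z a∈W) ⟩
      rooted D W a z * Δ H * (n ℕ.^ w * Δ H)                      ≡⟨ rearrange₂ (rooted D W a z) (Δ H) _ ⟩
      Δ H * (rooted D W a z * (n ℕ.^ w * Δ H))                    ≤⟨ ℕ.*-monoʳ-≤ (Δ H) (rooted-bound C a∈W z) ⟩
      Δ H * (n ℕ.^ n * Δ H ℕ.^ w)                                 ≡⟨ rearrange₃ (Δ H) (n ℕ.^ n) _ ⟩
      n ℕ.^ n * (Δ H * Δ H ℕ.^ w)                                 ∎
    bound (inj₂ a∈b) with refl ← x∈⁅y⁆⇒x≡y b a∈b = begin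
      rooted (D ∪ ⁅ x ⁆) (W ∪ ⁅ b ⁆) b z * (n * n ℕ.^ w * Δ H)    ≡⟨ rearrange₁ _ n _ (Δ H) ⟩
      n * rooted (D ∪ ⁅ x ⁆) (W ∪ ⁅ b ⁆) b z * (n ℕ.^ w * Δ H)    ≤⟨ ℕ.*-monoˡ-≤ _ (rooted-new V⊆W c∈W xcb b∉W z) ⟩
      sumOver (allFin n) (λ t → 𝟙 (adj? H z t) * rooted D W c t) * (n ℕ.^ w * Δ H)
        ≡⟨ sumOver-*ʳ (allFin n) _ _ ⟨
      sumOver (allFin n) (λ t → 𝟙 (adj? H z t) * rooted D W c t * (n ℕ.^ w * Δ H))
        ≤⟨ sumOver-mono (allFin n) (λ t → ℕ.≤-trans (ℕ.≤-reflexive (ℕ.*-assoc (𝟙 (adj? H z t)) (rooted D W c t) _))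
             (ℕ.*-monoʳ-≤ (𝟙 (adj? H z t)) (rooted-bound C c∈W t))) ⟩
      sumOver (allFin n) (λ t → 𝟙 (adj? H z t) * (n ℕ.^ n * Δ H ℕ.^ w))
        ≡⟨ sumOver-*ʳ (allFin n) _ _ ⟩
      count (adj? H z) (allFin n) * (n ℕ.^ n * Δ H ℕ.^ w)         ≤⟨ ℕ.*-monoˡ-≤ _ (neighbours≤Δ z) ⟩
      Δ H * (n ℕ.^ n * Δ H ℕ.^ w)                                 ≡⟨ rearrange₃ (Δ H) (n ℕ.^ n) _ ⟩
      n ℕ.^ n * (Δ H * Δ H ℕ.^ w)                                 ∎

  Component : Graph → Graph → Set
  Component A D = D ⊆ A × Connected D (V D) × (∀ {x} → x ∈ A → x ∉ D → ∀ {u} → Incident u x → u ∉ V D)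

  -- Edges of `A` that touch `W` are added until none is left. Each of them enlarges `D`, so the
  -- difference of the edge numbers is enough fuel.
  saturate : ∀ fuel {A D W} → e A ≤ e D + fuel → D ⊆ A → Connected D W →
    ∃[ D′ ] ∃[ W′ ] D ⊆ D′ × D′ ⊆ A × Connected D′ W′ × (∀ {x} → x ∈ A → x ∉ D′ → ∀ {u} → Incident u x → u ∉ W′)
  saturate fuel {A} {D} {W} enough D⊆A C
    with any? (λ x → (x ∈? A) ×-dec (¬? (x ∈? D) ×-dec any? (λ u → incident? u x ×-dec (u ∈? W))))
  ... | no ∄ = D , W , id , D⊆A , C , λ x∈A x∉D {u} inc u∈W → ∄ (_ , x∈A , x∉D , u , inc , u∈W)
  ... | yes (x , x∈A , x∉D , u , inc , u∈W) with fuel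
  ...   | zero = contradiction (subst (e A ≤_) (ℕ.+-identityʳ _) enough)
    (ℕ.<⇒≱ (p⊂q⇒∣p∣<∣q∣ {p = D} {q = A} (D⊆A , x , x∈A , x∉D)))
  ...   | suc fuel with w , xuw ← incident⇒joins inc
    with D′ , W′ , D∪x⊆D′ , rest ← saturate fuel {D = D ∪ ⁅ x ⁆}
      (subst (e A ≤_) (trans (ℕ.+-suc (e D) fuel) (cong (_+ fuel) (sym (∣p∪⁅x⁆∣≡1+∣p∣ D x∉D)))) enough)
      (λ i → [ D⊆A , (λ y∈x → subst (_∈ A) (sym (x∈⁅y⁆⇒x≡y x y∈x)) x∈A) ]′ (x∈p∪q⁻ D ⁅ x ⁆ i))
      (grow C u∈W xuw) = D′ , W′ , D∪x⊆D′ ∘ p⊆p∪q ⁅ x ⁆ , rest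

  component : ∀ {A} → Nonempty A → ∃[ D ] Nonempty D × Component A D
  component {A} (x , x∈A) with D , W , x⊆D , D⊆A , C , sat ←
    -- The growth starts from one edge of `A` attached to its first end, which makes the component
    -- nonempty.
    saturate (e A) {A} {⊥ ∪ ⁅ x ⁆} (ℕ.m≤n+m (e A) _)
      (λ i → [ ⊥-elim ∘ ∉⊥ , (λ y∈x → subst (_∈ A) (sym (x∈⁅y⁆⇒x≡y x y∈x)) x∈A) ]′ (x∈p∪q⁻ ⊥ ⁅ x ⁆ i))
      (grow (root (src x)) (x∈⁅x⁆ (src x)) (self-joins x)) =
    D , (x , x∈D) , D⊆A , subst (Connected D) W≡V C , λ y∈A y∉D inc u∈V → sat y∈A y∉D inc (subst (_ ∈_) (sym W≡V) u∈V)
    where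
    x∈D : x ∈ D
    x∈D = x⊆D (q⊆p∪q ⊥ ⁅ x ⁆ (x∈⁅x⁆ x))
    W⊆V : W ⊆ V D ⊎ (∃[ u ] W ≡ ⁅ u ⁆) → W ⊆ V D
    W⊆V (inj₁ W⊆)         = W⊆
    W⊆V (inj₂ (u , refl)) = contradiction
      (trans (x∈⁅y⁆⇒x≡y u (connected-V⊆ C (∈V⁺ {D} (∈⇒Adj {D} x∈D))))
        (sym (x∈⁅y⁆⇒x≡y u (connected-V⊆ C (∈V⁺ {D} (Adj-sym {D} (∈⇒Adj {D} x∈D)))))))
      (joins-≢ (self-joins x))
    W≡V : W ≡ V D
    W≡V = ⊆-antisym (W⊆V (connected-⊆V C)) (connected-V⊆ C)

-- Unions of disjoint copies

-- An element is taken if it is related to none taken so far. Reflexivity makes the chosen elements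
-- themselves fulfil the maximality condition.
greedy : {A : Set} {P : A → Set} {R : A → A → Set} (P? : Decidable P) (R? : ∀ x y → Dec (R x y)) →
  (∀ x → P x → R x x) → ∀ xs → ∃[ ys ]
  AllPairs (λ (x : ∃ P) (y : ∃ P) → ¬ R (proj₁ x) (proj₁ y)) ys ×
  (∀ {x} → x ∈ˡ xs → P x → Any (λ y → R x (proj₁ y)) ys)
greedy P? R? R-refl []       = [] , [] , λ ()
greedy {P = P} {R} P? R? R-refl (x ∷ xs) with greedy {P = P} {R} P? R? R-refl xs | P? x
... | ys , apart , maximal | no ¬px = ys , apart , λ
  { (here refl) px → contradiction px ¬px ; (there x∈xs) → maximal x∈xs }
... | ys , apart , maximal | yes px with Any.any? (λ y → R? x (proj₁ y)) ys
...   | yes hit = ys , apart , λ { (here refl) _ → hit ; (there x∈xs) → maximal x∈xs }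
...   | no miss = (x , px) ∷ ys , All.¬Any⇒All¬ ys miss ∷ apart , λ
  { (here refl) px → here (R-refl x px) ; (there x∈xs) → there ∘ maximal x∈xs }

combinations : {A : Set} → ℕ → List A → List (List A)
combinations zero    xs       = [] ∷ []
combinations (suc m) []       = []
combinations (suc m) (x ∷ xs) = map (x ∷_) (combinations m xs) ++ combinations (suc m) xs

filter∈combinations : {A : Set} {P : A → Set} (P? : Decidable P) → ∀ xs →
                      filter P? xs ∈ˡ combinations (length (filter P? xs)) xs
filter∈combinations P? []       = here refl
filter∈combinations P? (x ∷ xs) with does (P? x)
... | true  = ∈-++⁺ˡ (∈-map⁺ (x ∷_) (filter∈combinations P? xs))
... | false = skip (length (filter P? xs)) (filter∈combinations P? xs)
  where
  skip : ∀ m {ys} → ys ∈ˡ combinations m xs → ys ∈ˡ combinations m (x ∷ xs)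
  skip zero    ys∈ = ys∈
  skip (suc m) ys∈ = ∈-++⁺ʳ _ ys∈

-- The left side consists of the two leading terms of the binomial expansion of the right side.
1+t^m≥ : ∀ t m → suc m * t ℕ.^ m + t ℕ.^ suc m ≤ suc t ℕ.^ suc m
1+t^m≥ t zero    = ℕ.≤-reflexive (lemma t)
  where
  lemma : ∀ t → 1 * 1 + t * 1 ≡ suc t * 1
  lemma = solve-∀
1+t^m≥ t (suc m) = begin
  suc (suc m) * t ℕ.^ suc m + t ℕ.^ suc (suc m)               ≤⟨ ℕ.m≤m+n _ (suc m * t ℕ.^ m) ⟩
  suc (suc m) * (t * t ℕ.^ m) + t * (t * t ℕ.^ m) + suc m * t ℕ.^ m  ≡⟨ lemma m t (t ℕ.^ m) ⟩
  suc t * (suc m * t ℕ.^ m + t ℕ.^ suc m)                     ≤⟨ ℕ.*-monoʳ-≤ (suc t) (1+t^m≥ t m) ⟩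
  suc t ℕ.^ suc (suc m)                                       ∎
  where
  open ≤-Reasoning
  lemma : ∀ m t p → suc (suc m) * (t * p) + t * (t * p) + suc m * p ≡ suc t * (suc m * p + t * p)
  lemma = solve-∀

-- Pascal's rule, with the binomial coefficients multiplied by `m !`; adding one list element is
-- then the binomial estimate `1+t^m≥`.
combinations-≤ : {A : Set} (m : ℕ) (xs : List A) → length (combinations m xs) * m ! ≤ length xs ℕ.^ m
combinations-≤ zero    xs       = ℕ.≤-refl
combinations-≤ (suc m) []       = z≤n
combinations-≤ (suc m) (x ∷ xs) = begin
  length (map (x ∷_) (combinations m xs) ++ combinations (suc m) xs) * suc m !
    ≡⟨ cong (_* suc m !) (trans (length-++ (map (x ∷_) (combinations m xs)))
         (cong (_+ length (combinations (suc m) xs)) (length-map (x ∷_) (combinations m xs)))) ⟩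
  (length (combinations m xs) + length (combinations (suc m) xs)) * (suc m * m !)
    ≡⟨ lemma (length (combinations m xs)) (length (combinations (suc m) xs)) (suc m) (m !) ⟩
  suc m * (length (combinations m xs) * m !) + length (combinations (suc m) xs) * suc m !
    ≤⟨ ℕ.+-mono-≤ (ℕ.*-monoʳ-≤ (suc m) (combinations-≤ m xs)) (combinations-≤ (suc m) xs) ⟩
  suc m * length xs ℕ.^ m + length xs ℕ.^ suc m
    ≤⟨ 1+t^m≥ (length xs) m ⟩
  suc (length xs) ℕ.^ suc m ∎
  where
  open ≤-Reasoning
  lemma : ∀ a b c d → (a + b) * (c * d) ≡ c * (a * d) + b * (c * d)
  lemma = solve-∀

unique-⊆-length : {A : Set} → (∀ (x y : A) → Dec (x ≡ y)) → ∀ {xs ys : List A} → Unique xs →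
                  (∀ {x} → x ∈ˡ xs → x ∈ˡ ys) → length xs ≤ length ys
unique-⊆-length _≟_ {xs} {ys} u xs⊆ys = subst₂ _≤_ (count-all xs) (count-all ys) (begin
  count (λ _ → yes tt) xs       ≤⟨ sumOver-mono-∈ xs (λ x x∈ → ℕ.≤-reflexive (sym (𝟙-yes (x ∈ˡ? xs) x∈))) ⟩
  count (_∈ˡ? xs) xs            ≤⟨ count-injection (_∈ˡ? xs) (λ _ → yes tt) _≟_ u
                                     (λ {x} x∈ → x , xs⊆ys x∈ , refl) (λ _ → tt) (λ p q → trans p (sym q)) ⟩
  count (λ _ → yes tt) ys       ∎)
  where
  open ≤-Reasoning
  open DecMembership _≟_ using () renaming (_∈?_ to _∈ˡ?_)
  count-all : ∀ xs → count {P = λ _ → Unit} (λ _ → yes tt) xs ≡ length xs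
  count-all xs = trans (sumOver-const xs 1) (ℕ.*-identityʳ _)

∈-⋃⁺ : ∀ {Gs : List (Subset k)} {G x} → G ∈ˡ Gs → x ∈ G → x ∈ ⋃ Gs
∈-⋃⁺ {Gs = G ∷ Gs} (here refl) x∈G = p⊆p∪q (⋃ Gs) x∈G
∈-⋃⁺ {Gs = G ∷ Gs} (there G∈)  x∈G = q⊆p∪q G (⋃ Gs) (∈-⋃⁺ G∈ x∈G)

∈-⋃⁻ : ∀ (Gs : List (Subset k)) {x} → x ∈ ⋃ Gs → ∃[ G ] G ∈ˡ Gs × x ∈ G
∈-⋃⁻ []       x∈ = contradiction x∈ ∉⊥
∈-⋃⁻ (G ∷ Gs) x∈ with x∈p∪q⁻ G (⋃ Gs) x∈
... | inj₁ x∈G  = G , here refl , x∈G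
... | inj₂ x∈Gs with G′ , G′∈ , x∈G′ ← ∈-⋃⁻ Gs x∈Gs = G′ , there G′∈ , x∈G′

Disjoint : Subset k → Subset k → Set
Disjoint p q = ∀ {x} → x ∈ p → x ∉ q

∣⋃∣ : ∀ {Gs : List (Subset k)} {c} → AllPairs Disjoint Gs → (∀ {G} → G ∈ˡ Gs → ∣ G ∣ ≡ c) → ∣ ⋃ Gs ∣ ≡ length Gs * c
∣⋃∣ {k} {[]}     _           _    = ∣⊥∣≡0 k
∣⋃∣ {Gs = G ∷ Gs} (d ∷ apart) size = trans
  (∣p∪q∣≡∣p∣+∣q∣ G (⋃ Gs) λ x∈G x∈Gs → let _ , G′∈ , x∈G′ = ∈-⋃⁻ Gs x∈Gs in All.lookup d G′∈ x∈G x∈G′)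
  (cong₂ _+_ (size (here refl)) (∣⋃∣ apart (size ∘ there)))

⋃-cong-⊆ : ∀ {Gs Gs′ : List (Subset k)} → (∀ {G} → G ∈ˡ Gs → G ∈ˡ Gs′) → ⋃ Gs ⊆ ⋃ Gs′
⋃-cong-⊆ {Gs = Gs} Gs⊆ x∈ with _ , G∈ , x∈G ← ∈-⋃⁻ Gs x∈ = ∈-⋃⁺ (Gs⊆ G∈) x∈G

disjoint⇒unique : ∀ {Gs : List (Subset k)} → AllPairs Disjoint Gs → (∀ {G} → G ∈ˡ Gs → Nonempty G) → Unique Gs
disjoint⇒unique []          _  = []
disjoint⇒unique (d ∷ apart) ne = All.tabulate (λ { {G′} G′∈ refl → let x , x∈ = ne (here refl) in All.lookup d G′∈ x∈ x∈ })
  ∷ disjoint⇒unique apart (ne ∘ there)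

module Copies (n : ℕ) where
  open Subgraphs n
  open Relabelling n
  open DecMembership (_≟ˢ_ {length edges}) using () renaming (_∈?_ to _∈ˡ?_)

  copies : Graph → List Graph
  copies G = filter (isCopy? G K) graphs

  copies-unique : ∀ G → Unique (copies G)
  copies-unique G = Unique.filter⁺ (isCopy? G K) (allSubsets-unique _)

  ∈-copies : ∀ {S G} → S ≅ G → S ∈ˡ copies G
  ∈-copies {S} {G} φ = ∈-filter⁺ (isCopy? G K) (∈-allSubsets S) (⊆⊤ , φ)

  ∈-copies⁻ : ∀ {S G} → S ∈ˡ copies G → ∃[ f ] InjectiveOn ⊤ f × pull f G ≡ S
  ∈-copies⁻ {S} {G} S∈ = ≅⇒pull {S} {G} (proj₂ (proj₂ (∈-filter⁻ (isCopy? G K) {xs = graphs} S∈)))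

  pull-∈-copies : ∀ f → InjectiveOn ⊤ f → ∀ {G D} → G ≅ D → pull f G ∈ˡ copies D
  pull-∈-copies f f-inj {G} {D} φ = from-pull (≅⇒pull {G} {D} φ)
    where
    from-pull : ∃[ g ] InjectiveOn ⊤ g × pull g D ≡ G → pull f G ∈ˡ copies D
    from-pull (g , g-inj , eq) = subst (_∈ˡ copies D) (trans (sym (pull-∘ g f D)) (cong (pull f) eq))
      (∈-copies {pull (g ∘ᵛ f) D} {D} (pull-≅ (g ∘ᵛ f) (∘ᵛ-injective g f g-inj f-inj) D))

  pull-injective : ∀ f → InjectiveOn ⊤ f → ∀ {G G′} → pull f G ≡ pull f G′ → G ≡ G′
  pull-injective f f-inj {G} {G′} eq = trans (sym (pull-inverse f f-inj G))
    (trans (cong (pull (inverse f f-inj)) eq) (pull-inverse f f-inj G′))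

  module _ (f : Map) (Gs : List Graph) where

    pull-⋃-⊆ : pull f (⋃ Gs) ⊆ ⋃ (map (pull f) Gs)
    pull-⋃-⊆ x∈ = lemma (∈-pull⁻ {f} {⋃ Gs} x∈)
      where
      lemma : ∀ {x} → Adj (⋃ Gs) (f ! src x) (f ! tgt x) → x ∈ ⋃ (map (pull f) Gs)
      lemma (y , y∈ , joins) = let G , G∈ , y∈G = ∈-⋃⁻ Gs y∈ in
        ∈-⋃⁺ (∈-map⁺ (pull f) G∈) (∈-pull⁺ {f} {G} (y , y∈G , joins))

    pull-⋃-⊇ : ⋃ (map (pull f) Gs) ⊆ pull f (⋃ Gs)
    pull-⋃-⊇ {x} x∈ = let _ , fG∈ , x∈fG = ∈-⋃⁻ (map (pull f) Gs) x∈ in lemma x∈fG (∈-map⁻ (pull f) fG∈)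
      where
      lemma : ∀ {fG} → x ∈ fG → ∃[ G ] G ∈ˡ Gs × fG ≡ pull f G → x ∈ pull f (⋃ Gs)
      lemma x∈fG (G , G∈ , eq) = let y , y∈G , joins = ∈-pull⁻ {f} {G} (subst (x ∈_) eq x∈fG) in
        ∈-pull⁺ {f} {⋃ Gs} (y , ∈-⋃⁺ G∈ y∈G , joins)

    pull-⋃ : pull f (⋃ Gs) ≡ ⋃ (map (pull f) Gs)
    pull-⋃ = ⊆-antisym pull-⋃-⊆ pull-⋃-⊇

  -- A copy of the union of m disjoint copies of D is the union of some m distinct copies of D.
  module _ {D : Graph} {Gs : List Graph} (apart : AllPairs Disjoint Gs)
           (nonempty : ∀ {G} → G ∈ˡ Gs → Nonempty G) (iso : ∀ {G} → G ∈ˡ Gs → G ≅ D) where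

    private
      m : ℕ
      m = length Gs

      unions : List (List Graph)
      unions = combinations m (copies D)

    module _ (f : Map) (f-inj : InjectiveOn ⊤ f) where
      private
        fGs ts : List Graph
        fGs = map (pull f) Gs
        -- The graphs `fGs` in the order of `copies D`, since `combinations` produces only sublists
        -- that keep the order.
        ts = filter (_∈ˡ? fGs) (copies D)

        fGs-unique : Unique fGs
        fGs-unique = Unique.map⁺ (pull-injective f f-inj) (disjoint⇒unique apart nonempty)

        fGs⊆copies : ∀ {fG} → fG ∈ˡ fGs → ∃[ G ] G ∈ˡ Gs × fG ≡ pull f G → fG ∈ˡ copies D
        fGs⊆copies _ (G , G∈ , eq) = subst (_∈ˡ copies D) (sym eq) (pull-∈-copies f f-inj {G} {D} (iso G∈))

        ts⊆fGs : ∀ {G} → G ∈ˡ ts → G ∈ˡ fGs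
        ts⊆fGs G∈ = proj₂ (∈-filter⁻ (_∈ˡ? fGs) {xs = copies D} G∈)

        fGs⊆ts : ∀ {G} → G ∈ˡ fGs → G ∈ˡ ts
        fGs⊆ts G∈ = ∈-filter⁺ (_∈ˡ? fGs) (fGs⊆copies G∈ (∈-map⁻ (pull f) G∈)) G∈

        length-ts : length ts ≡ m
        length-ts = trans (ℕ.≤-antisym
          (unique-⊆-length _≟ˢ_ (Unique.filter⁺ (_∈ˡ? fGs) (copies-unique D)) ts⊆fGs)
          (unique-⊆-length _≟ˢ_ fGs-unique fGs⊆ts)) (length-map (pull f) Gs)

      pull-⋃-∈ : pull f (⋃ Gs) ∈ˡ map ⋃ unions
      pull-⋃-∈ = subst (_∈ˡ map ⋃ unions)
        (trans (⊆-antisym (⋃-cong-⊆ ts⊆fGs) (⋃-cong-⊆ fGs⊆ts)) (sym (pull-⋃ f Gs)))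
        (∈-map⁺ ⋃ (subst (λ l → ts ∈ˡ combinations l (copies D)) length-ts
          (filter∈combinations (_∈ˡ? fGs) (copies D))))

    copies-⋃ : ∀ {S} → ∃[ f ] InjectiveOn ⊤ f × pull f (⋃ Gs) ≡ S → S ∈ˡ map ⋃ unions
    copies-⋃ (f , f-inj , eq) = subst (_∈ˡ map ⋃ unions) eq (pull-⋃-∈ f f-inj)

    N-⋃ : N (⋃ Gs) K * m ! ≤ N D K ℕ.^ m
    N-⋃ = begin
      N (⋃ Gs) K * m !          ≤⟨ ℕ.*-monoˡ-≤ (m !) (unique-⊆-length _≟ˢ_ (copies-unique (⋃ Gs))
                                     (λ {S} S∈ → copies-⋃ (∈-copies⁻ {S} {⋃ Gs} S∈))) ⟩
      length (map ⋃ unions) * m !  ≡⟨ cong (_* m !) (length-map ⋃ unions) ⟩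
      length unions * m !          ≤⟨ combinations-≤ m (copies D) ⟩
      N D K ℕ.^ m               ∎
      where open ≤-Reasoning

-- Numbers of copies and packings

∣p∣*≡sum : ∀ (p : Subset k) c → sumOver (allFin k) (λ i → 𝟙 (i ∈? p) * c) ≡ ∣ p ∣ * c
∣p∣*≡sum p c = trans (sumOver-*ʳ (allFin _) (λ i → 𝟙 (i ∈? p)) c) (cong (_* c) (sym (∣p∣≡count p)))

length-allMaps : ∀ n k → length (allMaps n k) ≡ n ℕ.^ k
length-allMaps n k = begin
  length (allMaps n k)           ≡⟨ ℕ.*-identityʳ _ ⟨
  length (allMaps n k) * 1       ≡⟨ sumOver-const (allMaps n k) 1 ⟨
  sumOver (allMaps n k) (λ _ → 1)  ≡⟨ count-all k ⟩
  n ℕ.^ k                        ∎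
  where
  open ≡-Reasoning
  count-all : ∀ k → sumOver (allMaps n k) (λ _ → 1) ≡ n ℕ.^ k
  count-all zero    = refl
  count-all (suc k) = trans (sumMaps-suc n k (λ _ → 1)) (trans (sumOver-const (allFin n) _)
    (cong₂ _*_ (length-allFin n) (count-all k)))

-- The quotient of the factorials is a product of `v` factors, each at most `v + j`.
[v+j]!≤ : ∀ v j → (v + j) ! ≤ (v + j) ℕ.^ v * j !
[v+j]!≤ zero    j = ℕ.≤-reflexive (sym (ℕ.+-identityʳ (j !)))
[v+j]!≤ (suc v) j = begin
  suc (v + j) * (v + j) !                       ≤⟨ ℕ.*-monoʳ-≤ (suc (v + j)) ([v+j]!≤ v j) ⟩
  suc (v + j) * ((v + j) ℕ.^ v * j !)           ≤⟨ ℕ.*-monoʳ-≤ (suc (v + j))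
                                                     (ℕ.*-monoˡ-≤ (j !) (ℕ.^-monoˡ-≤ v (ℕ.n≤1+n (v + j)))) ⟩
  suc (v + j) * (suc (v + j) ℕ.^ v * j !)       ≡⟨ ℕ.*-assoc (suc (v + j)) (suc (v + j) ℕ.^ v) (j !) ⟨
  suc (v + j) ℕ.^ suc v * j !                   ∎
  where open ≤-Reasoning

module CopyCounts (n : ℕ) .{{_ : ℕ.NonZero n}} where
  open Subgraphs n
  open Relabelling n
  open Labellings n

  count-bijections : count (injectiveOn? ⊤) maps ≡ n !
  count-bijections = ℕ.*-cancelˡ-≡ _ _ (n ℕ.^ n) {{ℕ.m^n≢0 n n}} (begin
    n ℕ.^ n * count (injectiveOn? ⊤) maps   ≡⟨ cong (n ℕ.^ n *_) (count-cong (injectiveOn? ⊤) (inj? ⊤) (tt ,_) proj₂ maps) ⟩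
    n ℕ.^ n * count (inj? ⊤) maps           ≡⟨ count-injective {U = ⊥} (λ _ → yes tt) (λ _ _ _ _ → tt) n {⊥} id
                                                 (cong (_+ n) (∣⊥∣≡0 n)) ⟩
    n ! * count (inj? ⊥) maps               ≡⟨ cong (n ! *_) (trans (sumOver-cong maps λ f →
                                                 𝟙-yes (inj? ⊥ f) (tt , λ a∈⊥ → contradiction a∈⊥ ∉⊥))
                                                 (trans (sumOver-const maps 1)
                                                   (trans (ℕ.*-identityʳ _) (length-allMaps n n)))) ⟩
    n ! * n ℕ.^ n                           ≡⟨ ℕ.*-comm (n !) _ ⟩
    n ℕ.^ n * n !                           ∎)
    where
    open ≡-Reasoning
    inj? : ∀ W f → Dec (Unit × InjectiveOn W f)
    inj? = injective-on? {U = ⊥} (λ _ → yes tt) (λ _ _ _ _ → tt)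

  -- Orbit-stabiliser for the symmetric group acting on graphs: the copies of `G` form its orbit.
  N*labellings : ∀ G → N G K * labellings G G ≡ n !
  N*labellings G = begin
    N G K * labellings G G
      ≡⟨ cong (_* labellings G G) (trans (length-filter≡count (isCopy? G K) graphs)
           (count-cong (isCopy? G K) (copyWith? G (_⊆? K)) (λ (s , φ) → φ , s) (λ (φ , s) → s , φ) graphs)) ⟩
    count (copyWith? G (_⊆? K)) graphs * labellings G G
      ≡⟨ count-labellings G (_⊆? K) ⟨
    count (λ f → injectiveOn? ⊤ f ×-dec (pull f G ⊆? K)) maps
      ≡⟨ count-cong (λ f → injectiveOn? ⊤ f ×-dec (pull f G ⊆? K)) (injectiveOn? ⊤) proj₁ (λ inj → inj , ⊆⊤) maps ⟩
    count (injectiveOn? ⊤) maps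
      ≡⟨ count-bijections ⟩
    n ! ∎
    where open ≡-Reasoning

  module _ (G : Graph) {j : ℕ} (v+j≡n : v G + j ≡ n) where
    private
      identity : Map
      identity = Vec.allFin n

      fixes? : ∀ f → Dec (Agree (V G) f identity)
      fixes? f = agree? (V G) f identity

      fixes-respects : Respects (V G) (λ f → Agree (V G) f identity)
      fixes-respects f g f≡g f≡id i∈ = trans (sym (f≡g i∈)) (f≡id i∈)

      fixes-! : ∀ {f} → Agree (V G) f identity → ∀ {u} → u ∈ V G → f ! u ≡ u
      fixes-! f≡id {u} u∈ = trans (f≡id u∈) (lookup∘tabulate id u)

    fixes⇒pull : ∀ f → InjectiveOn ⊤ f → Agree (V G) f identity → pull f G ≡ G
    fixes⇒pull f f-inj f≡id = ⊆-antisym (Adj⇒⊆ {pull f G} {G} (λ u w a → forth u w (Adj-pull⁻ {f} {G} a)))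
      (Adj⇒⊆ {G} {pull f G} λ u w a → Adj-pull⁺ {f} {G} (subst₂ (Adj G)
        (sym (fixes-! {f} f≡id (∈V⁺ {G} a))) (sym (fixes-! {f} f≡id (∈V⁺ {G} (Adj-sym {G} a)))) a))
      where
      fixed : ∀ {u} → f ! u ∈ V G → f ! u ≡ u
      fixed fu∈ = f-inj ∈⊤ ∈⊤ (fixes-! {f} f≡id fu∈)
      forth : ∀ u w → Adj G (f ! u) (f ! w) → Adj G u w
      forth u w a = subst₂ (Adj G) (fixed (∈V⁺ {G} a)) (fixed (∈V⁺ {G} (Adj-sym {G} a))) a

    private
      fix-inj? : ∀ W f → Dec (Agree (V G) f identity × InjectiveOn W f)
      fix-inj? = injective-on? fixes? fixes-respects

      count-fixes : count fixes? maps ≡ n ℕ.^ j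
      count-fixes = ℕ.*-cancelʳ-≡ _ _ (n ℕ.^ v G) {{ℕ.m^n≢0 n (v G)}} (trans (count-agree (V G) identity)
        (trans (cong (n ℕ.^_) (trans (sym v+j≡n) (ℕ.+-comm (v G) j))) (ℕ.^-distribˡ-+-* n j (v G))))

      count-fix-inj : count (fix-inj? ⊤) maps ≡ j !
      count-fix-inj = ℕ.*-cancelˡ-≡ _ _ (n ℕ.^ j) {{ℕ.m^n≢0 n j}} (begin
        n ℕ.^ j * count (fix-inj? ⊤) maps     ≡⟨ count-injective fixes? fixes-respects j id v+j≡n ⟩
        j ! * count (fix-inj? (V G)) maps     ≡⟨ cong (j ! *_) (count-cong (fix-inj? (V G)) fixes? proj₁
                                                   (λ {f} f≡id → f≡id , inj f f≡id) maps) ⟩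
        j ! * count fixes? maps               ≡⟨ cong (j ! *_) count-fixes ⟩
        j ! * n ℕ.^ j                         ≡⟨ ℕ.*-comm (j !) _ ⟩
        n ℕ.^ j * j !                         ∎)
        where
        open ≡-Reasoning
        inj : ∀ f → Agree (V G) f identity → InjectiveOn (V G) f
        inj f f≡id a∈ b∈ eq = trans (sym (fixes-! {f} f≡id a∈)) (trans eq (fixes-! {f} f≡id b∈))

    -- The permutations that fix every vertex of `G` lie in its stabiliser, and there are `j !` of
    -- them.
    j!≤labellings : j ! ≤ labellings G G
    j!≤labellings = subst (_≤ labellings G G) count-fix-inj (count-mono (fix-inj? ⊤) (labels? G G)
      (λ {f} (f≡id , f-inj) → f-inj , fixes⇒pull f f-inj f≡id) maps)

    N≤n^v : N G K ≤ n ℕ.^ v G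
    N≤n^v = ℕ.*-cancelʳ-≤ _ _ (j !) {{ℕ.>-nonZero (ℕ.1≤n! j)}} (begin
      N G K * j !             ≤⟨ ℕ.*-monoʳ-≤ (N G K) j!≤labellings ⟩
      N G K * labellings G G  ≡⟨ N*labellings G ⟩
      n !                     ≡⟨ cong _! v+j≡n ⟨
      (v G + j) !             ≤⟨ [v+j]!≤ (v G) j ⟩
      (v G + j) ℕ.^ v G * j ! ≡⟨ cong (λ l → l ℕ.^ v G * j !) v+j≡n ⟩
      n ℕ.^ v G * j !         ∎)
      where open ≤-Reasoning

  module _ (H : Graph) where
    open Embeddings n H

    -- `A` lies in `pull f H` exactly when `f` maps `A` into `H`. The left side counts such
    -- permutations, and `count-injective` replaces them by maps that are injective on `V A` only.
    count-copies-⊇ : ∀ A {j} → v A + j ≡ n →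
      n ℕ.^ j * (count (copyWith? H (A ⊆?_)) graphs * labellings H H) ≡ j ! * embeddings A
    count-copies-⊇ A {j} v+j≡n = begin
      n ℕ.^ j * (count (copyWith? H (A ⊆?_)) graphs * labellings H H)
        ≡⟨ cong (n ℕ.^ j *_) (count-labellings H (A ⊆?_)) ⟨
      n ℕ.^ j * count (λ f → injectiveOn? ⊤ f ×-dec (A ⊆? pull f H)) maps
        ≡⟨ cong (n ℕ.^ j *_) (count-cong (λ f → injectiveOn? ⊤ f ×-dec (A ⊆? pull f H)) (X? ⊤)
             (λ (i , s) → s , i) (λ (s , i) → i , s) maps) ⟩
      n ℕ.^ j * count (X? ⊤) maps
        ≡⟨ count-injective contained? (⊆pull-respects A id) j id v+j≡n ⟩
      j ! * embeddings A ∎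
      where
      open ≡-Reasoning
      contained? : ∀ f → Dec (A ⊆ pull f H)
      contained? f = A ⊆? pull f H
      X? : ∀ W f → Dec (A ⊆ pull f H × InjectiveOn W f)
      X? = injective-on? contained? (⊆pull-respects A id)

    module Packing {D : Graph} (D≢∅ : Nonempty D) (C : Connected D (V D)) where

      -- An embedding of `D` in `H` is taken as a permutation, so that its image is the relabelling
      -- of `D` by the inverse permutation.
      Placed : Map → Set
      Placed f = D ⊆ pull f H × InjectiveOn ⊤ f

      placed? : Decidable Placed
      placed? f = (D ⊆? pull f H) ×-dec injectiveOn? ⊤ f

      Meet : Map → Map → Set
      Meet f g = ∃[ a ] a ∈ V D × (∃[ b ] b ∈ V D × f ! a ≡ g ! b)

      meet? : ∀ f g → Dec (Meet f g)
      meet? f g = any? λ a → (a ∈? V D) ×-dec any? λ b → (b ∈? V D) ×-dec (f ! a Fin.≟ g ! b)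

      vertex : ∃[ u ] u ∈ V D
      vertex = let x , x∈D = D≢∅ in src x , ∈V⁺ {D} (∈⇒Adj {D} x∈D)

      meet-refl : ∀ f → Meet f f
      meet-refl f = let u , u∈ = vertex in u , u∈ , u , u∈ , refl

      private
        packed : ∃[ ys ] AllPairs (λ (x : ∃ Placed) (y : ∃ Placed) → ¬ Meet (proj₁ x) (proj₁ y)) ys ×
                         (∀ {f} → f ∈ˡ maps → Placed f → Any (λ y → Meet f (proj₁ y)) ys)
        packed = greedy placed? meet? (λ f _ → meet-refl f) maps

      placements : List (∃ Placed)
      placements = proj₁ packed

      placements-apart : AllPairs (λ (x : ∃ Placed) (y : ∃ Placed) → ¬ Meet (proj₁ x) (proj₁ y)) placements
      placements-apart = proj₁ (proj₂ packed)

      image : ∃ Placed → Graph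
      image (f , _ , f-inj) = pull (inverse f f-inj) D

      image⊆H : ∀ p → image p ⊆ H
      image⊆H (f , D⊆ , f-inj) = Adj⇒⊆ {image (f , D⊆ , f-inj)} {H} λ u w a → subst₂ (Adj H)
        (f[inverse] f f-inj u) (f[inverse] f f-inj w)
        (⊆pull⇒Adj {D} {f} D⊆ (Adj-pull⁻ {inverse f f-inj} {D} a))

      e-image : ∀ p → e (image p) ≡ e D
      e-image (f , _ , f-inj) = e-pull (inverse f f-inj) (inverse-injective f f-inj) D

      image-≅ : ∀ p → image p ≅ D
      image-≅ (f , _ , f-inj) = pull-≅ (inverse f f-inj) (inverse-injective f f-inj) D

      image-nonempty : ∀ p → Nonempty (image p)
      image-nonempty p with nonempty? (image p)
      ... | yes ne = ne
      ... | no empty = contradiction 0≡e[D] (ℕ.<⇒≢ (ℕ.>-nonZero⁻¹ (e D) {{e≢0 {D} D≢∅}}))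
        where
        0≡e[D] : 0 ≡ e D
        0≡e[D] = trans (sym (∣⊥∣≡0 (length edges))) (trans (cong e (sym (Empty-unique empty))) (e-image p))

      image-vertex : ∀ p {u w} → Adj (image p) u w → inverse (proj₁ p) (proj₂ (proj₂ p)) ! u ∈ V D
      image-vertex (f , _ , f-inj) a = ∈V⁺ {D} (Adj-pull⁻ {inverse f f-inj} {D} a)

      image-disjoint : ∀ p p′ → ¬ Meet (proj₁ p) (proj₁ p′) → Disjoint (image p) (image p′)
      image-disjoint p@(f , _ , f-inj) p′@(g , _ , g-inj) apart x∈p x∈p′ = apart
        (_ , image-vertex p (∈⇒Adj {image p} x∈p) , _ , image-vertex p′ (∈⇒Adj {image p′} x∈p′) ,
         trans (f[inverse] f f-inj _) (sym (f[inverse] g g-inj _)))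

      images : List Graph
      images = map image placements

      images-apart : AllPairs Disjoint images
      images-apart = AllPairs.map⁺ (AllPairs.map (λ {p} {p′} → image-disjoint p p′) placements-apart)

      images-all : {Q : Graph → Set} → (∀ p → Q (image p)) → ∀ {G} → G ∈ˡ images → Q G
      images-all {Q} q G∈ = let p , _ , eq = ∈-map⁻ image G∈ in subst Q (sym eq) (q p)

      -- Maximality speaks of permutations only. An arbitrary embedding is therefore exchanged for a
      -- permutation with the same values on `V D`, which meets the same placements.
      embeds-meets : ∀ f → Embeds D (V D) f → Any (λ p → Meet f (proj₁ p)) placements
      embeds-meets f (D⊆ , inj) = via (extend-injective {U = V D} f inj)
        where
        via : ∃[ g ] InjectiveOn ⊤ g × Agree (V D) f g → Any (λ p → Meet f (proj₁ p)) placements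
        via (g , g-inj , f≡g) = Any.map (λ (a , a∈ , b , b∈ , eq) → a , a∈ , b , b∈ , trans (f≡g a∈) eq)
          (proj₂ (proj₂ packed) (∈-allMaps g) (⊆pull-respects D id f g f≡g D⊆ , g-inj))

      -- A union bound over triples of a placement `p` and vertices `a`, `b` of `D` with `f ! a`
      -- equal to the place of `b` under `p`. Each triple prescribes the image of `a`, so
      -- `rooted-bound` applies.
      embeddings-≤ : embeddings D * (n ℕ.^ v D * Δ H) ≤ length images * (v D * (v D * (n ℕ.^ n * Δ H ℕ.^ v D)))
      embeddings-≤ = begin
        embeddings D * (n ℕ.^ v D * Δ H)
          ≤⟨ ℕ.*-monoˡ-≤ (n ℕ.^ v D * Δ H) (sumOver-mono maps λ f → 𝟙≤ (embeds? D (V D) f) (meets f)) ⟩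
        sumOver maps (λ f → sumOver placements (λ p → sumOver (allFin n) (λ a → sumOver (allFin n) (λ b → 𝟙 (hit? f p a b))))) * c₀
          ≡⟨ cong (_* c₀) (trans (sumOver-swap maps placements _) (sumOver-cong placements λ p →
               trans (sumOver-swap maps (allFin n) _) (sumOver-cong (allFin n) λ a →
                 trans (sumOver-swap maps (allFin n) (λ f b → 𝟙 (hit? f p a b))) (sumOver-cong (allFin n) λ b → split p a b)))) ⟩
        sumOver placements (λ p → sumOver (allFin n) (λ a → sumOver (allFin n) (λ b →
          𝟙 (a ∈? V D) * (𝟙 (b ∈? V D) * rooted D (V D) a (proj₁ p ! b))))) * c₀
          ≡⟨ sumOver-*ʳ placements _ c₀ ⟨
        sumOver placements (λ p → sumOver (allFin n) (λ a → sumOver (allFin n) (λ b →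
          𝟙 (a ∈? V D) * (𝟙 (b ∈? V D) * rooted D (V D) a (proj₁ p ! b)))) * c₀)
          ≤⟨ sumOver-mono placements per-placement ⟩
        sumOver placements (λ _ → v D * (v D * c₁))
          ≡⟨ sumOver-const placements _ ⟩
        length placements * (v D * (v D * c₁))
          ≡⟨ cong (_* (v D * (v D * c₁))) (length-map image placements) ⟨
        length images * (v D * (v D * c₁)) ∎
        where
        open ≤-Reasoning
        c₀ c₁ : ℕ
        c₀ = n ℕ.^ v D * Δ H
        c₁ = n ℕ.^ n * Δ H ℕ.^ v D
        hit? : ∀ f (p : ∃ Placed) a b → Dec (a ∈ V D × (b ∈ V D × (Embeds D (V D) f × f ! a ≡ proj₁ p ! b)))
        hit? f p a b = (a ∈? V D) ×-dec ((b ∈? V D) ×-dec rooted? D (V D) a (proj₁ p ! b) f)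
        split : ∀ p a b → sumOver maps (λ f → 𝟙 (hit? f p a b)) ≡ 𝟙 (a ∈? V D) * (𝟙 (b ∈? V D) * rooted D (V D) a (proj₁ p ! b))
        split p a b = trans (sumOver-cong maps λ f → trans (𝟙-× (a ∈? V D) ((b ∈? V D) ×-dec rooted? D (V D) a (proj₁ p ! b) f))
            (cong (𝟙 (a ∈? V D) *_) (𝟙-× (b ∈? V D) (rooted? D (V D) a (proj₁ p ! b) f))))
          (trans (sumOver-*ˡ (𝟙 (a ∈? V D)) maps _) (cong (𝟙 (a ∈? V D) *_) (sumOver-*ˡ (𝟙 (b ∈? V D)) maps _)))
        meets : ∀ f → Embeds D (V D) f →
          1 ≤ sumOver placements (λ p → sumOver (allFin n) (λ a → sumOver (allFin n) (λ b → 𝟙 (hit? f p a b))))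
        meets f emb = go (embeds-meets f emb)
          where
          go : ∀ {ps} → Any (λ p → Meet f (proj₁ p)) ps →
            1 ≤ sumOver ps (λ p → sumOver (allFin n) (λ a → sumOver (allFin n) (λ b → 𝟙 (hit? f p a b))))
          go (here {p} (a , a∈ , b , b∈ , eq)) = ℕ.≤-trans
            (ℕ.≤-trans (count-∈ (hit? f p a) (∈-allFin b) (a∈ , b∈ , emb , eq))
              (sumOver-∈ (λ a → sumOver (allFin n) (λ b → 𝟙 (hit? f p a b))) (∈-allFin a)))
            (ℕ.m≤m+n _ _)
          go (there ps) = ℕ.≤-trans (go ps) (ℕ.m≤n+m _ _)
        -- The estimate of `rooted-bound` is available for roots in `V D` only, so it is used under
        -- the indicator.
        guard : ∀ {P : Set} (d : Dec P) {x y} → (P → x ≤ y) → 𝟙 d * x ≤ 𝟙 d * y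
        guard (yes p) x≤y = ℕ.*-monoʳ-≤ 1 (x≤y p)
        guard (no _)  _   = z≤n
        per-placement : ∀ p → sumOver (allFin n) (λ a → sumOver (allFin n) (λ b →
          𝟙 (a ∈? V D) * (𝟙 (b ∈? V D) * rooted D (V D) a (proj₁ p ! b)))) * c₀ ≤ v D * (v D * c₁)
        per-placement p = begin
          sumOver (allFin n) (λ a → sumOver (allFin n) (λ b → 𝟙 (a ∈? V D) * (𝟙 (b ∈? V D) * r a b))) * c₀
            ≡⟨ sumOver-*ʳ (allFin n) _ c₀ ⟨
          sumOver (allFin n) (λ a → sumOver (allFin n) (λ b → 𝟙 (a ∈? V D) * (𝟙 (b ∈? V D) * r a b)) * c₀)
            ≡⟨ sumOver-cong (allFin n) (λ a → trans (cong (_* c₀) (sumOver-*ˡ (𝟙 (a ∈? V D)) (allFin n) _))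
                 (ℕ.*-assoc (𝟙 (a ∈? V D)) _ c₀)) ⟩
          sumOver (allFin n) (λ a → 𝟙 (a ∈? V D) * (sumOver (allFin n) (λ b → 𝟙 (b ∈? V D) * r a b) * c₀))
            ≤⟨ sumOver-mono (allFin n) (λ a → guard (a ∈? V D) (per-root a)) ⟩
          sumOver (allFin n) (λ a → 𝟙 (a ∈? V D) * (v D * c₁))
            ≡⟨ ∣p∣*≡sum (V D) (v D * c₁) ⟩
          v D * (v D * c₁) ∎
          where
          r : Fin n → Fin n → ℕ
          r a b = rooted D (V D) a (proj₁ p ! b)
          per-root : ∀ a → a ∈ V D → sumOver (allFin n) (λ b → 𝟙 (b ∈? V D) * r a b) * c₀ ≤ v D * c₁
          per-root a a∈ = begin
            sumOver (allFin n) (λ b → 𝟙 (b ∈? V D) * r a b) * c₀    ≡⟨ sumOver-*ʳ (allFin n) _ c₀ ⟨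
            sumOver (allFin n) (λ b → 𝟙 (b ∈? V D) * r a b * c₀)    ≤⟨ sumOver-mono (allFin n) (λ b → ℕ.≤-trans
              (ℕ.≤-reflexive (ℕ.*-assoc (𝟙 (b ∈? V D)) (r a b) c₀))
              (ℕ.*-monoʳ-≤ (𝟙 (b ∈? V D)) (rooted-bound C a∈ (proj₁ p ! b)))) ⟩
            sumOver (allFin n) (λ b → 𝟙 (b ∈? V D) * c₁)            ≡⟨ ∣p∣*≡sum (V D) c₁ ⟩
            v D * c₁                                                ∎

-- Inequalities between surds

-- For v ≤ n the quotient is at most Euler's number e < 4. The value 4 arises as (2n / y)² with y =
-- 2n - v ≥ n, which has an elementary telescoping proof.
[1+n]^v≤4n^v : ∀ n v → v ≤ n → suc n ℕ.^ v ≤ 4 * n ℕ.^ v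
[1+n]^v≤4n^v zero      .zero z≤n = s≤s z≤n
[1+n]^v≤4n^v n@(suc _) v v≤n = ℕ.*-cancelʳ-≤ _ _ (n * n) {{ℕ.m*n≢0 n n}} (begin
  suc n ℕ.^ v * (n * n)         ≤⟨ ℕ.*-monoʳ-≤ (suc n ℕ.^ v) (ℕ.*-mono-≤ n≤y n≤y) ⟩
  suc n ℕ.^ v * (y * y)         ≤⟨ descend v y v+y≡2n ⟩
  n ℕ.^ v * (2 * n * (2 * n))   ≡⟨ rearrange (n ℕ.^ v) n ⟩
  4 * n ℕ.^ v * (n * n)         ∎)
  where
  open ≤-Reasoning
  y : ℕ
  y = (n ℕ.∸ v) + n
  n≤y : n ≤ y
  n≤y = ℕ.m≤n+m n (n ℕ.∸ v)
  v+y≡2n : v + y ≡ 2 * n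
  v+y≡2n = trans (sym (ℕ.+-assoc v (n ℕ.∸ v) n)) (trans (cong (_+ n) (ℕ.m+[n∸m]≡n v≤n)) (cong (n +_) (sym (ℕ.+-identityʳ n))))
  rearrange : ∀ p n → p * (2 * n * (2 * n)) ≡ 4 * p * (n * n)
  rearrange = solve-∀
  -- This is 1 + 1/n ≤ (1 + 1/y)², which holds because already the linear term 2/y is at least 1/n.
  square : ∀ y → y ≤ 2 * n → suc n * (y * y) ≤ n * (suc y * suc y)
  square y y≤2n = begin
    suc n * (y * y)                   ≡⟨ ℕ.+-comm (y * y) (n * (y * y)) ⟩
    n * (y * y) + y * y               ≤⟨ ℕ.+-monoʳ-≤ (n * (y * y)) (ℕ.≤-trans (ℕ.*-monoˡ-≤ y y≤2n) (ℕ.m≤m+n _ n)) ⟩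
    n * (y * y) + (2 * n * y + n)     ≡⟨ expand n y ⟩
    n * (suc y * suc y)               ∎
    where
    expand : ∀ n y → n * (y * y) + (2 * n * y + n) ≡ n * (suc y * suc y)
    expand = solve-∀
  -- (1 + 1/n)^v ≤ 1 / (1 - v/(2n))², with y = 2n - v.
  descend : ∀ v y → v + y ≡ 2 * n → suc n ℕ.^ v * (y * y) ≤ n ℕ.^ v * (2 * n * (2 * n))
  descend zero    y refl = ℕ.≤-refl
  descend (suc v) y eq   = begin
    suc n * suc n ℕ.^ v * (y * y)             ≡⟨ swap (suc n) (suc n ℕ.^ v) (y * y) ⟩
    suc n ℕ.^ v * (suc n * (y * y))           ≤⟨ ℕ.*-monoʳ-≤ (suc n ℕ.^ v) (square y (subst (y ≤_) eq (ℕ.m≤n+m y (suc v)))) ⟩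
    suc n ℕ.^ v * (n * (suc y * suc y))       ≡⟨ swap′ (suc n ℕ.^ v) n (suc y * suc y) ⟩
    n * (suc n ℕ.^ v * (suc y * suc y))       ≤⟨ ℕ.*-monoʳ-≤ n (descend v (suc y) (trans (ℕ.+-suc v y) eq)) ⟩
    n * (n ℕ.^ v * (2 * n * (2 * n)))         ≡⟨ ℕ.*-assoc n (n ℕ.^ v) _ ⟨
    n ℕ.^ suc v * (2 * n * (2 * n))           ∎
    where
    swap : ∀ a b c → a * b * c ≡ b * (a * c)
    swap = solve-∀
    swap′ : ∀ a b c → a * (b * c) ≡ b * (a * c)
    swap′ = solve-∀

-- Removing one factor of the falling factorial lowers the base from m + 1 to m, at a cost of at
-- most 4 by the preceding estimate, since v ≤ m. It compares permutations with maps and, at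
-- `j = 0`, gives the weak Stirling bound.
n^v*j!≤4^v*n! : ∀ v j → (v + j) ℕ.^ v * j ! ≤ 4 ℕ.^ v * (v + j) !
n^v*j!≤4^v*n! zero    j = ℕ.≤-refl
n^v*j!≤4^v*n! (suc v) j = begin
  suc m * suc m ℕ.^ v * j !       ≤⟨ ℕ.*-monoˡ-≤ (j !) (ℕ.*-monoʳ-≤ (suc m) ([1+n]^v≤4n^v m v (ℕ.m≤m+n v j))) ⟩
  suc m * (4 * m ℕ.^ v) * j !     ≡⟨ rearrange (suc m) (m ℕ.^ v) (j !) ⟩
  4 * suc m * (m ℕ.^ v * j !)     ≤⟨ ℕ.*-monoʳ-≤ (4 * suc m) (n^v*j!≤4^v*n! v j) ⟩
  4 * suc m * (4 ℕ.^ v * m !)     ≡⟨ rearrange′ (suc m) (4 ℕ.^ v) (m !) ⟩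
  4 ℕ.^ suc v * suc m !           ∎
  where
  open ≤-Reasoning
  m = v + j
  rearrange : ∀ a b c → a * (4 * b) * c ≡ 4 * a * (b * c)
  rearrange = solve-∀
  rearrange′ : ∀ a b c → 4 * a * (b * c) ≡ 4 * b * (a * c)
  rearrange′ = solve-∀

m^m≤4^m*m! : ∀ m → m ℕ.^ m ≤ 4 ℕ.^ m * m !
m^m≤4^m*m! m = subst (λ l → l ℕ.^ m ≤ 4 ℕ.^ m * l !) (ℕ.+-identityʳ m)
  (subst (_≤ 4 ℕ.^ m * (m + 0) !) (ℕ.*-identityʳ _) (n^v*j!≤4^v*n! m 0))

^-distribʳ-* : ∀ a b k → (a * b) ℕ.^ k ≡ a ℕ.^ k * b ℕ.^ k
^-distribʳ-* a b zero    = refl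
^-distribʳ-* a b (suc k) = trans (cong (a * b *_) (^-distribʳ-* a b k)) (interchange a b (a ℕ.^ k) (b ℕ.^ k))
  where
  interchange : ∀ a b c d → a * b * (c * d) ≡ a * c * (b * d)
  interchange = solve-∀

4e≤8^e : ∀ e .{{_ : ℕ.NonZero e}} → 4 * e ≤ 8 ℕ.^ e
4e≤8^e (suc zero)        = ℕ.m≤m+n 4 4
4e≤8^e (suc e@(suc d)) = begin
  4 * suc e          ≤⟨ ℕ.*-monoʳ-≤ 4 (ℕ.+-monoˡ-≤ e (s≤s (z≤n {d}))) ⟩
  4 * (e + e)        ≤⟨ ℕ.m≤m+n _ (24 * e) ⟩
  4 * (e + e) + 24 * e  ≡⟨ lemma e ⟩
  8 * (4 * e)        ≤⟨ ℕ.*-monoʳ-≤ 8 (4e≤8^e e) ⟩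
  8 * 8 ℕ.^ e        ∎
  where
  open ≤-Reasoning
  lemma : ∀ e → 4 * (e + e) + 24 * e ≡ 8 * (4 * e)
  lemma = solve-∀

-- Comparing natural numbers with powers of a surd

ι : ℕ → ℚ
ι k = ℤ.+ k / 1

ι-+ : ∀ a b → ι (a + b) ≡ ι a ℚ.+ ι b
ι-+ zero    b = sym (ℚ.+-identityˡ (ι b))
ι-+ (suc a) b = begin
  ι (suc (a + b))           ≡⟨ 1+k/1 (a + b) ⟩
  1ℚ ℚ.+ ι (a + b)          ≡⟨ cong (1ℚ ℚ.+_) (ι-+ a b) ⟩
  1ℚ ℚ.+ (ι a ℚ.+ ι b)      ≡⟨ ℚ.+-assoc 1ℚ (ι a) (ι b) ⟨
  1ℚ ℚ.+ ι a ℚ.+ ι b        ≡⟨ cong (ℚ._+ ι b) (1+k/1 a) ⟨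
  ι (suc a) ℚ.+ ι b         ∎
  where open ≡-Reasoning

ι-* : ∀ a b → ι (a * b) ≡ ι a ℚ.* ι b
ι-* zero    b = sym (ℚ.*-zeroˡ (ι b))
ι-* (suc a) b = begin
  ι (b + a * b)                 ≡⟨ ι-+ b (a * b) ⟩
  ι b ℚ.+ ι (a * b)             ≡⟨ cong₂ ℚ._+_ (sym (ℚ.*-identityˡ (ι b))) (ι-* a b) ⟩
  1ℚ ℚ.* ι b ℚ.+ ι a ℚ.* ι b    ≡⟨ ℚ.*-distribʳ-+ (ι b) 1ℚ (ι a) ⟨
  (1ℚ ℚ.+ ι a) ℚ.* ι b          ≡⟨ cong (ℚ._* ι b) (1+k/1 a) ⟨
  ι (suc a) ℚ.* ι b             ∎
  where open ≡-Reasoning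

ι-^ : ∀ a k → ι (a ℕ.^ k) ≡ ι a ^ k
ι-^ a zero    = refl
ι-^ a (suc k) = trans (ι-* a (a ℕ.^ k)) (cong (ι a ℚ.*_) (ι-^ a k))

0≤ι : ∀ k → 0ℚ ℚ.≤ ι k
0≤ι k = ℚ.nonNegative⁻¹ (ι k) {{ℚ.normalize-nonNeg k 1}}

0<ι : ∀ k .{{_ : ℕ.NonZero k}} → 0ℚ ℚ.< ι k
0<ι k = ℚ.positive⁻¹ (ι k) {{ℚ.normalize-pos k 1}}

ι-mono-≤ : ∀ {a b} → a ≤ b → ι a ℚ.≤ ι b
ι-mono-≤ {a} {b} a≤b = begin
  ι a                    ≡⟨ ℚ.+-identityʳ (ι a) ⟨
  ι a ℚ.+ 0ℚ             ≤⟨ ℚ.+-monoʳ-≤ (ι a) (0≤ι (b ℕ.∸ a)) ⟩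
  ι a ℚ.+ ι (b ℕ.∸ a)    ≡⟨ ι-+ a (b ℕ.∸ a) ⟨
  ι (a + (b ℕ.∸ a))      ≡⟨ cong ι (ℕ.m+[n∸m]≡n a≤b) ⟩
  ι b                    ∎
  where open ℚ.≤-Reasoning

*-mono-nonNeg : ∀ {x x′ y y′} → 0ℚ ℚ.≤ x → 0ℚ ℚ.≤ y′ → x ℚ.≤ x′ → y ℚ.≤ y′ → x ℚ.* y ℚ.≤ x′ ℚ.* y′
*-mono-nonNeg {x} {x′} {y} {y′} 0≤x 0≤y′ x≤x′ y≤y′ = ℚ.≤-trans
  (ℚ.*-monoˡ-≤-nonNeg x {{ℚ.nonNegative 0≤x}} y≤y′) (ℚ.*-monoʳ-≤-nonNeg y′ {{ℚ.nonNegative 0≤y′}} x≤x′)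

ℚ-interchange : ∀ a b c d → (a ℚ.* b) ℚ.* (c ℚ.* d) ≡ (a ℚ.* c) ℚ.* (b ℚ.* d)
ℚ-interchange a b c d = begin
  (a ℚ.* b) ℚ.* (c ℚ.* d)   ≡⟨ ℚ.*-assoc a b _ ⟩
  a ℚ.* (b ℚ.* (c ℚ.* d))   ≡⟨ cong (a ℚ.*_) (ℚ.*-assoc b c d) ⟨
  a ℚ.* ((b ℚ.* c) ℚ.* d)   ≡⟨ cong (λ x → a ℚ.* (x ℚ.* d)) (ℚ.*-comm b c) ⟩
  a ℚ.* ((c ℚ.* b) ℚ.* d)   ≡⟨ cong (a ℚ.*_) (ℚ.*-assoc c b d) ⟩
  a ℚ.* (c ℚ.* (b ℚ.* d))   ≡⟨ ℚ.*-assoc a c _ ⟨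
  (a ℚ.* c) ℚ.* (b ℚ.* d)   ∎
  where open ≡-Reasoning

^-pos : ∀ {x} → 0ℚ ℚ.< x → ∀ k → 0ℚ ℚ.< x ^ k
^-pos {x} 0<x zero    = ℚ.positive⁻¹ 1ℚ
^-pos {x} 0<x (suc k) = subst (ℚ._< x ℚ.* x ^ k) (ℚ.*-zeroʳ x)
  (ℚ.*-monoʳ-<-pos x {{ℚ.positive 0<x}} (^-pos 0<x k))

1^k : ∀ k → 1ℚ ^ k ≡ 1ℚ
1^k zero    = refl
1^k (suc k) = trans (ℚ.*-identityˡ _) (1^k k)

-- p ≤ s · a^e as real numbers.
record Bound (a : Surd) (e p s : ℕ) : Set where
  constructor bounded
  field bound : ι p ^ index a ℚ.≤ ι s ^ index a ℚ.* radicand a ^ e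

Surd≢0 : (a : Surd) → ℕ.NonZero (index a)
Surd≢0 (root k x {{k≢0}} 0≤x) = k≢0

radicand-nonNeg : (a : Surd) → 0ℚ ℚ.≤ radicand a
radicand-nonNeg (root k x 0≤x) = 0≤x

private
  rhs-nonNeg : ∀ a s e k → 0ℚ ℚ.≤ ι s ^ k ℚ.* radicand a ^ e
  rhs-nonNeg a s e k = *-nonNeg (^-nonNeg (0≤ι s) k) (^-nonNeg (radicand-nonNeg a) e)

bound-0 : ∀ a e s → Bound a e 0 s
bound-0 a e s = bounded (subst (ℚ._≤ ι s ^ index a ℚ.* radicand a ^ e) (sym (0^k (index a) {{Surd≢0 a}})) (rhs-nonNeg a s e (index a)))
  where
  0^k : ∀ k .{{_ : ℕ.NonZero k}} → ι 0 ^ k ≡ 0ℚ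
  0^k (suc k) = ℚ.*-zeroˡ (ι 0 ^ k)

bound-1 : ∀ a → Bound a 0 1 1
bound-1 a = bounded (ℚ.≤-reflexive (sym (ℚ.*-identityʳ (ι 1 ^ index a))))

bound-+ : ∀ a {e f p p′ s s′} → Bound a e p s → Bound a f p′ s′ → Bound a (e + f) (p * p′) (s * s′)
bound-+ a {e} {f} {p} {p′} {s} {s′} (bounded b) (bounded b′) = bounded (begin
  ι (p * p′) ^ κ                                              ≡⟨ trans (cong (_^ κ) (ι-* p p′)) (^-distrib-* (ι p) (ι p′) κ) ⟩
  ι p ^ κ ℚ.* ι p′ ^ κ                                        ≤⟨ *-mono-nonNeg (^-nonNeg (0≤ι p) κ) (rhs-nonNeg a s′ f κ) b b′ ⟩
  (ι s ^ κ ℚ.* r ^ e) ℚ.* (ι s′ ^ κ ℚ.* r ^ f)                ≡⟨ ℚ-interchange (ι s ^ κ) (r ^ e) (ι s′ ^ κ) (r ^ f) ⟩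
  (ι s ^ κ ℚ.* ι s′ ^ κ) ℚ.* (r ^ e ℚ.* r ^ f)                ≡⟨ cong₂ ℚ._*_
    (trans (cong (_^ κ) (ι-* s s′)) (^-distrib-* (ι s) (ι s′) κ)) (^-homo-* r e f) ⟨
  ι (s * s′) ^ κ ℚ.* r ^ (e + f)                              ∎)
  where
  open ℚ.≤-Reasoning
  κ = index a
  r = radicand a

private
  ι-^-swap : ∀ p j k → ι (p ℕ.^ j) ^ k ≡ (ι p ^ k) ^ j
  ι-^-swap p j k = trans (cong (_^ k) (ι-^ p j)) (^-swap (ι p) j k)

  rhs-^ : ∀ a s e j → ι (s ℕ.^ j) ^ index a ℚ.* radicand a ^ (e * j) ≡ (ι s ^ index a ℚ.* radicand a ^ e) ^ j
  rhs-^ a s e j = trans (cong₂ ℚ._*_ (ι-^-swap s j (index a)) (sym (^-assocʳ (radicand a) e j)))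
    (sym (^-distrib-* (ι s ^ index a) (radicand a ^ e) j))

bound-^ : ∀ a {e p s} j → Bound a e p s → Bound a (e * j) (p ℕ.^ j) (s ℕ.^ j)
bound-^ a {e} {p} {s} j (bounded b) = bounded (subst₂ ℚ._≤_ (sym (ι-^-swap p j (index a))) (sym (rhs-^ a s e j))
  (^-mono-≤ (^-nonNeg (0≤ι p) (index a)) b j))

-- A fractional exponent of the surd is handled by proving the estimate for a power that makes it
-- integral and then cancelling the power here.
bound-root : ∀ a {e p s} j {{_ : ℕ.NonZero j}} → Bound a (e * j) (p ℕ.^ j) (s ℕ.^ j) → Bound a e p s
bound-root a {e} {p} {s} j (bounded b) = bounded (^-cancel-≤ (rhs-nonNeg a s e (index a)) j
  (subst₂ ℚ._≤_ (ι-^-swap p j (index a)) (rhs-^ a s e j) b))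

-- The hypothesis is p/s ≤ p′/s′ cleared of denominators; all integer estimates are transferred to
-- surds through it.
bound-weaken : ∀ a {e p p′ s s′} .{{_ : ℕ.NonZero s′}} → p * s′ ≤ p′ * s → Bound a e p′ s′ → Bound a e p s
bound-weaken a {e} {p} {p′} {s} {s′} ps′≤p′s (bounded b) = bounded (ℚ.*-cancelʳ-≤-pos (ι s′ ^ κ) {{ℚ.positive (^-pos (0<ι s′) κ)}} (begin
  ι p ^ κ ℚ.* ι s′ ^ κ                  ≡⟨ ι-*-^ p s′ ⟨
  ι (p * s′) ^ κ                        ≤⟨ ^-mono-≤ (0≤ι (p * s′)) (ι-mono-≤ ps′≤p′s) κ ⟩
  ι (p′ * s) ^ κ                        ≡⟨ ι-*-^ p′ s ⟩
  ι p′ ^ κ ℚ.* ι s ^ κ                  ≤⟨ ℚ.*-monoʳ-≤-nonNeg (ι s ^ κ) {{ℚ.nonNegative (^-nonNeg (0≤ι s) κ)}} b ⟩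
  (ι s′ ^ κ ℚ.* r ^ e) ℚ.* ι s ^ κ      ≡⟨ ℚ.*-comm _ (ι s ^ κ) ⟩
  ι s ^ κ ℚ.* (ι s′ ^ κ ℚ.* r ^ e)      ≡⟨ cong (ι s ^ κ ℚ.*_) (ℚ.*-comm (ι s′ ^ κ) (r ^ e)) ⟩
  ι s ^ κ ℚ.* (r ^ e ℚ.* ι s′ ^ κ)      ≡⟨ ℚ.*-assoc (ι s ^ κ) (r ^ e) (ι s′ ^ κ) ⟨
  (ι s ^ κ ℚ.* r ^ e) ℚ.* ι s′ ^ κ      ∎))
  where
  open ℚ.≤-Reasoning
  κ = index a
  r = radicand a
  ι-*-^ : ∀ x y → ι (x * y) ^ κ ≡ ι x ^ κ ℚ.* ι y ^ κ
  ι-*-^ x y = trans (cong (_^ κ) (ι-* x y)) (^-distrib-* (ι x) (ι y) κ)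

bound-* : ∀ a b {e p p′ s s′} → Bound a e p s → Bound b e p′ s′ → Bound (a *ˢ b) e (p * p′) (s * s′)
bound-* a@(root k x 0≤x) b@(root l y 0≤y) {e} {p} {p′} {s} {s′} (bounded h) (bounded h′) = bounded (begin
  ι (p * p′) ^ (k * l)                               ≡⟨ split p p′ ⟩
  (ι p ^ k) ^ l ℚ.* (ι p′ ^ l) ^ k                   ≤⟨ *-mono-nonNeg (^-nonNeg (^-nonNeg (0≤ι p) k) l)
                                                          (^-nonNeg (rhs-nonNeg b s′ e l) k)
                                                          (^-mono-≤ (^-nonNeg (0≤ι p) k) h l)
                                                          (^-mono-≤ (^-nonNeg (0≤ι p′) l) h′ k) ⟩
  (ι s ^ k ℚ.* x ^ e) ^ l ℚ.* (ι s′ ^ l ℚ.* y ^ e) ^ k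
    ≡⟨ cong₂ ℚ._*_ (^-distrib-* (ι s ^ k) (x ^ e) l) (^-distrib-* (ι s′ ^ l) (y ^ e) k) ⟩
  ((ι s ^ k) ^ l ℚ.* (x ^ e) ^ l) ℚ.* ((ι s′ ^ l) ^ k ℚ.* (y ^ e) ^ k)
    ≡⟨ ℚ-interchange ((ι s ^ k) ^ l) ((x ^ e) ^ l) ((ι s′ ^ l) ^ k) ((y ^ e) ^ k) ⟩
  ((ι s ^ k) ^ l ℚ.* (ι s′ ^ l) ^ k) ℚ.* ((x ^ e) ^ l ℚ.* (y ^ e) ^ k)
    ≡⟨ cong₂ ℚ._*_ (split s s′) (trans (^-distrib-* (x ^ l) (y ^ k) e) (cong₂ ℚ._*_ (^-swap x l e) (^-swap y k e))) ⟨
  ι (s * s′) ^ (k * l) ℚ.* (x ^ l ℚ.* y ^ k) ^ e     ∎)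
  where
  open ℚ.≤-Reasoning
  split : ∀ t t′ → ι (t * t′) ^ (k * l) ≡ (ι t ^ k) ^ l ℚ.* (ι t′ ^ l) ^ k
  split t t′ = trans (cong (_^ (k * l)) (ι-* t t′)) (trans (^-distrib-* (ι t) (ι t′) (k * l))
    (cong₂ ℚ._*_ (sym (^-assocʳ (ι t) k l)) (trans (cong (ι t′ ^_) (ℕ.*-comm k l)) (sym (^-assocʳ (ι t′) l k)))))

bound-fromℚ : ∀ c e → Bound (fromℚ (ι c) (0≤ι c)) e (c ℕ.^ e) 1
bound-fromℚ c e = bounded (ℚ.≤-reflexive (trans (ℚ.*-identityʳ _) (trans (ι-^ c e) (sym (ℚ.*-identityˡ _)))))

bound⇒≤ˢ : ∀ a {e k N x} .{{_ : ℕ.NonZero N}} (0≤x : 0ℚ ℚ.≤ x) → x ℚ.* ι N ≡ ι k → Bound a e k N → fromℚ x 0≤x ≤ˢ a ^ˢ e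
bound⇒≤ˢ a@(root j r 0≤r) {e} {k} {N} {x} 0≤x xN≡k (bounded b) = ℚ.*-cancelʳ-≤-pos (ι N ^ j) {{ℚ.positive (^-pos (0<ι N) j)}} (begin
  x ^ j ℚ.* ι N ^ j             ≡⟨ ^-distrib-* x (ι N) j ⟨
  (x ℚ.* ι N) ^ j               ≡⟨ cong (_^ j) xN≡k ⟩
  ι k ^ j                       ≤⟨ b ⟩
  ι N ^ j ℚ.* r ^ e             ≡⟨ ℚ.*-comm (ι N ^ j) (r ^ e) ⟩
  r ^ e ℚ.* ι N ^ j             ≡⟨ cong (ℚ._* ι N ^ j) (ℚ.*-identityʳ (r ^ e)) ⟨
  (r ^ e ℚ.* 1ℚ) ℚ.* ι N ^ j    ∎)
  where open ℚ.≤-Reasoning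

-- The numerator and denominator of `z` are in lowest terms while `i` and `d` may share factors, so
-- only the cross-multiplied identity is available.
↥*≡ : ∀ z i d .{{_ : ℕ.NonZero d}} → z ≡ i / d → ↥ z ℤ.* ℤ.+ d ≡ i ℤ.* ℤ.+ (↧ₙ z)
↥*≡ z@(ℚ.mkℚ _ _ _) i d@(suc d-1) eq with ℚᵘ.*≡* h ← ℚᵘ.≃-trans (ℚ.toℚᵘ-cong eq) (ℚ.toℚᵘ-fromℚᵘ (ℚᵘ.mkℚᵘ i d-1)) = h

-- The hypothesis says z = P/E, so the `E`-th power of `m ^ℚ z` is the integer `m ^ P`.
bound-^ℚ : ∀ m .{{_ : ℕ.NonZero m}} z {P E} .{{_ : ℕ.NonZero E}} → ↥ z ℤ.* ℤ.+ E ≡ ℤ.+ P ℤ.* ℤ.+ (↧ₙ z) →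
           Bound (m ^ℚ z) E (m ℕ.^ P) 1
bound-^ℚ m z@(ℚ.mkℚ (ℤ.+ p) d-1 _) {P} {E} eq = bounded (ℚ.≤-reflexive (begin
  ι (m ℕ.^ P) ^ suc d-1                    ≡⟨ ι-^ (m ℕ.^ P) (suc d-1) ⟨
  ι ((m ℕ.^ P) ℕ.^ suc d-1)                ≡⟨ cong ι (ℕ.^-*-assoc m P (suc d-1)) ⟩
  ι (m ℕ.^ (P * suc d-1))                  ≡⟨ cong (λ l → ι (m ℕ.^ l)) (ℤ.+-injective (trans (ℤ.pos-* P (suc d-1))
                                                (trans (sym eq) (sym (ℤ.pos-* p E))))) ⟩
  ι (m ℕ.^ (p * E))                        ≡⟨ cong ι (ℕ.^-*-assoc m p E) ⟨
  ι ((m ℕ.^ p) ℕ.^ E)                      ≡⟨ ι-^ (m ℕ.^ p) E ⟩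
  ι (m ℕ.^ p) ^ E                          ≡⟨ ℚ.*-identityˡ _ ⟨
  1ℚ ℚ.* ι (m ℕ.^ p) ^ E                   ≡⟨ cong (ℚ._* ι (m ℕ.^ p) ^ E) (1^k (suc d-1)) ⟨
  ι 1 ^ suc d-1 ℚ.* ι (m ℕ.^ p) ^ E        ∎))
  where open ≡-Reasoning
bound-^ℚ m z@(ℚ.mkℚ -[1+ p ] d-1 _) {P} {suc E} eq = contradiction (trans eq (sym (ℤ.pos-* P (suc d-1)))) λ ()

-- The hypothesis says z = -1/E, so m^(-1/E) ≤ a becomes 1 ≤ m a^E. This is how the values compared
-- in `q` enter.
bound-^ℚ-neg : ∀ m .{{_ : ℕ.NonZero m}} z a {E} .{{_ : ℕ.NonZero E}} → ↥ z ℤ.* ℤ.+ E ≡ -[1+ 0 ] ℤ.* ℤ.+ (↧ₙ z) →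
               m ^ℚ z ≤ˢ a → Bound a E 1 m
bound-^ℚ-neg m z@(ℚ.mkℚ (ℤ.+ p) d-1 _) a {E} eq _ = contradiction (trans (ℤ.pos-* p E) eq) λ ()
bound-^ℚ-neg m z@(ℚ.mkℚ -[1+ p ] d-1 _) a@(root k r 0≤r) {suc E} eq m^z≤a =
  -- The numerator of `z` is `- suc p` and its denominator is `suc E * suc p`, so the inequality
  -- appears raised to the power `suc p`.
  bounded (^-cancel-≤ (rhs-nonNeg a m (suc E) k) (suc p) (begin
    (ι 1 ^ k) ^ suc p                               ≡⟨ trans (cong (_^ suc p) (1^k k)) (1^k (suc p)) ⟩
    1ℚ                                              ≡⟨ 1^k k ⟨
    1ℚ ^ k                                          ≡⟨ cong (_^ k) (trans (cong (ℚ._* ((ℤ.+ 1 / M) {{M≢0}})) (sym (ι-^ m (suc p)))) (k/1*1/k M {{M≢0}})) ⟨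
    (ι m ^ suc p ℚ.* (ℤ.+ 1 / M) {{M≢0}}) ^ k         ≡⟨ ^-distrib-* (ι m ^ suc p) _ k ⟩
    (ι m ^ suc p) ^ k ℚ.* ((ℤ.+ 1 / M) {{M≢0}}) ^ k   ≤⟨ ℚ.*-monoˡ-≤-nonNeg ((ι m ^ suc p) ^ k)
                                                         {{ℚ.nonNegative (^-nonNeg (^-nonNeg (0≤ι m) (suc p)) k)}} m^z≤a ⟩
    (ι m ^ suc p) ^ k ℚ.* r ^ suc d-1               ≡⟨ cong₂ ℚ._*_ (^-swap (ι m) (suc p) k)
                                                         (trans (cong (r ^_) d≡) (sym (^-assocʳ r (suc E) (suc p)))) ⟩
    (ι m ^ k) ^ suc p ℚ.* (r ^ suc E) ^ suc p       ≡⟨ ^-distrib-* (ι m ^ k) (r ^ suc E) (suc p) ⟨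
    (ι m ^ k ℚ.* r ^ suc E) ^ suc p                 ∎))
  where
  open ℚ.≤-Reasoning
  M : ℕ
  M = m ℕ.^ suc p
  M≢0 : ℕ.NonZero M
  M≢0 = ℕ.m^n≢0 m (suc p)
  d≡ : suc d-1 ≡ suc E * suc p
  d≡ = trans (sym (ℕ.+-identityʳ (suc d-1))) (trans (sym (cong ℤ.∣_∣ eq)) (ℕ.*-comm (suc p) (suc E)))

-- The maxima d⋆ and q

∈-mapMaybe⁺ : {A B : Set} (h : A → Maybe B) → ∀ {xs x y} → x ∈ˡ xs → h x ≡ just y → y ∈ˡ List.mapMaybe h xs
∈-mapMaybe⁺ h {x ∷ _} (here refl) eq with h x | eq
... | just _ | refl = here refl
∈-mapMaybe⁺ h {x ∷ _} (there x∈)  eq with h x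
... | just _  = there (∈-mapMaybe⁺ h x∈ eq)
... | nothing = ∈-mapMaybe⁺ h x∈ eq

count-filter : {A : Set} {P Q : A → Set} (P? : Decidable P) (Q? : Decidable Q) → ∀ xs →
               count P? (filter Q? xs) ≡ count (λ x → P? x ×-dec Q? x) xs
count-filter P? Q? []       = refl
count-filter P? Q? (x ∷ xs) with Q? x
... | yes q = cong₂ _+_ (𝟙-cong (P? x) (P? x ×-dec yes q) (_, q) proj₁) (count-filter P? Q? xs)
... | no ¬q = cong₂ _+_ (sym (𝟙-no (P? x ×-dec no ¬q) (¬q ∘ proj₂))) (count-filter P? Q? xs)

/-*ι : ∀ i d .{{_ : ℕ.NonZero d}} → (ℤ.+ i / d) ℚ.* ι d ≡ ι i
/-*ι i d@(suc d-1) = ℚ.toℚᵘ-injective (ℚᵘ.≃-trans (ℚ.toℚᵘ-homo-* (ℤ.+ i / d) (ι d))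
  (ℚᵘ.≃-trans (ℚᵘ.*-cong (ℚ.toℚᵘ-fromℚᵘ (ℚᵘ.mkℚᵘ (ℤ.+ i) d-1)) (ℚ.toℚᵘ-fromℚᵘ (ℚᵘ.mkℚᵘ (ℤ.+ d) 0)))
    (ℚᵘ.≃-trans (ℚᵘ.*≡* (trans (ℤ.*-identityʳ _) (cong (λ x → ℤ.+ i ℤ.* ℤ.+ x) (sym (ℕ.*-identityʳ d)))))
      (ℚᵘ.≃-sym (ℚ.toℚᵘ-fromℚᵘ (ℚᵘ.mkℚᵘ (ℤ.+ i) 0))))))

*ι⇒↥↧ : ∀ z E P → z ℚ.* ι E ≡ ι P → ↥ z ℤ.* ℤ.+ E ≡ ℤ.+ P ℤ.* ℤ.+ (↧ₙ z)
*ι⇒↥↧ z@(ℚ.mkℚ i d-1 _) E P eq with ℚᵘ.*≡* h ← ℚᵘ.≃-trans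
  (ℚᵘ.≃-sym (ℚᵘ.≃-trans (ℚ.toℚᵘ-homo-* z (ι E)) (ℚᵘ.*-congˡ {ℚ.toℚᵘ z} (ℚ.toℚᵘ-fromℚᵘ (ℚᵘ.mkℚᵘ (ℤ.+ E) 0)))))
  (ℚᵘ.≃-trans (ℚ.toℚᵘ-cong eq) (ℚ.toℚᵘ-fromℚᵘ (ℚᵘ.mkℚᵘ (ℤ.+ P) 0))) =
  trans (sym (ℤ.*-identityʳ _)) (trans h (cong (λ x → ℤ.+ P ℤ.* ℤ.+ x) (ℕ.*-identityʳ (suc d-1))))

-- In rational terms 2/y = V/E, which makes the exponent 2/d⋆ equal to v(J)/e(J) for a densest `J`.
2÷average : ∀ y E V .{{_ : ℚ.NonZero y}} .{{_ : ℕ.NonZero V}} → y ≡ ℤ.+ (2 * E) / V →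
            ↥ ((ℤ.+ 2 / 1) ÷ y) ℤ.* ℤ.+ E ≡ ℤ.+ V ℤ.* ℤ.+ (↧ₙ ((ℤ.+ 2 / 1) ÷ y))
2÷average y E V y≡ = *ι⇒↥↧ (ι 2 ÷ y) E V (ℚ.≤-antisym (cancel (ℚ.≤-reflexive 2zE≡2V)) (cancel (ℚ.≤-reflexive (sym 2zE≡2V))))
  where
  open ≡-Reasoning
  cancel : ∀ {a b} → a ℚ.* ι 2 ℚ.≤ b ℚ.* ι 2 → a ℚ.≤ b
  cancel = ℚ.*-cancelʳ-≤-pos (ι 2)
  2zE≡2V : (ι 2 ÷ y) ℚ.* ι E ℚ.* ι 2 ≡ ι V ℚ.* ι 2
  2zE≡2V = begin
    (ι 2 ÷ y) ℚ.* ι E ℚ.* ι 2                   ≡⟨ ℚ.*-assoc (ι 2 ÷ y) (ι E) (ι 2) ⟩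
    (ι 2 ÷ y) ℚ.* (ι E ℚ.* ι 2)                 ≡⟨ cong ((ι 2 ÷ y) ℚ.*_) (trans (ℚ.*-comm (ι E) (ι 2)) (sym (ι-* 2 E))) ⟩
    (ι 2 ÷ y) ℚ.* ι (2 * E)                     ≡⟨ cong ((ι 2 ÷ y) ℚ.*_) (/-*ι (2 * E) V) ⟨
    (ι 2 ÷ y) ℚ.* ((ℤ.+ (2 * E) / V) ℚ.* ι V)   ≡⟨ cong (λ x → (ι 2 ÷ y) ℚ.* (x ℚ.* ι V)) y≡ ⟨
    (ι 2 ÷ y) ℚ.* (y ℚ.* ι V)                   ≡⟨ ℚ.*-assoc (ι 2 ÷ y) y (ι V) ⟨
    (ι 2 ÷ y) ℚ.* y ℚ.* ι V                     ≡⟨ cong (ℚ._* ι V) (trans (ℚ.*-assoc (ι 2) (ℚ.1/ y) y)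
                                                     (trans (cong (ι 2 ℚ.*_) (ℚ.*-inverseˡ y)) (ℚ.*-identityʳ (ι 2)))) ⟩
    ι 2 ℚ.* ι V                                 ≡⟨ ℚ.*-comm (ι 2) (ι V) ⟩
    ι V ℚ.* ι 2                                 ∎

module Maxima (n : ℕ) where
  open Subgraphs n

  -- The candidates of `maxOver`: the listed subgraphs and the starting value. The list carries its
  -- own proofs of nonemptiness, hence the existential.
  Among : Graph → ∃ Nonempty → Set
  Among H (J , J≢∅) = (∃[ J≢∅′ ] (J , J≢∅′) ∈ˡ nonemptySubgraphs H) ⊎ J ≡ H

  ⊆⇒Among : ∀ {H J} → J ⊆ H → (J≢∅ : Nonempty J) → Among H (J , J≢∅)
  ⊆⇒Among {H} {J} J⊆H J≢∅ = inj₁ (found (nonempty? J ×-dec (J ⊆? H)) refl)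
    where
    found : ∀ d → d ≡ (nonempty? J ×-dec (J ⊆? H)) → ∃[ J≢∅′ ] (J , J≢∅′) ∈ˡ nonemptySubgraphs H
    found (no ∄)        _  = ⊥-elim (∄ (J≢∅ , J⊆H))
    found (yes (p , s)) eq = p , ∈-mapMaybe⁺ _ (∈-allSubsets J)
      (cong (λ d → Maybe.map (λ (J≢∅ , _) → J , J≢∅) (dec⇒maybe d)) (sym eq))

  maxOver-attained : ∀ {c ℓ₁ ℓ₂} (O : TotalOrder c ℓ₁ ℓ₂) f H H≢∅ →
    ∃[ J ] ∃[ J≢∅ ] Among H (J , J≢∅) × maxOver O f H H≢∅ ≡ f J J≢∅
  maxOver-attained O f H H≢∅ with Extrema.argmax-sel O id (f H H≢∅) (map (λ (J , J≢∅) → f J J≢∅) (nonemptySubgraphs H))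
  ... | inj₁ eq = H , H≢∅ , inj₂ refl , eq
  ... | inj₂ m∈ with (J , J≢∅) , J∈ , eq ← ∈-map⁻ (λ (J , J≢∅) → f J J≢∅) m∈ = J , J≢∅ , inj₁ (J≢∅ , J∈) , eq

  -- Only lower bounds on `q` are ever needed. They are taken from two subgraphs: a densest one and
  -- the union of a packing.
  bound-q : ∀ H H≢∅ {J} (J≢∅ : Nonempty J) → Among H (J , J≢∅) → Bound (q H H≢∅) (e J) 1 (N J K)
  bound-q H H≢∅ {J} J≢∅ among = go among
    where
    bound : ∀ {J} (J≢∅ : Nonempty J) → N^[-1/e] J J≢∅ ≤ˢ q H H≢∅ → Bound (q H H≢∅) (e J) 1 (N J K)
    bound {J} J≢∅ = bound-^ℚ-neg (N J K) (ℚ.- (ℤ.+ 1 / e J)) (q H H≢∅) (numerator (e J))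
      where
      instance
        N≢0′ = N≢0 J
        e≢0′ = e≢0 {J} J≢∅
      numerator : ∀ d .{{_ : ℕ.NonZero d}} → ↥ (ℚ.- (ℤ.+ 1 / d)) ℤ.* ℤ.+ d ≡ -[1+ 0 ] ℤ.* ℤ.+ (↧ₙ (ℚ.- (ℤ.+ 1 / d)))
      numerator d@(suc d-1) = ↥*≡ (ℚ.- (ℤ.+ 1 / d)) -[1+ 0 ] d (ℚ.toℚᵘ-injective (ℚᵘ.≃-trans (ℚ.toℚᵘ-homo‿- (ℤ.+ 1 / d))
        (ℚᵘ.≃-trans (ℚᵘ.-‿cong (ℚ.toℚᵘ-fromℚᵘ (ℚᵘ.mkℚᵘ (ℤ.+ 1) d-1))) (ℚᵘ.≃-sym (ℚ.toℚᵘ-fromℚᵘ (ℚᵘ.mkℚᵘ -[1+ 0 ] d-1))))))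
    values = map (λ (J , J≢∅) → N^[-1/e] J J≢∅) (nonemptySubgraphs H)
    go : Among H (J , J≢∅) → Bound (q H H≢∅) (e J) 1 (N J K)
    go (inj₁ (J≢∅′ , J∈)) = bound J≢∅′ (All.lookup (Extrema.xs≤max ≤ˢ-totalOrder (N^[-1/e] H H≢∅) values)
      (∈-map⁺ (λ (J , J≢∅) → N^[-1/e] J J≢∅) J∈))
    go (inj₂ refl) = bound H≢∅ (Extrema.⊥≤max ≤ˢ-totalOrder (N^[-1/e] H H≢∅) values)

  -- Since `J` attains d⋆, the power `e J` of Δ^(2/d⋆) has the integral exponent `v J`.
  bound-Δ : ∀ H H≢∅ {J} (J≢∅ : Nonempty J) → d⋆ H H≢∅ ≡ averageDegree J J≢∅ →
            Bound (Δ^[2/d⋆] H H≢∅) (e J) (Δ H ℕ.^ v J) 1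
  bound-Δ H H≢∅ {J} J≢∅ d≡ = bound-^ℚ (Δ H) ((ℤ.+ 2 / 1) ÷ d⋆ H H≢∅) {v J} {e J} (2÷average (d⋆ H H≢∅) (e J) (v J) d≡)
    where
    instance
      Δ≢0′  = Δ≢0 {H} H≢∅
      d⋆≢0′ = d⋆≢0 H H≢∅
      e≢0′  = e≢0 {J} J≢∅
      v≢0′  = v≢0 {J} J≢∅

-- The spread bound

16≤1024 : 16 ≤ 1024
16≤1024 = ℕ.m≤m+n 16 1008

module Spreading (n : ℕ) .{{_ : ℕ.NonZero n}} (H : Subgraphs.Graph n) (H≢∅ : Nonempty H) where
  open Subgraphs n
  open Relabelling n
  open Labellings n
  open Embeddings n H
  open Copies n
  open CopyCounts n
  open Maxima n
  open ≤-Reasoning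

  M : ℕ
  M = n ℕ.^ n

  instance
    M≢0 : ℕ.NonZero M
    M≢0 = ℕ.m^n≢0 n n

    ΔH≢0 : ℕ.NonZero (Δ H)
    ΔH≢0 = Δ≢0 {H} H≢∅

  -- 1024 = 16 · 64, where 16 ^ e ≥ 4 ^ v pays for falling factorials and 64 ^ e ≥ 4 v² for the packing.
  constant threshold : Surd
  constant = fromℚ (ι 1024) (0≤ι 1024)
  threshold = constant *ˢ Δ^[2/d⋆] H H≢∅ *ˢ q H H≢∅

  bound-threshold : ∀ {e x y s} → Bound (Δ^[2/d⋆] H H≢∅) e x 1 → Bound (q H H≢∅) e y s →
                    Bound threshold e (1024 ℕ.^ e * x * y) (1 * 1 * s)
  bound-threshold {e} bΔ bq = bound-* (constant *ˢ Δ^[2/d⋆] H H≢∅) (q H H≢∅)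
    (bound-* constant (Δ^[2/d⋆] H H≢∅) (bound-fromℚ 1024 e) bΔ) bq

  -- Every vertex of `V A` is an end of an edge, and an edge has two ends. Hence factors that grow
  -- with the number of vertices can be charged to the edges.
  v≤2e : ∀ A → v A ≤ 2 * e A
  v≤2e A = begin
    v A
      ≡⟨ ∣p∣≡count (V A) ⟩
    count (_∈? V A) (allFin n)
      ≤⟨ sumOver-mono (allFin n) (λ u → 𝟙≤ (u ∈? V A) λ u∈ → let x , x∈A , inc = ∈-setOf⁻ (covered? A) u∈ in
           count-∈ (λ x → (x ∈? A) ×-dec incident? u x) (∈-allFin x) (x∈A , inc)) ⟩
    sumOver (allFin n) (λ u → sumOver (allFin _) (λ x → 𝟙 ((x ∈? A) ×-dec incident? u x)))
      ≡⟨ sumOver-swap (allFin n) (allFin _) (λ u x → 𝟙 ((x ∈? A) ×-dec incident? u x)) ⟩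
    sumOver (allFin _) (λ x → sumOver (allFin n) (λ u → 𝟙 ((x ∈? A) ×-dec incident? u x)))
      ≡⟨ sumOver-cong (allFin _) (λ x → trans (sumOver-cong (allFin n) λ u → 𝟙-× (x ∈? A) (incident? u x))
           (sumOver-*ˡ (𝟙 (x ∈? A)) (allFin n) (λ u → 𝟙 (incident? u x)))) ⟩
    sumOver (allFin _) (λ x → 𝟙 (x ∈? A) * count (λ u → incident? u x) (allFin n))
      ≤⟨ sumOver-mono (allFin _) (λ x → ℕ.*-monoʳ-≤ (𝟙 (x ∈? A)) (two-ends x)) ⟩
    sumOver (allFin _) (λ x → 𝟙 (x ∈? A) * 2)
      ≡⟨ ∣p∣*≡sum A 2 ⟩
    e A * 2
      ≡⟨ ℕ.*-comm (e A) 2 ⟩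
    2 * e A ∎
    where
    two-ends : ∀ x → count (λ u → incident? u x) (allFin n) ≤ 2
    two-ends x = begin
      count (λ u → incident? u x) (allFin n)
        ≤⟨ sumOver-mono (allFin n) (λ u → 𝟙-⊎ (u Fin.≟ src x) (u Fin.≟ tgt x)) ⟩
      sumOver (allFin n) (λ u → 𝟙 (u Fin.≟ src x) + 𝟙 (u Fin.≟ tgt x))
        ≡⟨ sumOver-+ (allFin n) _ _ ⟩
      count (Fin._≟ src x) (allFin n) + count (Fin._≟ tgt x) (allFin n)
        ≤⟨ ℕ.+-mono-≤ (count-≤1 (Fin._≟ src x) (Unique.allFin⁺ n) λ p r → trans p (sym r))
                      (count-≤1 (Fin._≟ tgt x) (Unique.allFin⁺ n) λ p r → trans p (sym r)) ⟩
      2 ∎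

  embeddings≤M : ∀ A → embeddings A ≤ M
  embeddings≤M A = begin
    embeddings A                 ≤⟨ sumOver-mono maps (λ f → 𝟙≤ (embeds? A (V A) f) λ _ → ℕ.≤-refl) ⟩
    sumOver maps (λ _ → 1)       ≡⟨ sumOver-const maps 1 ⟩
    length maps * 1              ≡⟨ trans (ℕ.*-identityʳ _) (length-allMaps n n) ⟩
    M                            ∎

  module Densest (J : Graph) (J≢∅ : Nonempty J) (among : Among H (J , J≢∅)) (d≡ : d⋆ H H≢∅ ≡ averageDegree J J≢∅) where

    e₀ v₀ : ℕ
    e₀ = e J
    v₀ = v J

    instance
      e₀≢0 : ℕ.NonZero e₀
      e₀≢0 = e≢0 {J} J≢∅

    module ConnectedBound {D : Graph} (D≢∅ : Nonempty D) (C : Connected D (V D)) {w : ℕ} (v≡1+w : v D ≡ suc w) where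

      X d : ℕ
      X = embeddings D
      d = e D

      instance
        d≢0 : ℕ.NonZero d
        d≢0 = e≢0 {D} D≢∅

      -- `rooted-bound` summed over the `n` possible images of one vertex; that `n` cancels one
      -- factor of `n ^ v D`.
      X*n^w≤M*Δ^w : X * n ℕ.^ w ≤ M * Δ H ℕ.^ w
      X*n^w≤M*Δ^w = ℕ.*-cancelʳ-≤ _ _ (n * Δ H) {{ℕ.m*n≢0 n (Δ H)}} (begin
        X * n ℕ.^ w * (n * Δ H)                ≡⟨ rearrange X (n ℕ.^ w) n (Δ H) ⟩
        X * (n * n ℕ.^ w * Δ H)                ≡⟨ cong (λ l → X * (n ℕ.^ l * Δ H)) v≡1+w ⟨
        X * (n ℕ.^ v D * Δ H)                  ≤⟨ ℕ.*-monoˡ-≤ (n ℕ.^ v D * Δ H) by-root ⟩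
        sumOver (allFin n) (rooted D (V D) u) * (n ℕ.^ v D * Δ H)
                                               ≡⟨ sumOver-*ʳ (allFin n) (rooted D (V D) u) _ ⟨
        sumOver (allFin n) (λ z → rooted D (V D) u z * (n ℕ.^ v D * Δ H))
                                               ≤⟨ sumOver-mono (allFin n) (rooted-bound C u∈V) ⟩
        sumOver (allFin n) (λ _ → M * Δ H ℕ.^ v D)
                                               ≡⟨ trans (sumOver-const (allFin n) _) (cong (_* (M * Δ H ℕ.^ v D)) (length-allFin n)) ⟩
        n * (M * Δ H ℕ.^ v D)                  ≡⟨ cong (λ l → n * (M * Δ H ℕ.^ l)) v≡1+w ⟩
        n * (M * (Δ H * Δ H ℕ.^ w))            ≡⟨ rearrange′ n M (Δ H) (Δ H ℕ.^ w) ⟩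
        M * Δ H ℕ.^ w * (n * Δ H)              ∎)
        where
        u : Fin n
        u = src (proj₁ D≢∅)
        u∈V : u ∈ V D
        u∈V = ∈V⁺ {D} (∈⇒Adj {D} (proj₂ D≢∅))
        rearrange : ∀ a b c d → a * b * (c * d) ≡ a * (c * b * d)
        rearrange = solve-∀
        rearrange′ : ∀ a b c d → a * (b * (c * d)) ≡ b * d * (a * c)
        rearrange′ = solve-∀
        by-root : X ≤ sumOver (allFin n) (rooted D (V D) u)
        by-root = ℕ.≤-trans
          (sumOver-mono maps λ f → 𝟙≤ (embeds? D (V D) f) λ emb →
            count-∈ (λ z → rooted? D (V D) u z f) (∈-allFin (f ! u)) (emb , refl))
          (ℕ.≤-reflexive (sumOver-swap maps (allFin n) (λ f z → 𝟙 (rooted? D (V D) u z f))))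

      bound-Δ^v₀ : Bound (Δ^[2/d⋆] H H≢∅) (e₀ * d) ((Δ H ℕ.^ v₀) ℕ.^ d) (1 ℕ.^ d)
      bound-Δ^v₀ = bound-^ (Δ^[2/d⋆] H H≢∅) d (bound-Δ H H≢∅ {J} J≢∅ d≡)

      -- The densest subgraph alone gives q ≥ n^(-2/d⋆).
      sparse : d * v₀ ≤ w * e₀ → Bound threshold d (16 ℕ.^ d * X) M
      -- The power `e₀` makes the exponent d v₀ / e₀ = 2d/d⋆ integral.
      sparse dv₀≤we₀ = bound-root threshold e₀ (bound-weaken threshold {{s≢0}} (begin
        (16 ℕ.^ d * X) ℕ.^ e₀ * (1 * 1 * N₀)
          ≡⟨ cong₂ _*_ (^-distribʳ-* (16 ℕ.^ d) X e₀) (ℕ.*-identityˡ N₀) ⟩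
        (16 ℕ.^ d) ℕ.^ e₀ * X ℕ.^ e₀ * N₀
          ≤⟨ ℕ.*-monoˡ-≤ N₀ (ℕ.*-monoˡ-≤ (X ℕ.^ e₀) (ℕ.≤-trans (ℕ.^-monoˡ-≤ e₀ (ℕ.^-monoˡ-≤ d 16≤1024))
               (ℕ.≤-reflexive (ℕ.^-*-assoc 1024 d e₀)))) ⟩
        1024 ℕ.^ (d * e₀) * X ℕ.^ e₀ * N₀
          ≡⟨ ℕ.*-assoc (1024 ℕ.^ (d * e₀)) (X ℕ.^ e₀) N₀ ⟩
        1024 ℕ.^ (d * e₀) * (X ℕ.^ e₀ * N₀)
          ≤⟨ ℕ.*-monoʳ-≤ (1024 ℕ.^ (d * e₀)) powers ⟩
        1024 ℕ.^ (d * e₀) * (M ℕ.^ e₀ * Δ₀)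
          ≡⟨ rearrange (1024 ℕ.^ (d * e₀)) (M ℕ.^ e₀) Δ₀ ⟩
        1024 ℕ.^ (d * e₀) * Δ₀ * 1 * M ℕ.^ e₀ ∎) (bound-threshold
          (subst₂ (λ E s → Bound (Δ^[2/d⋆] H H≢∅) E Δ₀ s) (ℕ.*-comm e₀ d) (ℕ.^-zeroˡ d) bound-Δ^v₀)
          (subst₂ (λ E p → Bound (q H H≢∅) E p N₀) (ℕ.*-comm e₀ d) (ℕ.^-zeroˡ d)
            (bound-^ (q H H≢∅) d (bound-weaken (q H H≢∅) {{N≢0 J}} (ℕ.≤-trans (ℕ.≤-reflexive (ℕ.*-identityˡ (N J K)))
              (ℕ.≤-trans (N≤n^v J (ℕ.m+[n∸m]≡n (∣p∣≤n (V J)))) (ℕ.≤-reflexive (sym (ℕ.*-identityˡ (n ℕ.^ v₀))))))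
              (bound-q H H≢∅ {J} J≢∅ among))))))
        where
        N₀ Δ₀ r : ℕ
        N₀ = (n ℕ.^ v₀) ℕ.^ d
        Δ₀ = (Δ H ℕ.^ v₀) ℕ.^ d
        -- The surplus of the exponent `w` over 2d/d⋆, scaled by `e₀`; the factor (Δ/n)^r is at most
        -- 1 and is dropped in `powers`.
        r = w * e₀ ℕ.∸ d * v₀
        s≢0 : ℕ.NonZero (1 * 1 * N₀)
        s≢0 = ℕ.m*n≢0 1 N₀ {{_}} {{ℕ.m^n≢0 (n ℕ.^ v₀) d {{ℕ.m^n≢0 n v₀}}}}
        rearrange : ∀ a b c → a * (b * c) ≡ a * c * 1 * b
        rearrange = solve-∀
        split : ∀ y → (y ℕ.^ v₀) ℕ.^ d * y ℕ.^ r ≡ (y ℕ.^ w) ℕ.^ e₀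
        split y = trans (cong (_* y ℕ.^ r) (trans (ℕ.^-*-assoc y v₀ d) (cong (y ℕ.^_) (ℕ.*-comm v₀ d))))
          (trans (sym (ℕ.^-distribˡ-+-* y (d * v₀) r))
            (trans (cong (y ℕ.^_) (ℕ.m+[n∸m]≡n dv₀≤we₀)) (sym (ℕ.^-*-assoc y w e₀))))
        powers : X ℕ.^ e₀ * N₀ ≤ M ℕ.^ e₀ * Δ₀
        powers = ℕ.*-cancelʳ-≤ _ _ (n ℕ.^ r) {{ℕ.m^n≢0 n r}} (begin
          X ℕ.^ e₀ * N₀ * n ℕ.^ r               ≡⟨ ℕ.*-assoc (X ℕ.^ e₀) N₀ (n ℕ.^ r) ⟩
          X ℕ.^ e₀ * (N₀ * n ℕ.^ r)             ≡⟨ cong (X ℕ.^ e₀ *_) (split n) ⟩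
          X ℕ.^ e₀ * (n ℕ.^ w) ℕ.^ e₀           ≡⟨ ^-distribʳ-* X (n ℕ.^ w) e₀ ⟨
          (X * n ℕ.^ w) ℕ.^ e₀                  ≤⟨ ℕ.^-monoˡ-≤ e₀ X*n^w≤M*Δ^w ⟩
          (M * Δ H ℕ.^ w) ℕ.^ e₀                ≡⟨ ^-distribʳ-* M (Δ H ℕ.^ w) e₀ ⟩
          M ℕ.^ e₀ * (Δ H ℕ.^ w) ℕ.^ e₀         ≡⟨ cong (M ℕ.^ e₀ *_) (split (Δ H)) ⟨
          M ℕ.^ e₀ * (Δ₀ * Δ H ℕ.^ r)           ≤⟨ ℕ.*-monoʳ-≤ (M ℕ.^ e₀) (ℕ.*-monoʳ-≤ Δ₀ (ℕ.^-monoˡ-≤ r Δ≤n)) ⟩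
          M ℕ.^ e₀ * (Δ₀ * n ℕ.^ r)             ≡⟨ ℕ.*-assoc (M ℕ.^ e₀) Δ₀ (n ℕ.^ r) ⟨
          M ℕ.^ e₀ * Δ₀ * n ℕ.^ r               ∎)

      4v²≤64^d : 4 * (v D * v D) ≤ 64 ℕ.^ d
      4v²≤64^d = begin
        4 * (v D * v D)                   ≤⟨ ℕ.*-monoʳ-≤ 4 (ℕ.*-mono-≤ (v≤2e D) (v≤2e D)) ⟩
        4 * (2 * d * (2 * d))             ≡⟨ square d ⟩
        4 * d * (4 * d)                   ≤⟨ ℕ.*-mono-≤ (4e≤8^e d) (4e≤8^e d) ⟩
        8 ℕ.^ d * 8 ℕ.^ d                 ≡⟨ ^-distribʳ-* 8 8 d ⟨
        64 ℕ.^ d                          ∎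
        where
        square : ∀ d → 4 * (2 * d * (2 * d)) ≡ 4 * d * (4 * d)
        square = solve-∀

      open Packing H {D} D≢∅ C

      m : ℕ
      m = length images

      X*n^v≤ : X * n ℕ.^ v D ≤ m * (v D * v D) * (M * Δ H ℕ.^ w)
      X*n^v≤ = ℕ.*-cancelʳ-≤ _ _ (Δ H) (begin
        X * n ℕ.^ v D * Δ H                             ≡⟨ ℕ.*-assoc X _ (Δ H) ⟩
        X * (n ℕ.^ v D * Δ H)                           ≤⟨ embeddings-≤ ⟩
        m * (v D * (v D * (M * Δ H ℕ.^ v D)))           ≡⟨ cong (λ l → m * (v D * (v D * (M * Δ H ℕ.^ l)))) v≡1+w ⟩
        m * (v D * (v D * (M * (Δ H * Δ H ℕ.^ w))))     ≡⟨ rearrange m (v D) M (Δ H) (Δ H ℕ.^ w) ⟩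
        m * (v D * v D) * (M * Δ H ℕ.^ w) * Δ H         ∎)
        where
        rearrange : ∀ a b c d f → a * (b * (b * (c * (d * f)))) ≡ a * (b * b) * (c * f) * d
        rearrange = solve-∀

      -- The union of the packed copies has at most (n^v)^m / m! copies, so q^d ≥ m / (4 n^v).
      bound-packing : {{_ : ℕ.NonZero m}} → Bound (q H H≢∅) d m (4 * n ℕ.^ v D)
      bound-packing = bound-root (q H H≢∅) m (bound-weaken (q H H≢∅) {{N≢0 U}} (begin
        m ℕ.^ m * N U K                               ≤⟨ ℕ.*-monoˡ-≤ (N U K) (m^m≤4^m*m! m) ⟩
        4 ℕ.^ m * m ! * N U K                         ≡⟨ trans (ℕ.*-assoc (4 ℕ.^ m) (m !) _) (cong (4 ℕ.^ m *_) (ℕ.*-comm (m !) _)) ⟩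
        4 ℕ.^ m * (N U K * m !)                       ≤⟨ ℕ.*-monoʳ-≤ (4 ℕ.^ m) (N-⋃ {D} {images} images-apart
                                                           (images-all {Nonempty} image-nonempty) (images-all {λ G → G ≅ D} image-≅)) ⟩
        4 ℕ.^ m * N D K ℕ.^ m                         ≤⟨ ℕ.*-monoʳ-≤ (4 ℕ.^ m) (ℕ.^-monoˡ-≤ m (N≤n^v D (ℕ.m+[n∸m]≡n (∣p∣≤n (V D))))) ⟩
        4 ℕ.^ m * (n ℕ.^ v D) ℕ.^ m                   ≡⟨ ^-distribʳ-* 4 (n ℕ.^ v D) m ⟨
        (4 * n ℕ.^ v D) ℕ.^ m                         ≡⟨ ℕ.*-identityˡ _ ⟨
        1 * (4 * n ℕ.^ v D) ℕ.^ m                     ∎)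
        (subst (λ E → Bound (q H H≢∅) E 1 (N U K)) e[U]≡d*m (bound-q H H≢∅ {U} U≢∅ (⊆⇒Among {H} {U} U⊆H U≢∅))))
        where
        U : Graph
        U = ⋃ images
        U⊆H : U ⊆ H
        U⊆H x∈U = let _ , G∈ , x∈G = ∈-⋃⁻ images x∈U in images-all {λ G → ∀ {x} → x ∈ G → x ∈ H} (λ p → image⊆H p) G∈ x∈G
        U≢∅ : Nonempty U
        U≢∅ = first images refl
          where
          first : ∀ Gs → Gs ≡ images → Nonempty U
          first []       eq = contradiction (cong length eq) (ℕ.<⇒≢ (ℕ.>-nonZero⁻¹ m))
          first (G ∷ Gs) eq = let x , x∈G = images-all {Nonempty} image-nonempty {G} (subst (G ∈ˡ_) eq (here refl)) in
            x , ∈-⋃⁺ (subst (G ∈ˡ_) eq (here refl)) x∈G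
        e[U]≡d*m : e U ≡ d * m
        e[U]≡d*m = trans (∣⋃∣ images-apart (images-all {λ G → e G ≡ e D} e-image)) (ℕ.*-comm m d)

      -- The hypothesis is w ≤ 2d/d⋆, and Δ ≥ 1 lets the exponent grow.
      bound-Δ^w : w * e₀ ≤ d * v₀ → Bound (Δ^[2/d⋆] H H≢∅) d (Δ H ℕ.^ w) 1
      bound-Δ^w we₀≤dv₀ = bound-root (Δ^[2/d⋆] H H≢∅) e₀ (bound-weaken (Δ^[2/d⋆] H H≢∅) {{ℕ.m^n≢0 1 d}} (begin
        (Δ H ℕ.^ w) ℕ.^ e₀ * 1 ℕ.^ d          ≡⟨ trans (cong ((Δ H ℕ.^ w) ℕ.^ e₀ *_) (ℕ.^-zeroˡ d))
                                                   (trans (ℕ.*-identityʳ _) (ℕ.^-*-assoc (Δ H) w e₀)) ⟩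
        Δ H ℕ.^ (w * e₀)                      ≤⟨ ℕ.^-monoʳ-≤ (Δ H) we₀≤dv₀ ⟩
        Δ H ℕ.^ (d * v₀)                      ≡⟨ trans (cong (Δ H ℕ.^_) (ℕ.*-comm d v₀)) (sym (ℕ.^-*-assoc (Δ H) v₀ d)) ⟩
        (Δ H ℕ.^ v₀) ℕ.^ d                    ≡⟨ trans (sym (ℕ.*-identityʳ _)) (cong ((Δ H ℕ.^ v₀) ℕ.^ d *_) (sym (ℕ.^-zeroˡ e₀))) ⟩
        (Δ H ℕ.^ v₀) ℕ.^ d * 1 ℕ.^ e₀         ∎)
        (subst (λ E → Bound (Δ^[2/d⋆] H H≢∅) E ((Δ H ℕ.^ v₀) ℕ.^ d) (1 ℕ.^ d)) (ℕ.*-comm e₀ d) bound-Δ^v₀))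

      -- The size `m` of the packing, over which there is no control, cancels: it multiplies the
      -- bound on the embeddings and equally the lower bound m / (4 n^v) on q^d.
      dense : w * e₀ ≤ d * v₀ → Bound threshold d (16 ℕ.^ d * X) M
      dense we₀≤dv₀ = by-cases (m ℕ.≟ 0)
        where
        s≢0 : ℕ.NonZero (1 * 1 * (4 * n ℕ.^ v D))
        s≢0 = ℕ.m*n≢0 1 (4 * n ℕ.^ v D) {{_}} {{ℕ.m*n≢0 4 (n ℕ.^ v D) {{_}} {{ℕ.m^n≢0 n (v D)}}}}
        rearrange₁ : ∀ a b c → a * b * (1 * 1 * (4 * c)) ≡ a * 4 * (b * c)
        rearrange₁ = solve-∀
        rearrange₂ : ∀ a b c f g → a * 4 * (b * c * (f * g)) ≡ a * (4 * c) * (g * b * f)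
        rearrange₂ = solve-∀
        rearrange₃ : ∀ a b c f → a * (b * c * f) ≡ a * b * c * f
        rearrange₃ = solve-∀
        X≡0 : m ≡ 0 → X ≡ 0
        X≡0 m≡0 = ℕ.m*n≡0⇒m≡0 X (n ℕ.^ v D) {{ℕ.m^n≢0 n (v D)}} (ℕ.n≤0⇒n≡0
          (subst (λ l → X * n ℕ.^ v D ≤ l * (v D * v D) * (M * Δ H ℕ.^ w)) m≡0 X*n^v≤))
        by-cases : Dec (m ≡ 0) → Bound threshold d (16 ℕ.^ d * X) M
        -- With an empty packing there is no union to compare with `q`, but then `D` has no
        -- embedding at all.
        by-cases (yes m≡0) = subst (λ x → Bound threshold d x M)
          (sym (trans (cong (16 ℕ.^ d *_) (X≡0 m≡0)) (ℕ.*-zeroʳ (16 ℕ.^ d)))) (bound-0 threshold d M)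
        by-cases (no m≢0) = bound-weaken threshold {{s≢0}} (begin
          16 ℕ.^ d * X * (1 * 1 * (4 * n ℕ.^ v D))                        ≡⟨ rearrange₁ (16 ℕ.^ d) X (n ℕ.^ v D) ⟩
          16 ℕ.^ d * 4 * (X * n ℕ.^ v D)                                  ≤⟨ ℕ.*-monoʳ-≤ (16 ℕ.^ d * 4) X*n^v≤ ⟩
          16 ℕ.^ d * 4 * (m * (v D * v D) * (M * Δ H ℕ.^ w))              ≡⟨ rearrange₂ (16 ℕ.^ d) m (v D * v D) M (Δ H ℕ.^ w) ⟩
          16 ℕ.^ d * (4 * (v D * v D)) * (Δ H ℕ.^ w * m * M)              ≤⟨ ℕ.*-monoˡ-≤ (Δ H ℕ.^ w * m * M) (ℕ.*-monoʳ-≤ (16 ℕ.^ d) 4v²≤64^d) ⟩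
          16 ℕ.^ d * 64 ℕ.^ d * (Δ H ℕ.^ w * m * M)                       ≡⟨ cong (_* (Δ H ℕ.^ w * m * M)) (^-distribʳ-* 16 64 d) ⟨
          1024 ℕ.^ d * (Δ H ℕ.^ w * m * M)                                ≡⟨ rearrange₃ (1024 ℕ.^ d) (Δ H ℕ.^ w) m M ⟩
          1024 ℕ.^ d * Δ H ℕ.^ w * m * M                                  ∎)
          (bound-threshold (bound-Δ^w we₀≤dv₀) (bound-packing {{ℕ.≢-nonZero m≢0}}))

      connected-bound : Bound threshold d (16 ℕ.^ d * X) M
      connected-bound = [ sparse , dense ]′ (ℕ.≤-total (d * v₀) (w * e₀))

    embeddings-bound-∅ : ∀ A → ¬ Nonempty A → Bound threshold (e A) (16 ℕ.^ e A * embeddings A) M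
    embeddings-bound-∅ A A≡∅ = subst (λ E → Bound threshold E (16 ℕ.^ E * embeddings A) M) (sym e≡0)
      (bound-weaken threshold (begin
        1 * embeddings A * 1     ≡⟨ trans (ℕ.*-identityʳ _) (ℕ.*-identityˡ _) ⟩
        embeddings A             ≤⟨ embeddings≤M A ⟩
        M                        ≡⟨ ℕ.*-identityˡ M ⟨
        1 * M                    ∎) (bound-1 threshold))
      where
      e≡0 : e A ≡ 0
      e≡0 = trans (cong e (Empty-unique A≡∅)) (∣⊥∣≡0 (length edges))

    -- Splitting off one component multiplies the proportions of embeddings and adds the edge
    -- numbers. The component has an edge, so the remainder, possibly empty, has fewer edges than
    -- `A`.
    embeddings-bound-≢∅ : ∀ fuel A → e A ≤ fuel → Nonempty A → Bound threshold (e A) (16 ℕ.^ e A * embeddings A) M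

    embeddings-bound : ∀ fuel A → e A ≤ fuel → Bound threshold (e A) (16 ℕ.^ e A * embeddings A) M
    embeddings-bound fuel A e≤fuel = by-cases (nonempty? A)
      where
      by-cases : Dec (Nonempty A) → Bound threshold (e A) (16 ℕ.^ e A * embeddings A) M
      by-cases (no A≡∅)  = embeddings-bound-∅ A A≡∅
      by-cases (yes A≢∅) = embeddings-bound-≢∅ fuel A e≤fuel A≢∅

    embeddings-bound-≢∅ zero A e≤0 A≢∅ =
      contradiction (ℕ.n≤0⇒n≡0 e≤0) (ℕ.≢-nonZero⁻¹ (e A) {{e≢0 {A} A≢∅}})
    embeddings-bound-≢∅ (suc fuel) A e≤fuel A≢∅ = split (component A≢∅)
      where
      split : ∃[ D ] Nonempty D × Component A D → Bound threshold (e A) (16 ℕ.^ e A * embeddings A) M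
      split (D , D≢∅ , D⊆A , C , closed) = bound-weaken threshold {{ℕ.m*n≢0 M M}} (begin
        16 ℕ.^ e A * embeddings A * (M * M)             ≡⟨ rearrange (16 ℕ.^ e A) (embeddings A) M ⟩
        16 ℕ.^ e A * (embeddings A * M) * M             ≤⟨ ℕ.*-monoˡ-≤ M (ℕ.*-monoʳ-≤ (16 ℕ.^ e A)
                                                             (embeddings-disjoint {A} {D} {rest} D⊆A rest⊆A disjoint)) ⟩
        16 ℕ.^ e A * (embeddings D * embeddings rest) * M  ≡⟨ cong (λ x → x * (embeddings D * embeddings rest) * M)
                                                             (trans (cong (16 ℕ.^_) e[A]) (ℕ.^-distribˡ-+-* 16 (e D) (e rest))) ⟩
        16 ℕ.^ e D * 16 ℕ.^ e rest * (embeddings D * embeddings rest) * M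
          ≡⟨ cong (_* M) (interchange (16 ℕ.^ e D) (16 ℕ.^ e rest) (embeddings D) (embeddings rest)) ⟩
        16 ℕ.^ e D * embeddings D * (16 ℕ.^ e rest * embeddings rest) * M ∎)
        (subst (λ E → Bound threshold E (16 ℕ.^ e D * embeddings D * (16 ℕ.^ e rest * embeddings rest)) (M * M)) (sym e[A])
          (bound-+ threshold (ConnectedBound.connected-bound {D} D≢∅ C (sym (ℕ.suc-pred (v D) {{v≢0 {D} D≢∅}})))
            (embeddings-bound fuel rest e[rest]≤fuel)))
        where
        rest : Graph
        rest = A ∩ ∁ D
        rest⊆A : rest ⊆ A
        rest⊆A = p∩q⊆p A (∁ D)
        outside-D : ∀ {x} → x ∈ rest → x ∉ D
        outside-D x∈rest = x∈∁p⇒x∉p (proj₂ (x∈p∩q⁻ A (∁ D) x∈rest))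
        disjoint : ∀ {u} → u ∈ V D → u ∉ V rest
        disjoint u∈D u∈rest = let x , x∈rest , inc = ∈-setOf⁻ (covered? rest) u∈rest in closed (rest⊆A x∈rest) (outside-D x∈rest) inc u∈D
        D∪rest≡A : D ∪ rest ≡ A
        D∪rest≡A = ⊆-antisym (λ x∈ → [ D⊆A , rest⊆A ]′ (x∈p∪q⁻ D rest x∈)) λ {x} x∈A → x∈p∪q⁺ (side x x∈A)
          where
          side : ∀ x → x ∈ A → x ∈ D ⊎ x ∈ rest
          side x x∈A with x ∈? D
          ... | yes x∈D = inj₁ x∈D
          ... | no x∉D  = inj₂ (x∈p∩q⁺ (x∈A , x∉p⇒x∈∁p x∉D))
        e[A] : e A ≡ e D + e rest
        e[A] = trans (cong e (sym D∪rest≡A)) (∣p∪q∣≡∣p∣+∣q∣ D rest λ x∈D x∈rest → outside-D x∈rest x∈D)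
        e[rest]≤fuel : e rest ≤ fuel
        e[rest]≤fuel = ℕ.≤-pred (ℕ.≤-trans (ℕ.+-monoˡ-≤ (e rest) (ℕ.>-nonZero⁻¹ (e D) {{e≢0 {D} D≢∅}}))
          (subst (_≤ suc fuel) e[A] e≤fuel))
        rearrange : ∀ a b c → a * b * (c * c) ≡ a * (b * c) * c
        rearrange = solve-∀
        interchange : ∀ a b c f → a * b * (c * f) ≡ a * c * (b * f)
        interchange = solve-∀

    -- The share of copies that contain `A` is the proportion of embedding maps times n^v (n - v)! /
    -- n!, and that quotient is at most 4^v ≤ 16^e. The fibre size `L` cancels.
    copies-⊇-bound : ∀ A → Bound threshold (e A) (count (copyWith? H (A ⊆?_)) graphs) (N H K)
    copies-⊇-bound A = bound-weaken threshold (ℕ.*-cancelʳ-≤ _ _ (L * n ℕ.^ j) {{ℕ.m*n≢0 L (n ℕ.^ j) {{L≢0}} {{ℕ.m^n≢0 n j}}}} (begin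
      κ * M * (L * n ℕ.^ j)                           ≡⟨ rearrange₁ κ M L (n ℕ.^ j) ⟩
      n ℕ.^ j * (κ * L) * M                           ≡⟨ cong (_* M) (count-copies-⊇ H A v+j≡n) ⟩
      j ! * embeddings A * M                          ≡⟨ cong (j ! * embeddings A *_)
                                                           (trans (cong (n ℕ.^_) (sym v+j≡n)) (ℕ.^-distribˡ-+-* n (v A) j)) ⟩
      j ! * embeddings A * (n ℕ.^ v A * n ℕ.^ j)      ≡⟨ rearrange₂ (j !) (embeddings A) (n ℕ.^ v A) (n ℕ.^ j) ⟩
      embeddings A * (n ℕ.^ v A * j !) * n ℕ.^ j      ≤⟨ ℕ.*-monoˡ-≤ (n ℕ.^ j) (ℕ.*-monoʳ-≤ (embeddings A) falling) ⟩
      embeddings A * (16 ℕ.^ e A * n !) * n ℕ.^ j     ≡⟨ cong (λ x → embeddings A * (16 ℕ.^ e A * x) * n ℕ.^ j) (N*labellings H) ⟨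
      embeddings A * (16 ℕ.^ e A * (N H K * L)) * n ℕ.^ j ≡⟨ rearrange₃ (embeddings A) (16 ℕ.^ e A) (N H K) L (n ℕ.^ j) ⟩
      16 ℕ.^ e A * embeddings A * N H K * (L * n ℕ.^ j)   ∎)) (embeddings-bound (e A) A ℕ.≤-refl)
      where
      κ L j : ℕ
      κ = count (copyWith? H (A ⊆?_)) graphs
      L = labellings H H
      j = n ℕ.∸ v A
      v+j≡n : v A + j ≡ n
      v+j≡n = ℕ.m+[n∸m]≡n (∣p∣≤n (V A))
      L≢0 : ℕ.NonZero L
      L≢0 = ℕ.m*n≢0⇒n≢0 (N H K) {{subst ℕ.NonZero (sym (N*labellings H)) (ℕ.>-nonZero (ℕ.1≤n! n))}}
      falling : n ℕ.^ v A * j ! ≤ 16 ℕ.^ e A * n !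
      falling = begin
        n ℕ.^ v A * j !                ≡⟨ cong (λ l → l ℕ.^ v A * j !) v+j≡n ⟨
        (v A + j) ℕ.^ v A * j !        ≤⟨ n^v*j!≤4^v*n! (v A) j ⟩
        4 ℕ.^ v A * (v A + j) !        ≤⟨ ℕ.*-monoˡ-≤ ((v A + j) !) (ℕ.^-monoʳ-≤ 4 (v≤2e A)) ⟩
        4 ℕ.^ (2 * e A) * (v A + j) !  ≡⟨ cong₂ (λ x l → x * l !) (sym (ℕ.^-*-assoc 4 2 (e A))) v+j≡n ⟩
        16 ℕ.^ e A * n !               ∎
      rearrange₁ : ∀ a b c f → a * b * (c * f) ≡ f * (a * c) * b
      rearrange₁ = solve-∀
      rearrange₂ : ∀ a b c f → a * b * (c * f) ≡ b * (c * a) * f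
      rearrange₂ = solve-∀
      rearrange₃ : ∀ a b c f g → a * (b * (c * f)) * g ≡ b * a * c * (f * g)
      rearrange₃ = solve-∀

  prob-ν : ∀ A → ProbabilityMeasure.prob (ν H) (A ⊆?_) ℚ.* ι (N H K) ≡ ι (count (copyWith? H (A ⊆?_)) graphs)
  prob-ν A = trans (cong (ℚ._* ι (N H K)) (∑-indicator (isCopy? H K) ((ℤ.+ 1 / N H K) {{N≢0 H}}) (filter (A ⊆?_) graphs)))
    (trans (ℚ.*-assoc (ι k′) _ (ι (N H K)))
      (trans (cong (ι k′ ℚ.*_) (trans (ℚ.*-comm _ (ι (N H K))) (k/1*1/k (N H K) {{N≢0 H}})))
        (trans (ℚ.*-identityʳ (ι k′)) (cong ι k′≡k))))
    where
    k′ : ℕ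
    k′ = length (filter (isCopy? H K) (filter (A ⊆?_) graphs))
    k′≡k : k′ ≡ count (copyWith? H (A ⊆?_)) graphs
    k′≡k = trans (length-filter≡count (isCopy? H K) (filter (A ⊆?_) graphs))
      (trans (count-filter (isCopy? H K) (A ⊆?_) graphs)
        (count-cong (λ S → isCopy? H K S ×-dec (A ⊆? S)) (copyWith? H (A ⊆?_))
          (λ ((_ , φ) , s) → φ , s) (λ (φ , s) → (⊆⊤ , φ) , s) graphs))

  spread : Spread threshold (ν H)
  spread A A≢∅ = from-densest (maxOver-attained ℚ-totalOrder averageDegree H H≢∅)
    where
    open ProbabilityMeasure (ν H) using (prob; prob≥0)
    from-densest : ∃[ J ] ∃[ J≢∅ ] Among H (J , J≢∅) × d⋆ H H≢∅ ≡ averageDegree J J≢∅ →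
      fromℚ (prob (A ⊆?_)) (prob≥0 (A ⊆?_)) ≤ˢ threshold ^ˢ ∣ A ∣
    from-densest (J , J≢∅ , among , d≡) = bound⇒≤ˢ threshold {{N≢0 H}} (prob≥0 (A ⊆?_)) (prob-ν A)
      (Densest.copies-⊇-bound J J≢∅ among d≡ A)

theorem1p2 : ∃[ C ] (Positiveˢ C ×
    (∀ (n : ℕ) → let open Subgraphs n in
    (H : Graph) (H≢∅ : Nonempty H) →
    Spread (C *ˢ Δ^[2/d⋆] H H≢∅ *ˢ q H H≢∅) (ν H)))
theorem1p2 = fromℚ (ι 1024) (0≤ι 1024) , 0<ι 1024 , λ n H H≢∅ →
  -- An end of an edge of `H` is an element of `Fin n`, so `n` is nonzero.
  Spreading.spread n {{Fin.nonZeroIndex (proj₁ (Subgraphs.ends n (proj₁ H≢∅)))}} H H≢∅
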